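{- Let $k$ be a field, let $g$ and $d$ be natural numbers, and suppose that $M\in\mathrm{Rep}_k(\mathcal{G}_g^{\mathrm{op}})$ is $d$-smallish. Let $G$ be a graph of genus $g$, let $r$ be a natural number, and let $\underline v=(v_1,\dots,v_r)$ be an ordered $r$-tuple of distinct vertices of $G$. Then there exists a multivariate polynomial $f_{M,G,\underline v}(t_1,\dots,t_r)$ of total degree at most $d$ such that, if $\underline m=(m_1,\dots,m_r)$ is sufficiently large in every coordinate, $$\dim_k M(G(\underline v,\underline m))=f_{M,G,\underline v}(m_1,\dots,m_r).$$
   Context: A graph is a finite CW complex of dimension at most 1; 0-cells are vertices, 1-cells are edges (loops and multiple edges allowed). The genus of a non-empty connected graph is the rank of its first homology; a "graph of genus $g$" is always non-empty and connected. A map of CW complexes between graphs is very cellular if it takes every vertex to a vertex and every edge to either a vertex or an edge. A graph morphism is an equivalence class of very cellular maps under homotopy through very cellular maps. A contraction is a surjective graph morphism with contractible fibers (it amounts to collapsing a set of edges forming a forest, followed by a graph isomorphism). $\mathcal{G}_g$ is the category of graphs of genus $g$ with contractions as morphisms, and $\mathrm{Rep}_k(\mathcal{G}_g^{\mathrm{op}})$ is the category of functors from $\mathcal{G}_g^{\mathrm{op}}$ to $k$-modules. $M$ is finitely generated in degrees $\le d$ if there are finitely many graphs $G_1,\dots,G_s$ of genus $g$, each with at most $d$ edges, and elements $u_i\in M(G_i)$ such that for every $G$, $M(G)$ is spanned by the images of the $u_i$ under the maps $M(G_i)\to M(G)$ induced by all contractions $G\to G_i$. $M$ is $d$-small if it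 is a subquotient of a module that is finitely generated in degrees $\le d$, and $d$-smallish if it admits a (finite) filtration by submodules, $0=M_0\subset\dots\subset M_m=M$, whose associated graded module is $d$-small. For an $r$-tuple $\underline m=(m_1,\dots,m_r)$ of natural numbers, $G(\underline v,\underline m)$ is the graph obtained from $G$ by attaching, for each $i$, $m_i$ new edges to the vertex $v_i$, each having a new vertex (a leaf) as its other endpoint. "Sufficiently large in every coordinate" means that there is a constant $N$ such that the equality holds whenever $m_i\ge N$ for all $i$. The polynomial has rational coefficients. -}

module Defs where

open import Level using () renaming (suc to lsuc)
open import Algebra.Bundles using (CommutativeMonoid; CommutativeRing)
open import Algebra.Module.Bundles using (Module)
open import Algebra.Module.Structures.Biased using (IsModuleFromLeft)
open import Algebra.Module.Morphism.Structures using (module ModuleMorphisms)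
import Algebra.Definitions.RawMonoid as RawMonoidDefinitions
import Algebra.Definitions.RawSemiring as RawSemiringDefinitions
import Algebra.Module.Properties as ModuleProperties
import Algebra.Properties.Semiring.Sum as SemiringSum
open import Data.Bool.Base using (Bool; true; false; not; _xor_; if_then_else_)
open import Data.Bool.Properties using (not-involutive)
open import Data.Empty using (⊥-elim)
open import Data.Fin.Base using (Fin; zero; suc; _↑ˡ_; _↑ʳ_; splitAt; inject₁; fromℕ)
open import Data.Fin.Properties using (_≟_; splitAt-↑ˡ; splitAt-↑ʳ; join-splitAt; ↑ˡ-injective; ↑ʳ-injective)
open import Data.Integer.Base as ℤ using (ℤ; 0ℤ; 1ℤ; -1ℤ)
import Data.Integer.Properties as ℤ
open import Data.List.Base as List using (List)
open import Data.List.Relation.Unary.All using (All)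
open import Data.Nat.Base as ℕ using (ℕ; zero; suc)
open import Data.Product.Base using (Σ; Σ-syntax; ∃; ∃₂; ∃-syntax; _×_; _,_; proj₁; proj₂)
open import Data.Product using (∃!)
open import Data.Rational.Base as ℚ using (ℚ; 0ℚ)
open import Data.Sum.Base using (_⊎_; inj₁; inj₂; [_,_]′)
open import Data.Unit.Base using (⊤; tt)
open import Data.Vec.Functional using (Vector)
open import Function.Base using (_∘_; id)
open import Relation.Binary.Construct.Closure.ReflexiveTransitive as Star using (Star; ε; _◅_; _◅◅_)
open import Relation.Binary.PropositionalEquality
  using (_≡_; _≢_; refl; sym; trans; cong; cong₂; subst; module ≡-Reasoning)
open import Relation.Nullary using (¬_; yes; no; does)

open SemiringSum ℤ.+-*-semiring
  using (sum; sum-cong-≗; ∑-comm; *-distribˡ-sum; sum-replicate-zero)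

-- A finite CW complex of dimension at most 1, with a chosen
-- characteristic map [0,1] → G for each 1-cell: end e false and
-- end e true are the images of 0 and 1.  Morphisms (below) may reverse
-- edges, so the choice carries no information.

record Graph : Set where
  field
    #V #E : ℕ
    end   : Fin #E → Bool → Fin #V

  V E : Set
  V = Fin #V
  E = Fin #E

open Graph public using (V; E; #V; #E)

record Subgraph (G : Graph) : Set₁ where
  open Graph G using (end)
  field
    V∈     : V G → Set
    E∈     : E G → Set
    closed : ∀ {e} → E∈ e → ∀ s → V∈ (end e s)

whole : (G : Graph) → Subgraph G
whole G = record { V∈ = λ _ → ⊤ ; E∈ = λ _ → ⊤ ; closed = λ _ _ → tt }

δ : ∀ {n} → Fin n → Fin n → ℤ
δ i j = if does (i ≟ j) then 1ℤ else 0ℤ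

module _ {G : Graph} (S : Subgraph G) where
  open Graph G using (end)
  open Subgraph S

  Nonempty : Set
  Nonempty = ∃ V∈

  Adjacent : V G → V G → Set
  Adjacent u v = ∃₂ λ e s → E∈ e × end e s ≡ u × end e (not s) ≡ v

  Connected : Set
  Connected = ∀ u v → V∈ u → V∈ v → Star Adjacent u v

-- Cellular homology.  As there are no 2-cells, H₁ is the group of
-- integral 1-cycles, which is free; its rank is the size of a ℤ-basis.

Chain : Graph → Set
Chain G = E G → ℤ

module _ (G : Graph) where
  open Graph G using (end)

  incidence : E G → V G → ℤ
  incidence e v = δ (end e true) v ℤ.- δ (end e false) v

  ∂ : Chain G → V G → ℤ
  ∂ z v = sum (λ e → z e ℤ.* incidence e v)

combination : ∀ {G n} → (Fin n → ℤ) → (Fin n → Chain G) → Chain G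
combination a b e = sum (λ i → a i ℤ.* b i e)

module _ {G : Graph} (S : Subgraph G) where
  open Subgraph S

  record IsCycle (z : Chain G) : Set where
    field
      supported : ∀ e → ¬ E∈ e → z e ≡ 0ℤ
      boundary  : ∀ v → ∂ G z v ≡ 0ℤ

  record H₁HasRank (n : ℕ) : Set where
    field
      basis       : Fin n → Chain G
      isCycle     : ∀ i → IsCycle (basis i)
      spanning    : ∀ z → IsCycle z → ∃[ a ] (∀ e → z e ≡ combination {G} a basis e)
      independent : ∀ a → (∀ e → combination {G} a basis e ≡ 0ℤ) → ∀ i → a i ≡ 0ℤ

  -- A finite CW complex of dimension at most 1 is contractible exactly
  -- when it is a tree.
  record Contractible : Set where
    field
      nonempty  : Nonempty S
      connected : Connected S
      H₁-rank-0 : H₁HasRank 0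

record GraphOfGenus (g : ℕ) : Set where
  field
    graph     : Graph
    nonempty  : Nonempty (whole graph)
    connected : Connected (whole graph)
    genus     : H₁HasRank (whole graph) g

open GraphOfGenus public using (graph)

-- Where an edge can be sent: to a vertex, or onto an edge, where the
-- Boolean records whether the orientation is reversed.  For a loop the
-- two directions are different homotopy classes.

Cell : Graph → Set
Cell G = V G ⊎ (E G × Bool)

endᶜ : (G : Graph) → Cell G → Bool → V G
endᶜ G (inj₁ w)       s = w
endᶜ G (inj₂ (e , b)) s = Graph.end G e (b xor s)

reverseIf : ∀ {G} → Bool → Cell G → Cell G
reverseIf b (inj₁ w)       = inj₁ w
reverseIf b (inj₂ (e , c)) = inj₂ (e , b xor c)

-- A homotopy class of very cellular maps.  An edge collapsed up to
-- homotopy is recorded as sent to a vertex.  Maps winding an edge at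
-- least twice around a loop are left out; none of them is a contraction,
-- because the fibre over an interior point of the loop is disconnected.

record Morphism (G H : Graph) : Set where
  field
    onV        : V G → V H
    onE        : E G → Cell H
    compatible : ∀ e s → onV (Graph.end G e s) ≡ endᶜ H (onE e) s

open Morphism public

infix 4 _≈ₘ_

record _≈ₘ_ {G H : Graph} (φ ψ : Morphism G H) : Set where
  field
    ≈V : ∀ v → onV φ v ≡ onV ψ v
    ≈E : ∀ e → onE φ e ≡ onE ψ e

idₘ : ∀ {G} → Morphism G G
idₘ = record { onV = id ; onE = λ e → inj₂ (e , false) ; compatible = λ _ _ → refl }

endᶜ-reverseIf : ∀ G b (x : Cell G) s → endᶜ G (reverseIf {G} b x) s ≡ endᶜ G x (b xor s)
endᶜ-reverseIf G b (inj₁ w) s = refl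
endᶜ-reverseIf G true  (inj₂ (e , true))  s = cong (Graph.end G e) (sym (not-involutive s))
endᶜ-reverseIf G true  (inj₂ (e , false)) s = refl
endᶜ-reverseIf G false (inj₂ (e , c))     s = refl

onCell : ∀ {G H} → Morphism G H → Cell G → Cell H
onCell {H = H} ψ (inj₁ w)       = inj₁ (onV ψ w)
onCell {H = H} ψ (inj₂ (e , b)) = reverseIf {H} b (onE ψ e)

endᶜ-onCell : ∀ {G H} (ψ : Morphism G H) (x : Cell G) s →
              onV ψ (endᶜ G x s) ≡ endᶜ H (onCell ψ x) s
endᶜ-onCell ψ (inj₁ w) s = refl
endᶜ-onCell {H = H} ψ (inj₂ (e , b)) s =
  trans (compatible ψ e (b xor s)) (sym (endᶜ-reverseIf H b (onE ψ e) s))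

infixr 9 _∘ₘ_

_∘ₘ_ : ∀ {G H K} → Morphism H K → Morphism G H → Morphism G K
ψ ∘ₘ φ = record
  { onV        = onV ψ ∘ onV φ
  ; onE        = onCell ψ ∘ onE φ
  ; compatible = λ e s → trans (cong (onV ψ) (compatible φ e s)) (endᶜ-onCell ψ (onE φ e) s)
  }

MapsOnto : ∀ {G H} → Morphism G H → E G → E H → Set
MapsOnto φ e e′ = ∃[ b ] onE φ e ≡ inj₂ (e′ , b)

fibre : ∀ {G H} → Morphism G H → V H → Subgraph G
fibre φ w = record
  { V∈     = λ v → onV φ v ≡ w
  ; E∈     = λ e → onE φ e ≡ inj₁ w
  ; closed = λ {e} p s → trans (compatible φ e s) (cong (λ x → endᶜ _ x s) p)
  }

-- The fibre over an interior point of an edge e′ is the discrete set of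
-- edges mapping onto e′, which is contractible iff it has one element.
-- Surjectivity is implied, contractible spaces being non-empty.

record IsContraction {G H : Graph} (φ : Morphism G H) : Set where
  field
    vertexFibre : ∀ w → Contractible (fibre φ w)
    edgeFibre   : ∀ e′ → ∃! _≡_ (λ e → MapsOnto φ e e′)

record Contraction {g} (G H : GraphOfGenus g) : Set where
  field
    morphism      : Morphism (graph G) (graph H)
    isContraction : IsContraction morphism

open Contraction public using (morphism)

acyclic : ∀ {G} {S : Subgraph G} → H₁HasRank S 0 → ∀ z → IsCycle S z → ∀ e → z e ≡ 0ℤ
acyclic h z c = proj₂ (H₁HasRank.spanning h z c)

acyclic⇒H₁-rank-0 : ∀ {G} {S : Subgraph G} → (∀ z → IsCycle S z → ∀ e → z e ≡ 0ℤ) → H₁HasRank S 0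
acyclic⇒H₁-rank-0 h = record
  { basis       = λ ()
  ; isCycle     = λ ()
  ; spanning    = λ z c → (λ ()) , h z c
  ; independent = λ a _ ()
  }

sum-0 : ∀ {n} (f : Fin n → ℤ) → (∀ i → f i ≡ 0ℤ) → sum f ≡ 0ℤ
sum-0 {n} f h = trans (sum-cong-≗ h) (sum-replicate-zero n)

δ-refl : ∀ {n} (i : Fin n) → δ i i ≡ 1ℤ
δ-refl i with i ≟ i
... | yes _  = refl
... | no i≢i = ⊥-elim (i≢i refl)

δ-≢ : ∀ {n} {i j : Fin n} → i ≢ j → δ i j ≡ 0ℤ
δ-≢ {i = i} {j} i≢j with i ≟ j
... | yes i≡j = ⊥-elim (i≢j i≡j)
... | no _    = refl

sum-δ : ∀ {n} (f : Fin n → ℤ) i → sum (λ j → f j ℤ.* δ i j) ≡ f i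
sum-δ f zero = trans
  (cong₂ ℤ._+_ (ℤ.*-identityʳ (f zero)) (sum-0 _ (λ j → ℤ.*-zeroʳ (f (suc j)))))
  (ℤ.+-identityʳ (f zero))
sum-δ f (suc i) = trans
  (cong₂ ℤ._+_ (ℤ.*-zeroʳ (f zero)) (sum-δ (f ∘ suc) i))
  (ℤ.+-identityˡ (f (suc i)))

incidence-0 : ∀ G e v → (∀ s → Graph.end G e s ≢ v) → incidence G e v ≡ 0ℤ
incidence-0 G e v h = cong₂ ℤ._-_ (δ-≢ (h true)) (δ-≢ (h false))

sgn : Bool → ℤ
sgn false = 1ℤ
sgn true  = -1ℤ

coefficient : ∀ {G} → Cell G → Chain G
coefficient (inj₁ _)       e′ = 0ℤ
coefficient (inj₂ (e , b)) e′ = sgn b ℤ.* δ e e′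

pushforward : ∀ {G H} → Morphism G H → Chain G → Chain H
pushforward {H = H} φ z e′ = sum (λ e → z e ℤ.* coefficient {H} (onE φ e) e′)

incidenceᶜ : (H : Graph) → Cell H → V H → ℤ
incidenceᶜ H x v = δ (endᶜ H x true) v ℤ.- δ (endᶜ H x false) v

∂-coefficient : ∀ H (x : Cell H) v → ∂ H (coefficient {H} x) v ≡ incidenceᶜ H x v
∂-coefficient H (inj₁ w) v = trans
  (sum-0 _ (λ e′ → ℤ.*-zeroˡ (incidence H e′ v)))
  (sym (ℤ.+-inverseʳ (δ w v)))
∂-coefficient H (inj₂ (e , b)) v = begin
  sum (λ e′ → sgn b ℤ.* δ e e′ ℤ.* incidence H e′ v)   ≡⟨ sum-cong-≗ (λ e′ → rearrange (sgn b) (δ e e′) _) ⟩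
  sum (λ e′ → sgn b ℤ.* incidence H e′ v ℤ.* δ e e′)   ≡⟨ sum-δ (λ e′ → sgn b ℤ.* incidence H e′ v) e ⟩
  sgn b ℤ.* incidence H e v                            ≡⟨ orient b ⟩
  incidenceᶜ H (inj₂ (e , b)) v                        ∎
  where
  open ≡-Reasoning
  rearrange : ∀ x y w → x ℤ.* y ℤ.* w ≡ x ℤ.* w ℤ.* y
  rearrange x y w = trans (ℤ.*-assoc x y w) (trans (cong (x ℤ.*_) (ℤ.*-comm y w)) (sym (ℤ.*-assoc x w y)))
  orient : ∀ b → sgn b ℤ.* incidence H e v ≡ incidenceᶜ H (inj₂ (e , b)) v
  orient false = ℤ.*-identityˡ _
  orient true  = begin
    -1ℤ ℤ.* (t ℤ.- h)        ≡⟨ ℤ.-1*i≡-i (t ℤ.- h) ⟩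
    ℤ.- (t ℤ.- h)            ≡⟨ ℤ.neg-distrib-+ t (ℤ.- h) ⟩
    ℤ.- t ℤ.+ ℤ.- (ℤ.- h)    ≡⟨ cong (λ i → ℤ.- t ℤ.+ i) (ℤ.neg-involutive h) ⟩
    ℤ.- t ℤ.+ h              ≡⟨ ℤ.+-comm (ℤ.- t) h ⟩
    h ℤ.- t                  ∎
    where
    t h : ℤ
    t = δ (Graph.end H e true) v
    h = δ (Graph.end H e false) v

∂-pushforward : ∀ {G H} (φ : Morphism G H) z x →
                ∂ H (pushforward φ z) x ≡ sum (λ v → δ (onV φ v) x ℤ.* ∂ G z v)
∂-pushforward {G} {H} φ z x = begin
  sum (λ e′ → sum (λ e → z e ℤ.* c e e′) ℤ.* i′ e′)
    ≡⟨ sum-cong-≗ (λ e′ → *-distribʳ (i′ e′) (λ e → z e ℤ.* c e e′)) ⟩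
  sum (λ e′ → sum (λ e → z e ℤ.* c e e′ ℤ.* i′ e′))
    ≡⟨ ∑-comm (λ e′ e → z e ℤ.* c e e′ ℤ.* i′ e′) ⟩
  sum (λ e → sum (λ e′ → z e ℤ.* c e e′ ℤ.* i′ e′))
    ≡⟨ sum-cong-≗ (λ e → trans
         (sum-cong-≗ (λ e′ → ℤ.*-assoc (z e) (c e e′) (i′ e′)))
         (sym (*-distribˡ-sum (z e) (λ e′ → c e e′ ℤ.* i′ e′)))) ⟩
  sum (λ e → z e ℤ.* ∂ H (c e) x)
    ≡⟨ sum-cong-≗ (λ e → cong (z e ℤ.*_) (image e)) ⟩
  sum (λ e → z e ℤ.* sum (λ v → δ (onV φ v) x ℤ.* incidence G e v))
    ≡⟨ sum-cong-≗ (λ e → trans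
         (*-distribˡ-sum (z e) (λ v → δ (onV φ v) x ℤ.* incidence G e v))
         (sum-cong-≗ (λ v → rearrange (z e) (δ (onV φ v) x) (incidence G e v)))) ⟩
  sum (λ e → sum (λ v → δ (onV φ v) x ℤ.* (z e ℤ.* incidence G e v)))
    ≡⟨ ∑-comm (λ e v → δ (onV φ v) x ℤ.* (z e ℤ.* incidence G e v)) ⟩
  sum (λ v → sum (λ e → δ (onV φ v) x ℤ.* (z e ℤ.* incidence G e v)))
    ≡⟨ sum-cong-≗ (λ v → sym (*-distribˡ-sum (δ (onV φ v) x) (λ e → z e ℤ.* incidence G e v))) ⟩
  sum (λ v → δ (onV φ v) x ℤ.* ∂ G z v)
    ∎
  where
  open ≡-Reasoning
  c : E G → Chain H
  c e = coefficient {H} (onE φ e)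
  i′ : E H → ℤ
  i′ e′ = incidence H e′ x
  *-distribʳ : ∀ {n} (y : ℤ) (f : Fin n → ℤ) → sum f ℤ.* y ≡ sum (λ i → f i ℤ.* y)
  *-distribʳ y f = SemiringSum.*-distribʳ-sum ℤ.+-*-semiring y f
  rearrange : ∀ p q r → p ℤ.* (q ℤ.* r) ≡ q ℤ.* (p ℤ.* r)
  rearrange p q r = trans (sym (ℤ.*-assoc p q r)) (trans (cong (ℤ._* r) (ℤ.*-comm p q)) (ℤ.*-assoc q p r))
  sum-δ-difference : ∀ (f : V G → ℤ) u w → sum (λ v → f v ℤ.* (δ u v ℤ.- δ w v)) ≡ f u ℤ.- f w
  sum-δ-difference f u w = begin
    sum (λ v → f v ℤ.* (δ u v ℤ.- δ w v))
      ≡⟨ sum-cong-≗ (λ v → trans (ℤ.*-distribˡ-+ (f v) (δ u v) (ℤ.- δ w v))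
           (cong (λ i → f v ℤ.* δ u v ℤ.+ i) (trans (sym (ℤ.neg-distribʳ-* (f v) (δ w v))) (ℤ.neg-distribˡ-* (f v) (δ w v))))) ⟩
    sum (λ v → f v ℤ.* δ u v ℤ.+ (ℤ.- f v) ℤ.* δ w v)
      ≡⟨ SemiringSum.∑-distrib-+ ℤ.+-*-semiring (λ v → f v ℤ.* δ u v) (λ v → (ℤ.- f v) ℤ.* δ w v) ⟩
    sum (λ v → f v ℤ.* δ u v) ℤ.+ sum (λ v → (ℤ.- f v) ℤ.* δ w v)
      ≡⟨ cong₂ ℤ._+_ (sum-δ f u) (sum-δ (λ v → ℤ.- f v) w) ⟩
    f u ℤ.- f w ∎
  image : ∀ e → ∂ H (c e) x ≡ sum (λ v → δ (onV φ v) x ℤ.* incidence G e v)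
  image e = begin
    ∂ H (c e) x
      ≡⟨ ∂-coefficient H (onE φ e) x ⟩
    incidenceᶜ H (onE φ e) x
      ≡⟨ cong₂ (λ a b → δ a x ℤ.- δ b x) (sym (compatible φ e true)) (sym (compatible φ e false)) ⟩
    δ (onV φ (Graph.end G e true)) x ℤ.- δ (onV φ (Graph.end G e false)) x
      ≡⟨ sym (sum-δ-difference (λ v → δ (onV φ v) x) _ _) ⟩
    sum (λ v → δ (onV φ v) x ℤ.* incidence G e v) ∎

id-isContraction : ∀ {G} → IsContraction (idₘ {G})
id-isContraction = record
  { vertexFibre = λ w → record
      { nonempty  = w , refl
      ; connected = λ { u v refl refl → ε }
      ; H₁-rank-0 = acyclic⇒H₁-rank-0 (λ z c e → IsCycle.supported c e (λ ()))
      }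
  ; edgeFibre = λ e → e , (false , refl) , λ { (_ , refl) → refl }
  }

module _ {G H K : Graph} {ψ : Morphism H K} {φ : Morphism G H}
         (Ψ : IsContraction ψ) (Φ : IsContraction φ) where

  private
    module Ψ = IsContraction Ψ
    module Φ = IsContraction Φ

    inFibre : ∀ {w x} → onV ψ x ≡ w → ∀ {u v} →
              Adjacent (fibre φ x) u v → Adjacent (fibre (ψ ∘ₘ φ) w) u v
    inFibre p (e , s , q , a , b) = e , s , trans (cong (onCell ψ) q) (cong inj₁ p) , a , b

    withinFibre : ∀ {w x} → onV ψ x ≡ w → ∀ {u v} → onV φ u ≡ x → onV φ v ≡ x →
                  Star (Adjacent (fibre (ψ ∘ₘ φ) w)) u v
    withinFibre p {u} {v} q r =
      Star.map (inFibre p) (Contractible.connected (Φ.vertexFibre _) u v q r)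

    xor-not : ∀ b s → b xor not (b xor s) ≡ not s
    xor-not true  true  = refl
    xor-not true  false = refl
    xor-not false s     = refl

    xor-cancel : ∀ b s → b xor (b xor s) ≡ s
    xor-cancel true  s = not-involutive s
    xor-cancel false s = refl

    lift : ∀ {w x y} → onV ψ x ≡ w → Star (Adjacent (fibre ψ w)) x y →
           ∀ {u v} → onV φ u ≡ x → onV φ v ≡ y → Star (Adjacent (fibre (ψ ∘ₘ φ) w)) u v
    lift p ε q r = withinFibre p q r
    lift {w} p ((e′ , s , c , refl , refl) ◅ steps) {u} {v} q r with Φ.edgeFibre e′
    ... | e , (b , eq) , _ =
      withinFibre p q (trans (at t) (cong (Graph.end H e′) (xor-cancel b s)))
      ◅◅ (e , t , over , refl , refl)
      ◅ lift (Subgraph.closed (fibre ψ w) c (not s)) steps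
             (trans (at (not t)) (cong (Graph.end H e′) (xor-not b s))) r
      where
      t : Bool
      t = b xor s
      at : ∀ s′ → onV φ (Graph.end G e s′) ≡ Graph.end H e′ (b xor s′)
      at s′ = trans (compatible φ e s′) (cong (λ y → endᶜ H y s′) eq)
      over : onCell ψ (onE φ e) ≡ inj₁ w
      over = trans (cong (onCell ψ) eq) (cong (reverseIf {K} b) c)

    restrict : V H → Chain G → Chain G
    restrict x z e with onE φ e
    ... | inj₂ _ = 0ℤ
    ... | inj₁ y = if does (y ≟ x) then z e else 0ℤ

    module _ {w : V K} (z : Chain G) (c : IsCycle (fibre (ψ ∘ₘ φ) w) z) where

      open IsCycle c

      push-isCycle : IsCycle (fibre ψ w) (pushforward φ z)
      push-isCycle = record
        { supported = λ e′ e′∉ → sum-0 _ (λ e → outside e′ e′∉ e (onE φ e) refl)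
        ; boundary  = λ x → trans (∂-pushforward φ z x)
            (sum-0 _ (λ v → trans (cong (δ (onV φ v) x ℤ.*_) (boundary v)) (ℤ.*-zeroʳ (δ (onV φ v) x))))
        }
        where
        reverse-collapsed : ∀ b (y : Cell K) → reverseIf {K} b y ≡ inj₁ w → y ≡ inj₁ w
        reverse-collapsed b (inj₁ _) p = p
        outside : ∀ e′ → onE ψ e′ ≢ inj₁ w → ∀ e y → onE φ e ≡ y → z e ℤ.* coefficient {H} y e′ ≡ 0ℤ
        outside e′ e′∉ e (inj₁ _) p = ℤ.*-zeroʳ (z e)
        outside e′ e′∉ e (inj₂ (e″ , b)) p with e″ ≟ e′
        ... | no _ = trans (cong (z e ℤ.*_) (ℤ.*-zeroʳ (sgn b))) (ℤ.*-zeroʳ (z e))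
        ... | yes refl = cong (ℤ._* (sgn b ℤ.* 1ℤ)) (supported e (λ q →
                e′∉ (reverse-collapsed b (onE ψ e′) (trans (sym (cong (onCell ψ) p)) q))))

      vanishes-on-uncollapsed : ∀ e {e′ b} → onE φ e ≡ inj₂ (e′ , b) → z e ≡ 0ℤ
      vanishes-on-uncollapsed e {e′} {b} p = unit b (begin
        z e ℤ.* sgn b
          ≡⟨ sum-δ (λ f → z f ℤ.* sgn b) e ⟨
        sum (λ f → z f ℤ.* sgn b ℤ.* δ e f)
          ≡⟨ sum-cong-≗ term ⟩
        pushforward φ z e′
          ≡⟨ acyclic (Contractible.H₁-rank-0 (Ψ.vertexFibre w)) (pushforward φ z) push-isCycle e′ ⟩
        0ℤ ∎)
        where
        open ≡-Reasoning
        unit : ∀ b → z e ℤ.* sgn b ≡ 0ℤ → z e ≡ 0ℤ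
        unit false q = trans (sym (ℤ.*-identityʳ (z e))) q
        unit true  q = trans (sym (ℤ.neg-involutive (z e)))
          (cong ℤ.-_ (trans (sym (ℤ.-1*i≡-i (z e))) (trans (ℤ.*-comm -1ℤ (z e)) q)))
        unique : ∀ f → MapsOnto φ f e′ → e ≡ f
        unique f m = trans (sym (proj₂ (proj₂ (Φ.edgeFibre e′)) (b , p))) (proj₂ (proj₂ (Φ.edgeFibre e′)) m)
        term : ∀ f → z f ℤ.* sgn b ℤ.* δ e f ≡ z f ℤ.* coefficient {H} (onE φ f) e′
        term f with e ≟ f
        ... | yes refl rewrite p | δ-refl e′ = trans (ℤ.*-assoc (z e) (sgn b) 1ℤ) refl
        ... | no e≢f = trans (ℤ.*-zeroʳ (z f ℤ.* sgn b)) (sym (trans (cong (z f ℤ.*_) (other (onE φ f) refl)) (ℤ.*-zeroʳ (z f))))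
          where
          other : ∀ y → onE φ f ≡ y → coefficient {H} y e′ ≡ 0ℤ
          other (inj₁ _) q = refl
          other (inj₂ (e″ , b′)) q with e″ ≟ e′
          ... | yes refl = ⊥-elim (e≢f (unique f (b′ , q)))
          ... | no _     = ℤ.*-zeroʳ (sgn b′)

      restrict-isCycle : ∀ x → IsCycle (fibre φ x) (restrict x z)
      restrict-isCycle x = record { supported = supp ; boundary = bound }
        where
        supp : ∀ e → onE φ e ≢ inj₁ x → restrict x z e ≡ 0ℤ
        supp e e∉ with onE φ e
        ... | inj₂ _ = refl
        ... | inj₁ y with y ≟ x
        ...   | yes refl = ⊥-elim (e∉ refl)
        ...   | no _     = refl
        collapsed : ∀ {e y} → onE φ e ≡ inj₁ y → ∀ s → onV φ (Graph.end G e s) ≡ y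
        collapsed {e} p s = trans (compatible φ e s) (cong (λ c → endᶜ H c s) p)
        same : ∀ v → onV φ v ≡ x → ∀ e → restrict x z e ℤ.* incidence G e v ≡ z e ℤ.* incidence G e v
        same v q e with onE φ e in p
        ... | inj₂ _ = cong (ℤ._* incidence G e v) (sym (vanishes-on-uncollapsed e p))
        ... | inj₁ y with y ≟ x
        ...   | yes _  = refl
        ...   | no y≢x = sym (trans (cong (z e ℤ.*_) (incidence-0 G e v (λ s r →
                  y≢x (trans (sym (collapsed p s)) (trans (cong (onV φ) r) q))))) (ℤ.*-zeroʳ (z e)))
        none : ∀ v → onV φ v ≢ x → ∀ e → restrict x z e ℤ.* incidence G e v ≡ 0ℤ
        none v q e with onE φ e in p
        ... | inj₂ _ = refl
        ... | inj₁ y with y ≟ x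
        ...   | no _     = refl
        ...   | yes refl = trans (cong (z e ℤ.*_) (incidence-0 G e v (λ s r →
                  q (trans (cong (onV φ) (sym r)) (collapsed p s))))) (ℤ.*-zeroʳ (z e))
        bound : ∀ v → ∂ G (restrict x z) v ≡ 0ℤ
        bound v with onV φ v ≟ x
        ... | yes q = trans (sum-cong-≗ (same v q)) (boundary v)
        ... | no q  = sum-0 _ (none v q)

      vanishes : ∀ e → z e ≡ 0ℤ
      vanishes e = by-cases (onE φ e) refl
        where
        restrict-collapsed : ∀ {x} → onE φ e ≡ inj₁ x → restrict x z e ≡ z e
        restrict-collapsed {x} p rewrite p with x ≟ x
        ... | yes _  = refl
        ... | no x≢x = ⊥-elim (x≢x refl)
        by-cases : ∀ y → onE φ e ≡ y → z e ≡ 0ℤ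
        by-cases (inj₂ _) p = vanishes-on-uncollapsed e p
        by-cases (inj₁ x) p = trans (sym (restrict-collapsed p))
          (acyclic (Contractible.H₁-rank-0 (Φ.vertexFibre x)) (restrict x z) (restrict-isCycle x) e)

  ∘-isContraction : IsContraction (ψ ∘ₘ φ)
  ∘-isContraction = record
    { vertexFibre = λ w → record
        { nonempty  = let x , p = Contractible.nonempty (Ψ.vertexFibre w)
                          v , q = Contractible.nonempty (Φ.vertexFibre x)
                      in v , trans (cong (onV ψ) q) p
        ; connected = λ u v p q →
            lift p (Contractible.connected (Ψ.vertexFibre w) _ _ p q) refl refl
        ; H₁-rank-0 = acyclic⇒H₁-rank-0 vanishes
        }
    ; edgeFibre = edgeFibre
    }
    where
    edgeFibre : ∀ e″ → ∃! _≡_ (λ e → MapsOnto (ψ ∘ₘ φ) e e″)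
    edgeFibre e″ with Ψ.edgeFibre e″
    ... | e′ , (b′ , p′) , uniq′ with Φ.edgeFibre e′
    ...   | e , (b , p) , uniq =
      e , (b xor b′ , trans (cong (onCell ψ) p) (cong (reverseIf {K} b) p′)) ,
      λ { {f} (a , q) → via f a q (onE φ f) refl }
      where
      via : ∀ f a → onCell ψ (onE φ f) ≡ inj₂ (e″ , a) → ∀ y → onE φ f ≡ y → e ≡ f
      via f a q y r with trans (sym (cong (onCell ψ) r)) q
      via f a q (inj₂ (f′ , d)) r | q′ with onE ψ f′ in s
      via f a q (inj₂ (f′ , d)) r | refl | inj₂ (_ , h) =
        uniq (d , trans r (cong (λ k → inj₂ (k , d)) (sym (uniq′ (h , s)))))

idᶜ : ∀ {g} {G : GraphOfGenus g} → Contraction G G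
idᶜ = record { morphism = idₘ ; isContraction = id-isContraction }

infixr 9 _∘ᶜ_

_∘ᶜ_ : ∀ {g} {G H K : GraphOfGenus g} → Contraction H K → Contraction G H → Contraction G K
ψ ∘ᶜ φ = record
  { morphism      = morphism ψ ∘ₘ morphism φ
  ; isContraction = ∘-isContraction (Contraction.isContraction ψ) (Contraction.isContraction φ)
  }

-- attachLeaves G k at has k new edges; the j-th one joins at j to a new
-- vertex #V G ↑ʳ j.

attachLeaves : (G : Graph) (k : ℕ) → (Fin k → V G) → Graph
attachLeaves G k at = record
  { #V  = #V G ℕ.+ k
  ; #E  = #E G ℕ.+ k
  ; end = λ e s → [ (λ e₀ → Graph.end G e₀ s ↑ˡ k)
                  , (λ j → if s then #V G ↑ʳ j else at j ↑ˡ k)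
                  ]′ (splitAt (#E G) e)
  }

sum-++ : ∀ m {n} (f : Fin (m ℕ.+ n) → ℤ) → sum f ≡ sum (λ i → f (i ↑ˡ n)) ℤ.+ sum (λ j → f (m ↑ʳ j))
sum-++ zero    f = sym (ℤ.+-identityˡ (sum f))
sum-++ (suc m) f = trans (cong (ℤ._+_ (f zero)) (sum-++ m (f ∘ suc))) (sym (ℤ.+-assoc (f zero) _ _))

splitCases : ∀ m {n} (P : Fin (m ℕ.+ n) → Set) → (∀ i → P (i ↑ˡ n)) → (∀ j → P (m ↑ʳ j)) → ∀ i → P i
splitCases m {n} P l r i with splitAt m i | join-splitAt m n i
... | inj₁ i′ | p = subst P p (l i′)
... | inj₂ j  | p = subst P p (r j)

↑ˡ≢↑ʳ : ∀ {m n} (i : Fin m) (j : Fin n) → i ↑ˡ n ≢ m ↑ʳ j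
↑ˡ≢↑ʳ {m} {n} i j p with trans (sym (splitAt-↑ˡ m i n)) (trans (cong (splitAt m) p) (splitAt-↑ʳ m n j))
... | ()

δ-injective : ∀ {m n} (f : Fin m → Fin n) → (∀ {i j} → f i ≡ f j → i ≡ j) → ∀ i j → δ (f i) (f j) ≡ δ i j
δ-injective f inj i j with i ≟ j
... | yes refl = δ-refl (f i)
... | no i≢j   = δ-≢ (i≢j ∘ inj)

module _ (G : Graph) (k : ℕ) (at : Fin k → V G) where

  private
    G⁺ : Graph
    G⁺ = attachLeaves G k at

    old : ∀ e s → Graph.end G⁺ (e ↑ˡ k) s ≡ Graph.end G e s ↑ˡ k
    old e s rewrite splitAt-↑ˡ (#E G) e k = refl

    new : ∀ j s → Graph.end G⁺ (#E G ↑ʳ j) s ≡ (if s then #V G ↑ʳ j else at j ↑ˡ k)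
    new j s rewrite splitAt-↑ʳ (#E G) k j = refl

    old-old : ∀ e v → incidence G⁺ (e ↑ˡ k) (v ↑ˡ k) ≡ incidence G e v
    old-old e v = cong₂ ℤ._-_ (one true) (one false)
      where
      one : ∀ s → δ (Graph.end G⁺ (e ↑ˡ k) s) (v ↑ˡ k) ≡ δ (Graph.end G e s) v
      one s = trans (cong (λ u → δ u (v ↑ˡ k)) (old e s)) (δ-injective (_↑ˡ k) (↑ˡ-injective k _ _) (Graph.end G e s) v)

    old-new : ∀ e j → incidence G⁺ (e ↑ˡ k) (#V G ↑ʳ j) ≡ 0ℤ
    old-new e j = incidence-0 G⁺ (e ↑ˡ k) (#V G ↑ʳ j) (λ s p → ↑ˡ≢↑ʳ _ j (trans (sym (old e s)) p))

    new-new : ∀ i j → incidence G⁺ (#E G ↑ʳ i) (#V G ↑ʳ j) ≡ δ j i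
    new-new i j = trans
      (cong₂ ℤ._-_
        (trans (cong (λ u → δ u (#V G ↑ʳ j)) (new i true)) (δ-injective (#V G ↑ʳ_) (↑ʳ-injective (#V G) _ _) i j))
        (δ-≢ (λ p → ↑ˡ≢↑ʳ (at i) j (trans (sym (new i false)) p))))
      (trans (ℤ.+-identityʳ (δ i j)) (δ-sym i j))
      where
      δ-sym : ∀ {n} (a b : Fin n) → δ a b ≡ δ b a
      δ-sym a b with a ≟ b
      ... | yes refl = sym (δ-refl a)
      ... | no a≢b   = sym (δ-≢ (a≢b ∘ sym))

    ∂-old : ∀ z → (∀ j → z (#E G ↑ʳ j) ≡ 0ℤ) → ∀ v → ∂ G⁺ z (v ↑ˡ k) ≡ ∂ G (λ e → z (e ↑ˡ k)) v
    ∂-old z h v = trans (sum-++ (#E G) (λ e → z e ℤ.* incidence G⁺ e (v ↑ˡ k))) (trans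
      (cong₂ ℤ._+_
        (sum-cong-≗ (λ e → cong (z (e ↑ˡ k) ℤ.*_) (old-old e v)))
        (sum-0 _ (λ j → cong (ℤ._* incidence G⁺ (#E G ↑ʳ j) (v ↑ˡ k)) (h j))))
      (ℤ.+-identityʳ _))

    ∂-new : ∀ z j → ∂ G⁺ z (#V G ↑ʳ j) ≡ z (#E G ↑ʳ j)
    ∂-new z j = trans (sum-++ (#E G) (λ e → z e ℤ.* incidence G⁺ e (#V G ↑ʳ j))) (trans
      (cong₂ ℤ._+_
        (sum-0 _ (λ e → trans (cong (z (e ↑ˡ k) ℤ.*_) (old-new e j)) (ℤ.*-zeroʳ (z (e ↑ˡ k)))))
        (trans (sum-cong-≗ (λ i → cong (z (#E G ↑ʳ i) ℤ.*_) (new-new i j))) (sum-δ (λ i → z (#E G ↑ʳ i)) j)))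
      (ℤ.+-identityˡ _))

    extend : Chain G → Chain G⁺
    extend z e = [ z , (λ _ → 0ℤ) ]′ (splitAt (#E G) e)

    extend-old : ∀ z e → extend z (e ↑ˡ k) ≡ z e
    extend-old z e rewrite splitAt-↑ˡ (#E G) e k = refl

    extend-new : ∀ z j → extend z (#E G ↑ʳ j) ≡ 0ℤ
    extend-new z j rewrite splitAt-↑ʳ (#E G) k j = refl

    ∂-cong : ∀ {y z : Chain G} → (∀ e → y e ≡ z e) → ∀ v → ∂ G y v ≡ ∂ G z v
    ∂-cong h v = sum-cong-≗ (λ e → cong (ℤ._* incidence G e v) (h e))

    oldWalk : ∀ {u v} → Star (Adjacent (whole G)) u v → Star (Adjacent (whole G⁺)) (u ↑ˡ k) (v ↑ˡ k)
    oldWalk = Star.gmap (_↑ˡ k) (λ { (e , s , _ , refl , refl) → e ↑ˡ k , s , tt , old e s , old e (not s) })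

    toLeaf : ∀ j → Star (Adjacent (whole G⁺)) (at j ↑ˡ k) (#V G ↑ʳ j)
    toLeaf j = (#E G ↑ʳ j , false , tt , new j false , new j true) ◅ ε

    fromLeaf : ∀ j → Star (Adjacent (whole G⁺)) (#V G ↑ʳ j) (at j ↑ˡ k)
    fromLeaf j = (#E G ↑ʳ j , true , tt , new j true , new j false) ◅ ε

  attachLeaves-connected : Connected (whole G) → Connected (whole G⁺)
  attachLeaves-connected c u v _ _ = splitCases (#V G) (λ u → Star (Adjacent (whole G⁺)) u v)
    (λ u → splitCases (#V G) (Star (Adjacent (whole G⁺)) (u ↑ˡ k))
      (λ v → oldWalk (c u v tt tt))
      (λ j → oldWalk (c u (at j) tt tt) ◅◅ toLeaf j) v)
    (λ i → splitCases (#V G) (Star (Adjacent (whole G⁺)) (#V G ↑ʳ i))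
      (λ v → fromLeaf i ◅◅ oldWalk (c (at i) v tt tt))
      (λ j → fromLeaf i ◅◅ oldWalk (c (at i) (at j) tt tt) ◅◅ toLeaf j) v) u

  attachLeaves-H₁ : ∀ {n} → H₁HasRank (whole G) n → H₁HasRank (whole G⁺) n
  attachLeaves-H₁ h = record
    { basis       = λ i → extend (basis i)
    ; isCycle     = λ i → record
        { supported = λ e e∉ → ⊥-elim (e∉ tt)
        ; boundary  = splitCases (#V G) (λ v → ∂ G⁺ (extend (basis i)) v ≡ 0ℤ)
            (λ v → trans (∂-old (extend (basis i)) (extend-new (basis i)) v)
              (trans (∂-cong (extend-old (basis i)) v) (IsCycle.boundary (isCycle i) v)))
            (λ j → trans (∂-new (extend (basis i)) j) (extend-new (basis i) j))
        }
    ; spanning    = λ z c →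
        let leaf : ∀ j → z (#E G ↑ʳ j) ≡ 0ℤ
            leaf j = trans (sym (∂-new z j)) (IsCycle.boundary c (#V G ↑ʳ j))
            a , p = spanning (λ e → z (e ↑ˡ k)) (record
              { supported = λ e e∉ → ⊥-elim (e∉ tt)
              ; boundary  = λ v → trans (sym (∂-old z leaf v)) (IsCycle.boundary c (v ↑ˡ k))
              })
        in a , splitCases (#E G) (λ e → z e ≡ combination {G⁺} a (λ i → extend (basis i)) e)
          (λ e → trans (p e) (sym (combination-old a e)))
          (λ j → trans (leaf j) (sym (sum-0 _ (λ i →
            trans (cong (a i ℤ.*_) (extend-new (basis i) j)) (ℤ.*-zeroʳ (a i))))))
    ; independent = λ a p → independent a (λ e → trans (sym (combination-old a e)) (p (e ↑ˡ k)))
    }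
    where
    open H₁HasRank h
    combination-old : ∀ a e → combination {G⁺} a (λ i → extend (basis i)) (e ↑ˡ k) ≡ combination {G} a basis e
    combination-old a e = sum-cong-≗ (λ i → cong (a i ℤ.*_) (extend-old (basis i) e))

∑ℕ : ∀ {n} → Vector ℕ n → ℕ
∑ℕ = RawMonoidDefinitions.sum ℕ.+-0-rawMonoid

-- Fin (∑ℕ m) is the disjoint union of the Fin (m i); block m tells
-- which summand an element lies in.

block : ∀ {r} (m : Vector ℕ r) → Fin (∑ℕ m) → Fin r
block {suc r} m j = [ (λ _ → zero) , (λ j′ → suc (block (m ∘ suc) j′)) ]′ (splitAt (m zero) j)

-- G(v, m): for each i, m i new leaves at the vertex v i.

_⟨_,_⟩ : ∀ {g r} (G : GraphOfGenus g) → Vector (V (graph G)) r → Vector ℕ r → GraphOfGenus g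
G ⟨ v , m ⟩ = record
  { graph     = attachLeaves (graph G) (∑ℕ m) (v ∘ block m)
  ; nonempty  = proj₁ (GraphOfGenus.nonempty G) ↑ˡ ∑ℕ m , tt
  ; connected = attachLeaves-connected (graph G) (∑ℕ m) (v ∘ block m) (GraphOfGenus.connected G)
  ; genus     = attachLeaves-H₁ (graph G) (∑ℕ m) (v ∘ block m) (GraphOfGenus.genus G)
  }

record Field c : Set (lsuc c) where
  field
    commutativeRing : CommutativeRing c c
  open CommutativeRing commutativeRing public
  field
    1≉0     : ¬ (1# ≈ 0#)
    inverse : ∀ x → ¬ (x ≈ 0#) → ∃[ y ] (x * y ≈ 1#)

module LinearAlgebra {c} (R : CommutativeRing c c) where

  open CommutativeRing R using (ring; 0#; 1#; -_) renaming (Carrier to K; _≈_ to _≈ᴷ_)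

  module _ (A : Module R c c) where
    open Module A

    ∑ᴹ : ∀ {n} → Vector Carrierᴹ n → Carrierᴹ
    ∑ᴹ = RawMonoidDefinitions.sum +ᴹ-rawMonoid

    InSpan : {I : Set} → (I → Carrierᴹ) → Carrierᴹ → Set c
    InSpan {I} u x = ∃[ n ] Σ[ a ∈ Vector K n ] Σ[ i ∈ Vector I n ] x ≈ᴹ ∑ᴹ (λ j → a j *ₗ u (i j))

    record HasDimension (n : ℕ) : Set c where
      field
        basis       : Vector Carrierᴹ n
        spanning    : ∀ x → InSpan basis x
        independent : ∀ (a : Vector K n) → ∑ᴹ (λ i → a i *ₗ basis i) ≈ᴹ 0ᴹ → ∀ i → a i ≈ᴷ 0#

    record IsSubmodule (S : Carrierᴹ → Set c) : Set c where
      field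
        resp : ∀ {x y} → x ≈ᴹ y → S x → S y
        0∈   : S 0ᴹ
        +∈   : ∀ {x y} → S x → S y → S (x +ᴹ y)
        *ₗ∈  : ∀ a {x} → S x → S (a *ₗ x)

      -∈ : ∀ {x} → S x → S (-ᴹ x)
      -∈ {x} s = resp (inverseˡ-uniqueᴹ ((- 1#) *ₗ x) x -1*x+x≈0) (*ₗ∈ (- 1#) s)
        where
        open ModuleProperties A using (inverseˡ-uniqueᴹ)
        -1*x+x≈0 : (- 1#) *ₗ x +ᴹ x ≈ᴹ 0ᴹ
        -1*x+x≈0 =
          ≈ᴹ-trans (+ᴹ-congˡ (≈ᴹ-sym (*ₗ-identityˡ x)))
          (≈ᴹ-trans (≈ᴹ-sym (*ₗ-distribʳ x (- 1#) 1#))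
          (≈ᴹ-trans (*ₗ-cong (CommutativeRing.-‿inverseˡ R 1#) ≈ᴹ-refl) (*ₗ-zeroˡ x)))

    module _ {S T : Carrierᴹ → Set c} (isS : IsSubmodule S) (isT : IsSubmodule T) where

      private
        module S = IsSubmodule isS
        module T = IsSubmodule isT
        open import Algebra.Properties.AbelianGroup +ᴹ-abelianGroup
          using (⁻¹-∙-comm; ⁻¹-involutive)
        open import Algebra.Properties.CommutativeSemigroup
          (CommutativeMonoid.commutativeSemigroup +ᴹ-commutativeMonoid)
          using (interchange)

        infix 4 _∼_
        _∼_ : Carrierᴹ → Carrierᴹ → Set c
        x ∼ y = T (x +ᴹ -ᴹ y)

        ≈⇒∼ : ∀ {x y} → x ≈ᴹ y → x ∼ y
        ≈⇒∼ {y = y} p = T.resp (≈ᴹ-sym (≈ᴹ-trans (+ᴹ-congʳ p) (-ᴹ‿inverseʳ y))) T.0∈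

        ∼-sym : ∀ {x y} → x ∼ y → y ∼ x
        ∼-sym {x} {y} h = T.resp
          (≈ᴹ-trans (≈ᴹ-sym (⁻¹-∙-comm x (-ᴹ y)))
          (≈ᴹ-trans (+ᴹ-congˡ (⁻¹-involutive y)) (+ᴹ-comm (-ᴹ x) y)))
          (T.-∈ h)

        ∼-trans : ∀ {x y z} → x ∼ y → y ∼ z → x ∼ z
        ∼-trans {x} {y} {z} h₁ h₂ = T.resp
          (≈ᴹ-trans (+ᴹ-assoc x (-ᴹ y) (y +ᴹ -ᴹ z))
          (+ᴹ-congˡ (≈ᴹ-trans (≈ᴹ-sym (+ᴹ-assoc (-ᴹ y) y (-ᴹ z)))
            (≈ᴹ-trans (+ᴹ-congʳ (-ᴹ‿inverseˡ y)) (+ᴹ-identityˡ (-ᴹ z))))))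
          (T.+∈ h₁ h₂)

        +-cong : ∀ {x x′ y y′} → x ∼ x′ → y ∼ y′ → (x +ᴹ y) ∼ (x′ +ᴹ y′)
        +-cong {x} {x′} {y} {y′} h₁ h₂ = T.resp
          (≈ᴹ-trans (interchange x (-ᴹ x′) y (-ᴹ y′)) (+ᴹ-congˡ (⁻¹-∙-comm x′ y′)))
          (T.+∈ h₁ h₂)

        -‿cong : ∀ {x y} → x ∼ y → (-ᴹ x) ∼ (-ᴹ y)
        -‿cong {x} {y} h = T.resp (≈ᴹ-sym (⁻¹-∙-comm x (-ᴹ y))) (T.-∈ h)

        *-neg : ∀ a y → a *ₗ (-ᴹ y) ≈ᴹ -ᴹ (a *ₗ y)
        *-neg a y = ModuleProperties.inverseˡ-uniqueᴹ A (a *ₗ (-ᴹ y)) (a *ₗ y)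
          (≈ᴹ-trans (≈ᴹ-sym (*ₗ-distribˡ a (-ᴹ y) y))
          (≈ᴹ-trans (*ₗ-congˡ (-ᴹ‿inverseˡ y)) (*ₗ-zeroʳ a)))

        *-cong : ∀ {a b x y} → a ≈ᴷ b → x ∼ y → (a *ₗ x) ∼ (b *ₗ y)
        *-cong {a} {b} {x} {y} p h = T.resp
          (≈ᴹ-trans (*ₗ-distribˡ a x (-ᴹ y))
          (+ᴹ-congˡ (≈ᴹ-trans (*-neg a y) (-ᴹ‿cong (*ₗ-cong p ≈ᴹ-refl)))))
          (T.*ₗ∈ a h)

      -- S / (S ∩ T)
      subquotientModule : Module R c c
      subquotientModule = record
        { Carrierᴹ = Σ Carrierᴹ S
        ; _≈ᴹ_     = λ (x , _) (y , _) → x ∼ y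
        ; _+ᴹ_     = λ (x , s) (y , t) → x +ᴹ y , S.+∈ s t
        ; _*ₗ_     = λ a (x , s) → a *ₗ x , S.*ₗ∈ a s
        ; _*ᵣ_     = λ (x , s) a → a *ₗ x , S.*ₗ∈ a s
        ; 0ᴹ       = 0ᴹ , S.0∈
        ; -ᴹ_      = λ (x , s) → -ᴹ x , S.-∈ s
        ; isModule = IsModuleFromLeft.isModule record { isLeftModule = record
          { isLeftSemimodule = record
            { +ᴹ-isCommutativeMonoid = record
              { isMonoid = record
                { isSemigroup = record
                  { isMagma = record
                    { isEquivalence = record
                      { refl  = ≈⇒∼ ≈ᴹ-refl
                      ; sym   = ∼-sym
                      ; trans = ∼-trans
                      }
                    ; ∙-cong = +-cong
                    }
                  ; assoc = λ (x , _) (y , _) (z , _) → ≈⇒∼ (+ᴹ-assoc x y z)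
                  }
                ; identity = (λ (x , _) → ≈⇒∼ (+ᴹ-identityˡ x)) , (λ (x , _) → ≈⇒∼ (+ᴹ-identityʳ x))
                }
              ; comm = λ (x , _) (y , _) → ≈⇒∼ (+ᴹ-comm x y)
              }
            ; isPreleftSemimodule = record
              { *ₗ-cong      = *-cong
              ; *ₗ-zeroˡ     = λ (x , _) → ≈⇒∼ (*ₗ-zeroˡ x)
              ; *ₗ-distribʳ  = λ (x , _) a b → ≈⇒∼ (*ₗ-distribʳ x a b)
              ; *ₗ-identityˡ = λ (x , _) → ≈⇒∼ (*ₗ-identityˡ x)
              ; *ₗ-assoc     = λ a b (x , _) → ≈⇒∼ (*ₗ-assoc a b x)
              ; *ₗ-zeroʳ     = λ a → ≈⇒∼ (*ₗ-zeroʳ a)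
              ; *ₗ-distribˡ  = λ a (x , _) (y , _) → ≈⇒∼ (*ₗ-distribˡ a x y)
              }
            }
          ; -ᴹ‿cong    = -‿cong
          ; -ᴹ‿inverse = (λ (x , _) → ≈⇒∼ (-ᴹ‿inverseˡ x)) , (λ (x , _) → ≈⇒∼ (-ᴹ‿inverseʳ x))
          } }
        }

  ⨁ᴹ : ∀ {n} → (Fin n → Module R c c) → Module R c c
  ⨁ᴹ {n} A = record
    { Carrierᴹ = ∀ i → Carrierᴹ i
    ; _≈ᴹ_     = λ x y → ∀ i → x i ≈ y i
    ; _+ᴹ_     = λ x y i → x i + y i
    ; _*ₗ_     = λ a x i → a * x i
    ; _*ᵣ_     = λ x a i → a * x i
    ; 0ᴹ       = λ i → Module.0ᴹ (A i)
    ; -ᴹ_      = λ x i → Module.-ᴹ_ (A i) (x i)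
    ; isModule = IsModuleFromLeft.isModule record { isLeftModule = record
      { isLeftSemimodule = record
        { +ᴹ-isCommutativeMonoid = record
          { isMonoid = record
            { isSemigroup = record
              { isMagma = record
                { isEquivalence = record
                  { refl  = λ i → ≈ᴹ-refl i
                  ; sym   = λ p i → ≈ᴹ-sym i (p i)
                  ; trans = λ p q i → ≈ᴹ-trans i (p i) (q i)
                  }
                ; ∙-cong = λ p q i → +ᴹ-cong i (p i) (q i)
                }
              ; assoc = λ x y z i → +ᴹ-assoc i (x i) (y i) (z i)
              }
            ; identity = (λ x i → +ᴹ-identityˡ i (x i)) , (λ x i → +ᴹ-identityʳ i (x i))
            }
          ; comm = λ x y i → +ᴹ-comm i (x i) (y i)
          }
        ; isPreleftSemimodule = record
          { *ₗ-cong      = λ p q i → *ₗ-cong i p (q i)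
          ; *ₗ-zeroˡ     = λ x i → *ₗ-zeroˡ i (x i)
          ; *ₗ-distribʳ  = λ x a b i → *ₗ-distribʳ i (x i) a b
          ; *ₗ-identityˡ = λ x i → *ₗ-identityˡ i (x i)
          ; *ₗ-assoc     = λ a b x i → *ₗ-assoc i a b (x i)
          ; *ₗ-zeroʳ     = λ a i → *ₗ-zeroʳ i a
          ; *ₗ-distribˡ  = λ a x y i → *ₗ-distribˡ i a (x i) (y i)
          }
        }
      ; -ᴹ‿cong    = λ p i → -ᴹ‿cong i (p i)
      ; -ᴹ‿inverse = (λ x i → -ᴹ‿inverseˡ i (x i)) , (λ x i → -ᴹ‿inverseʳ i (x i))
      } }
    }
    where
    open module Aᵢ (i : Fin n) = Module (A i)
      using ( Carrierᴹ; ≈ᴹ-refl; ≈ᴹ-sym; ≈ᴹ-trans; +ᴹ-cong; +ᴹ-assoc; +ᴹ-identityˡ; +ᴹ-identityʳ; +ᴹ-comm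
            ; *ₗ-cong; *ₗ-zeroˡ; *ₗ-distribʳ; *ₗ-identityˡ; *ₗ-assoc; *ₗ-zeroʳ; *ₗ-distribˡ
            ; -ᴹ‿cong; -ᴹ‿inverseˡ; -ᴹ‿inverseʳ)
    open module Aᵢ′ {i : Fin n} = Module (A i) using () renaming (_≈ᴹ_ to _≈_; _+ᴹ_ to _+_; _*ₗ_ to _*_)

  IsLinear : (A B : Module R c c) → (Module.Carrierᴹ A → Module.Carrierᴹ B) → Set c
  IsLinear A B = ModuleMorphisms.IsModuleHomomorphism (Module.rawModule A) (Module.rawModule B)

  IsLinearIso : (A B : Module R c c) → (Module.Carrierᴹ A → Module.Carrierᴹ B) → Set c
  IsLinearIso A B = ModuleMorphisms.IsModuleIsomorphism (Module.rawModule A) (Module.rawModule B)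

module _ {c} (k : Field c) where

  open Field k using (commutativeRing)
  open LinearAlgebra commutativeRing

  -- Functors 𝒢_gᵒᵖ → k-modules.  Contractions are compared by _≈ₘ_, so
  -- the proof component of a contraction is irrelevant to its action.
  record Rep (g : ℕ) : Set (lsuc c) where
    field
      obj : GraphOfGenus g → Module commutativeRing c c

    ∣_∣ : GraphOfGenus g → Set c
    ∣ G ∣ = Module.Carrierᴹ (obj G)

    infix 4 _≈_
    _≈_ : ∀ {G} → ∣ G ∣ → ∣ G ∣ → Set c
    _≈_ {G} = Module._≈ᴹ_ (obj G)

    field
      map      : ∀ {G H} → Contraction G H → ∣ H ∣ → ∣ G ∣
      map-homo : ∀ {G H} (φ : Contraction G H) →
                 IsLinear (obj H) (obj G) (map φ)
      map-resp : ∀ {G H} (φ ψ : Contraction G H) → morphism φ ≈ₘ morphism ψ →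
                 ∀ x → map φ x ≈ map ψ x
      map-id   : ∀ {G} (x : ∣ G ∣) → map idᶜ x ≈ x
      map-∘    : ∀ {G H J} (ψ : Contraction H J) (φ : Contraction G H) →
                 ∀ x → map (ψ ∘ᶜ φ) x ≈ map φ (map ψ x)

  module _ {g : ℕ} where

    record _≅_ (M N : Rep g) : Set c where
      private
        module M = Rep M
        module N = Rep N
      field
        to      : ∀ {G} → M.∣ G ∣ → N.∣ G ∣
        isIso   : ∀ {G} → IsLinearIso (M.obj G) (N.obj G) to
        natural : ∀ {G H} (φ : Contraction G H) x →
                  to (M.map φ x) N.≈ N.map φ (to x)

    record Subrep (M : Rep g) : Set (lsuc c) where
      open Rep M
      field
        carrier     : ∀ G → ∣ G ∣ → Set c
        isSubmodule : ∀ {G} → IsSubmodule (obj G) (carrier G)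
        stable      : ∀ {G H} (φ : Contraction G H) {x} → carrier H x → carrier G (map φ x)

    open Subrep public using (carrier)

    infix 4 _⊆_
    _⊆_ : {M : Rep g} → Subrep M → Subrep M → Set c
    _⊆_ {M} S T = ∀ G x → carrier S G x → carrier T G x

    -- S / (S ∩ T), with the action induced from M.
    subquotient : {M : Rep g} (S T : Subrep M) → Rep g
    subquotient {M} S T = record
      { obj      = λ G → subquotientModule (obj G) (S.isSubmodule {G}) (T.isSubmodule {G})
      ; map      = λ φ (x , s) → map φ x , S.stable φ s
      ; map-homo = λ {G} {H} φ → record { isBimoduleHomomorphism = record
          { +ᴹ-isGroupHomomorphism = record
            { isMonoidHomomorphism = record
              { isMagmaHomomorphism = record
                { isRelHomomorphism = record
                  { cong = λ { {x , _} {y , _} h → T.resp (difference φ x y) (T.stable φ h) } }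
                ; homo = λ (x , _) (y , _) → ≈⇒T (Hom.+ᴹ-homo φ x y)
                }
              ; ε-homo = ≈⇒T (Hom.0ᴹ-homo φ)
              }
            ; ⁻¹-homo = λ (x , _) → ≈⇒T (Hom.-ᴹ-homo φ x)
            }
          ; *ₗ-homo = λ a (x , _) → ≈⇒T (Hom.*ₗ-homo φ a x)
          ; *ᵣ-homo = λ a (x , _) → ≈⇒T (Hom.*ₗ-homo φ a x)
          } }
      ; map-resp = λ φ ψ φ≈ψ (x , _) → ≈⇒T (map-resp φ ψ φ≈ψ x)
      ; map-id   = λ (x , _) → ≈⇒T (map-id x)
      ; map-∘    = λ ψ φ (x , _) → ≈⇒T (map-∘ ψ φ x)
      }
      where
      open Rep M
      module S = Subrep S
      module T where
        open Subrep T public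
        open module IsSub {G} = IsSubmodule (isSubmodule {G}) public
      module Hom {G H} (φ : Contraction G H) = ModuleMorphisms.IsModuleHomomorphism (map-homo φ)
      module _ {G : GraphOfGenus g} where
        open Module (obj G)
        ≈⇒T : ∀ {x y} → x ≈ᴹ y → T.carrier G (x +ᴹ -ᴹ y)
        ≈⇒T {y = y} p = T.resp (≈ᴹ-sym (≈ᴹ-trans (+ᴹ-congʳ p) (-ᴹ‿inverseʳ y))) T.0∈
      difference : ∀ {G H} (φ : Contraction G H) x y →
                   map φ (Module._+ᴹ_ (obj H) x (Module.-ᴹ_ (obj H) y)) ≈
                   Module._+ᴹ_ (obj G) (map φ x) (Module.-ᴹ_ (obj G) (map φ y))
      difference {G} {H} φ x y = ≈ᴹ-trans (Hom.+ᴹ-homo φ x _) (+ᴹ-congˡ (Hom.-ᴹ-homo φ y))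
        where open Module (obj G)

    ⨁ : ∀ {n} → (Fin n → Rep g) → Rep g
    ⨁ M = record
      { obj      = λ G → ⨁ᴹ (λ i → Rep.obj (M i) G)
      ; map      = λ φ x i → Rep.map (M i) φ (x i)
      ; map-homo = λ φ → record { isBimoduleHomomorphism = record
          { +ᴹ-isGroupHomomorphism = record
            { isMonoidHomomorphism = record
              { isMagmaHomomorphism = record
                { isRelHomomorphism = record { cong = λ p i → Hom.⟦⟧-cong φ i (p i) }
                ; homo = λ x y i → Hom.+ᴹ-homo φ i (x i) (y i)
                }
              ; ε-homo = λ i → Hom.0ᴹ-homo φ i
              }
            ; ⁻¹-homo = λ x i → Hom.-ᴹ-homo φ i (x i)
            }
          ; *ₗ-homo = λ a x i → Hom.*ₗ-homo φ i a (x i)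
          ; *ᵣ-homo = λ a x i → Hom.*ₗ-homo φ i a (x i)
          } }
      ; map-resp = λ φ ψ φ≈ψ x i → Rep.map-resp (M i) φ ψ φ≈ψ (x i)
      ; map-id   = λ x i → Rep.map-id (M i) (x i)
      ; map-∘    = λ ψ φ x i → Rep.map-∘ (M i) ψ φ (x i)
      }
      where
      module Hom {G H} (φ : Contraction G H) i = ModuleMorphisms.IsModuleHomomorphism (Rep.map-homo (M i) φ)

    record FinitelyGenerated≤ (d : ℕ) (M : Rep g) : Set c where
      open Rep M
      field
        s          : ℕ
        generator  : Fin s → GraphOfGenus g
        degree     : ∀ i → #E (graph (generator i)) ℕ.≤ d
        u          : ∀ i → ∣ generator i ∣
        spanning   : ∀ G x → InSpan (obj G) {Σ[ i ∈ Fin s ] Contraction G (generator i)}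
                       (λ (i , φ) → map φ (u i)) x

    IsSubquotientOf : Rep g → Rep g → Set (lsuc c)
    IsSubquotientOf M P = Σ[ S ∈ Subrep P ] Σ[ T ∈ Subrep P ] T ⊆ S × M ≅ subquotient S T

    Small : ℕ → Rep g → Set (lsuc c)
    Small d M = Σ[ P ∈ Rep g ] FinitelyGenerated≤ d P × IsSubquotientOf M P

    record Filtration (M : Rep g) : Set (lsuc c) where
      open Rep M
      field
        length : ℕ
        step   : Fin (suc length) → Subrep M
        mono   : ∀ i → step (inject₁ i) ⊆ step (suc i)
        bottom : ∀ G x → carrier (step zero) G x → x ≈ Module.0ᴹ (obj G)
        top    : ∀ G x → carrier (step (fromℕ length)) G x

    gr : {M : Rep g} → Filtration M → Rep g
    gr F = ⨁ (λ i → subquotient (step (suc i)) (step (inject₁ i)))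
      where open Filtration F

    Smallish : ℕ → Rep g → Set (lsuc c)
    Smallish d M = Σ[ F ∈ Filtration M ] Small d (gr F)

record Term (r : ℕ) : Set where
  field
    coeff    : ℚ
    exponent : Vector ℕ r

-- A polynomial over ℚ in r variables is presented as a sum of terms.
-- Presentations are not unique; a polynomial of total degree at most d
-- is one having a presentation with all exponents of size at most d.

Polynomial : ℕ → Set
Polynomial r = List (Term r)

module _ {r : ℕ} where

  open RawSemiringDefinitions ℚ.+-*-rawSemiring using (product; _^_)

  TotalDegree≤ : ℕ → Polynomial r → Set
  TotalDegree≤ d = All (λ t → ∑ℕ (Term.exponent t) ℕ.≤ d)

  evaluate : Polynomial r → Vector ℚ r → ℚ
  evaluate f x = List.foldr (λ t y → Term.coeff t ℚ.* product (λ i → x i ^ Term.exponent t i) ℚ.+ y) 0ℚ f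

fromℕℚ : ℕ → ℚ
fromℕℚ n = ℤ.+ n ℚ./ 1

module Submission where

open import Axiom.ExcludedMiddle using (ExcludedMiddle)
open import Algebra.Bundles using (CommutativeMonoid)
open import Algebra.Module.Bundles using (Module)
open import Algebra.Module.Morphism.Structures using (module ModuleMorphisms)
import Algebra.Properties.AbelianGroup as AbelianGroupProperties
import Algebra.Properties.CommutativeSemigroup as CommutativeSemigroupProperties
open import Data.Bool.Base using (Bool; true; false; not; _xor_; if_then_else_)
open import Data.Empty using (⊥-elim)
open import Data.Fin.Base using (Fin; zero; suc; _↑ˡ_; _↑ʳ_; splitAt; cast; combine; funToFin; inject₁; fromℕ)
open import Data.Fin.Properties using (_≟_; splitAt-↑ˡ; splitAt-↑ʳ; join-splitAt; ↑ˡ-injective; ↑ʳ-injective; injective⇒≤; cast-involutive; combine-injective; combine-injectiveˡ; combine-injectiveʳ)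
open import Data.Integer.Base as ℤ using (ℤ; 0ℤ; 1ℤ)
import Data.Integer.Properties as ℤ
open import Data.List.Base as List using (List; []; _∷_; _++_; length; lookup; replicate)
open import Data.List.Properties using (tabulate-cong; length-tabulate; lookup-tabulate)
open import Data.List.Relation.Binary.Sublist.Propositional using ([]; _∷_; _∷ʳ_; ⊆-refl; ⊆-trans) renaming (_⊆_ to _⊑_)
open import Data.List.Relation.Binary.Sublist.Propositional.Properties using (⊆-trans-idʳ)
open import Data.List.Relation.Unary.All as All using (All; []; _∷_)
import Data.List.Relation.Unary.All.Properties as All
open import Data.List.Relation.Unary.Any using (Any; here; there)
import Data.List.Relation.Unary.Any.Properties as Any
open import Data.Maybe.Base as Maybe using (Maybe; just; nothing; _>>=_)
open import Data.Nat.Base as ℕ using (ℕ; zero; suc; _∸_; _⊔_; _≤_; _<_; z≤n; s≤s; s≤s⁻¹)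
import Data.Nat.Properties as ℕ
import Data.Nat.Tactic.RingSolver as ℕ
open import Data.Product using (∃!)
open import Data.Product.Base using (Σ-syntax; ∃-syntax; _×_; _,_; proj₁; proj₂)
open import Data.Sum.Base using (_⊎_; inj₁; inj₂; [_,_]′)
open import Data.Unit.Base using (⊤; tt)
open import Data.Vec.Base as Vec using (Vec; []; _∷_)
import Data.Vec.Functional as Vector
open import Data.Vec.Functional using (Vector; updateAt)
open import Data.Vec.Functional.Properties using (lookup-++ˡ; lookup-++ʳ)
open import Function.Base using (_∘_; id)
open import Function.Definitions using (Injective)
import Level
open import Relation.Binary.Construct.Closure.ReflexiveTransitive using (Star; ε; _◅_; _◅◅_)
open import Relation.Binary.PropositionalEquality
open import Relation.Nullary using (¬_; yes; no; does; Dec)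
open import Relation.Nullary.Decidable using (decidable-stable)
open import Relation.Unary using (Pred)
open import Algebra.Properties.Semiring.Sum ℤ.+-*-semiring using (sum; sum-cong-≗)
open import Defs

-- Let G_c be G with leaves attached at the vertices in the list c.  A sublist
-- τ : y ⊑ c gives a contraction G_c → G_y, and any contraction from G_c to a
-- graph with at most d edges factors through one with length y ≤ d.  Hence, if P
-- is finitely generated in degrees ≤ d, then P(G_c) is spanned by vectors e(x, τ)
-- with x in a finite set and length y ≤ d.  Order these lexicographically.  The
-- pairs (x, τ) leading an element of a subrepresentation S form a set closed under
-- enlarging c, and the dimension of S/T at G_c is the number of pairs that lead an
-- element of S but none of T.  Closed sets satisfy the ascending chain condition,
-- so the generating function in m of the number of elements of such a set is a
-- sum of products of series t^c / (1 - t)^k, where each chosen letter raises one k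
-- by one; so the number is eventually polynomial of degree at most d.  If M is
-- smallish, each graded piece is of the form S/T, and the dimensions add up.

-- The order on sublists puts skipping a letter before keeping it. Composition with an embedding
-- `c ⊑ c′` respects this order, so lower vectors go to lower vectors; with an arbitrary order a
-- leading term could be overtaken, and the set of leading pairs would not be closed. Pairs with
-- more than `d` letters are given the zero vector. It leads an element of every subrepresentation,
-- so these pairs drop out of the difference of the sets for S and T, and only embeddings of at most
-- `d` letters are counted; hence the degree bound. The difference itself need not be closed, so the
-- two closed sets are counted separately and the polynomials subtracted. Counting goes by the first
-- letter of the ambient word. Skipping it again and again yields an ascending chain of sets, whose
-- stabilisation ends the recursion and produces the factor 1 / (1 - t). The chain condition is
-- proved by following the same skips, so one chain turns into a doubly indexed family, and the
-- stabilisation has to be uniform in the number of skips.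

module Combinatorics where

  -- Products of rational power series in independent variables

  open import Data.Nat.Base using (_+_; _*_)
  open import Data.Nat.Properties

  private variable
    r : ℕ

  -- The coefficient of t^m in t^c / (1 - t)^k.
  coeff : ℕ → ℕ → ℕ → ℕ
  coeff zero    zero    zero    = 1
  coeff zero    zero    (suc m) = 0
  coeff zero    (suc k) zero    = 1
  coeff zero    (suc k) (suc m) = coeff zero k (suc m) + coeff zero (suc k) m
  coeff (suc c) k       zero    = 0
  coeff (suc c) k       (suc m) = coeff c k m

  coeff-0-1 : ∀ m → coeff 0 1 m ≡ 1
  coeff-0-1 zero    = refl
  coeff-0-1 (suc m) = coeff-0-1 m

  coeff-pascal : ∀ c k m → coeff c (suc k) m ≡ coeff c k m + coeff (suc c) (suc k) m
  coeff-pascal zero    zero    zero    = refl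
  coeff-pascal zero    (suc k) zero    = refl
  coeff-pascal zero    k       (suc m) = refl
  coeff-pascal (suc c) k       zero    = refl
  coeff-pascal (suc c) k       (suc m) = coeff-pascal c k m

  -- (c , k) stands for the power series t^c / (1 - t)^k, a list of such
  -- pairs for the product of these series in independent variables.
  Series : ℕ → Set
  Series = Vec (ℕ × ℕ)

  -- A bound for the total degree: for large m the coefficient of t^m in t^c / (1 - t)^k is a
  -- polynomial of degree k - 1 in m, or zero if k = 0.
  growth : Series r → ℕ
  growth []             = 0
  growth ((_ , k) ∷ gs) = (k ∸ 1) + growth gs

  coefficientAt : Series r → Vec ℕ r → ℕ
  coefficientAt []             []       = 1
  coefficientAt ((c , k) ∷ gs) (m ∷ ms) = coeff c k m * coefficientAt gs ms

  sumCoefficientsAt : List (Series r) → Vec ℕ r → ℕ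
  sumCoefficientsAt []       m = 0
  sumCoefficientsAt (g ∷ gs) m = coefficientAt g m + sumCoefficientsAt gs m

  sumCoefficientsAt-++ : ∀ (gs hs : List (Series r)) m →
    sumCoefficientsAt (gs ++ hs) m ≡ sumCoefficientsAt gs m + sumCoefficientsAt hs m
  sumCoefficientsAt-++ []       hs m = refl
  sumCoefficientsAt-++ (g ∷ gs) hs m =
    trans (cong (coefficientAt g m +_) (sumCoefficientsAt-++ gs hs m)) (sym (+-assoc (coefficientAt g m) _ _))

  times-t times-t/[1-t] : Series (suc r) → Series (suc r)
  times-t       ((c , k) ∷ gs) = (suc c , k) ∷ gs
  times-t/[1-t] ((c , k) ∷ gs) = (suc c , suc k) ∷ gs

  module _ (gs : List (Series r)) (ms : Vec ℕ r) where

    constant-at-0 : sumCoefficientsAt (List.map ((0 , 0) ∷_) gs) (0 ∷ ms) ≡ sumCoefficientsAt gs ms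
    constant-at-0 = go gs
      where
      go : ∀ gs → sumCoefficientsAt (List.map ((0 , 0) ∷_) gs) (0 ∷ ms) ≡ sumCoefficientsAt gs ms
      go []       = refl
      go (g ∷ gs) = cong₂ _+_ (+-identityʳ _) (go gs)

    constant-at-suc : ∀ m → sumCoefficientsAt (List.map ((0 , 0) ∷_) gs) (suc m ∷ ms) ≡ 0
    constant-at-suc m = go gs
      where
      go : ∀ gs → sumCoefficientsAt (List.map ((0 , 0) ∷_) gs) (suc m ∷ ms) ≡ 0
      go []       = refl
      go (g ∷ gs) = go gs

    geometric : ∀ m → sumCoefficientsAt (List.map ((0 , 1) ∷_) gs) (m ∷ ms) ≡ sumCoefficientsAt gs ms
    geometric m = go gs
      where
      go : ∀ gs → sumCoefficientsAt (List.map ((0 , 1) ∷_) gs) (m ∷ ms) ≡ sumCoefficientsAt gs ms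
      go []       = refl
      go (g ∷ gs) = cong₂ _+_ (trans (cong (_* coefficientAt g ms) (coeff-0-1 m)) (+-identityʳ _)) (go gs)

  times-t-at-0 : ∀ (gs : List (Series (suc r))) ms → sumCoefficientsAt (List.map times-t gs) (0 ∷ ms) ≡ 0
  times-t-at-0 []                    ms = refl
  times-t-at-0 (((c , k) ∷ g) ∷ gs) ms = times-t-at-0 gs ms

  times-t-at-suc : ∀ (gs : List (Series (suc r))) m ms →
    sumCoefficientsAt (List.map times-t gs) (suc m ∷ ms) ≡ sumCoefficientsAt gs (m ∷ ms)
  times-t-at-suc []                    m ms = refl
  times-t-at-suc (((c , k) ∷ g) ∷ gs) m ms = cong (_ +_) (times-t-at-suc gs m ms)

  times-t/[1-t]-at-0 : ∀ (gs : List (Series (suc r))) ms →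
    sumCoefficientsAt (List.map times-t/[1-t] gs) (0 ∷ ms) ≡ 0
  times-t/[1-t]-at-0 []                    ms = refl
  times-t/[1-t]-at-0 (((c , k) ∷ g) ∷ gs) ms = times-t/[1-t]-at-0 gs ms

  -- The recursion h = t g + t h, which characterises h = t g / (1 - t).
  times-t/[1-t]-at-suc : ∀ (gs : List (Series (suc r))) m ms →
    sumCoefficientsAt (List.map times-t/[1-t] gs) (suc m ∷ ms) ≡
    sumCoefficientsAt gs (m ∷ ms) + sumCoefficientsAt (List.map times-t/[1-t] gs) (m ∷ ms)
  times-t/[1-t]-at-suc []                   m ms = refl
  times-t/[1-t]-at-suc (((c , k) ∷ g) ∷ gs) m ms = trans
    (cong₂ _+_ (trans (cong (_* coefficientAt g ms) (coeff-pascal c k m))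
                      (*-distribʳ-+ (coefficientAt g ms) (coeff c k m) (coeff (suc c) (suc k) m)))
               (times-t/[1-t]-at-suc gs m ms))
    (interchange (coeff c k m * coefficientAt g ms) _ _ _)
    where
    open import Algebra.Properties.CommutativeSemigroup +-commutativeSemigroup using (interchange)

  degree-times-t : ∀ {d} {gs : List (Series (suc r))} →
    All (λ g → growth g ≤ d) gs → All (λ g → growth g ≤ d) (List.map times-t gs)
  degree-times-t []                        = []
  degree-times-t {gs = (_ ∷ _) ∷ _} (p ∷ ps) = p ∷ degree-times-t ps

  degree-times-t/[1-t] : ∀ {d} {gs : List (Series (suc r))} →
    All (λ g → growth g ≤ d) gs → All (λ g → growth g ≤ suc d) (List.map times-t/[1-t] gs)
  degree-times-t/[1-t] [] = []
  degree-times-t/[1-t] {gs = ((c , k) ∷ g) ∷ _} (p ∷ ps) =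
    ≤-trans (+-monoˡ-≤ (growth g) (k≤1+k∸1 k)) (s≤s p) ∷ degree-times-t/[1-t] ps
    where
    k≤1+k∸1 : ∀ k → k ≤ suc (k ∸ 1)
    k≤1+k∸1 zero    = z≤n
    k≤1+k∸1 (suc k) = ≤-refl

  word : {A : Set} → Vec A r → Vec ℕ r → List A
  word []       []       = []
  word (u ∷ us) (m ∷ ms) = replicate m u ++ word us ms

  module Indicator {ℓ} (em : ExcludedMiddle ℓ) where

    indicator : Set ℓ → ℕ
    indicator P = if does (em {P}) then 1 else 0

    indicator-cong : ∀ {P Q : Set ℓ} → (P → Q) → (Q → P) → indicator P ≡ indicator Q
    indicator-cong {P} {Q} f g with em {P} | em {Q}
    ... | yes _ | yes _ = refl
    ... | yes p | no ¬q = ⊥-elim (¬q (f p))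
    ... | no ¬p | yes q = ⊥-elim (¬p (g q))
    ... | no _  | no _  = refl

    indicator-∖ : ∀ {P Q : Set ℓ} → (Q → P) → indicator (P × ¬ Q) + indicator Q ≡ indicator P
    indicator-∖ {P} {Q} Q→P with em {P} | em {Q} | em {P × ¬ Q}
    ... | yes p | yes q | yes (_ , ¬q) = ⊥-elim (¬q q)
    ... | yes p | yes q | no _         = refl
    ... | yes p | no ¬q | yes _        = refl
    ... | yes p | no ¬q | no ¬p∖q      = ⊥-elim (¬p∖q (p , ¬q))
    ... | no ¬p | yes q | _            = ⊥-elim (¬p (Q→P q))
    ... | no ¬p | no _  | yes (p , _)  = ⊥-elim (¬p p)
    ... | no ¬p | no _  | no _         = refl

  -- Upward closed families of embeddings: chain condition and generating function

  module Counting {ℓ} (em : ExcludedMiddle ℓ) {A : Set} where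

    open Indicator em

    -- Membership depends on the embedding and not only on the two words, as different embeddings
    -- induce different contractions.
    Family : Set (Level.suc ℓ)
    Family = ∀ {y c : List A} → y ⊑ c → Set ℓ

    Upward : Family → Set ℓ
    Upward U = ∀ {y c c′} (τ : y ⊑ c) (σ : c ⊑ c′) → U τ → U (⊆-trans τ σ)

    -- Analogues of the derivatives of a language by a letter. On words beginning with `u` the two
    -- together determine the family, and both inherit upward closure.
    skip keep : A → Family → Family
    skip u U τ = U (u ∷ʳ τ)
    keep u U τ = U (refl {x = u} ∷ τ)

    skips : ℕ → A → Family → Family
    skips zero    u U τ = U τ
    skips (suc j) u U τ = skips j u U (u ∷ʳ τ)

    skip-upward : ∀ {U : Family} u → Upward U → Upward (skip u U)
    skip-upward u up τ σ = up (u ∷ʳ τ) (refl ∷ σ)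

    keep-upward : ∀ {U : Family} u → Upward U → Upward (keep u U)
    keep-upward u up τ σ = up (refl ∷ τ) (refl ∷ σ)

    skips-upward : ∀ j {U : Family} u → Upward U → Upward (skips j u U)
    skips-upward zero    u up = up
    skips-upward (suc j) {U} u up = skip-upward {U = skips j u U} u (skips-upward j {U} u up)

    skips-mono : ∀ j u {U W : Family} → (∀ {y c} (τ : y ⊑ c) → U τ → W τ) →
                 ∀ {y c} (τ : y ⊑ c) → skips j u U τ → skips j u W τ
    skips-mono zero    u f τ = f τ
    skips-mono (suc j) u f τ = skips-mono j u f (u ∷ʳ τ)

    -- An upward family is thus contained in its `skip`, which makes `skips j u U` ascending in `j`.
    grow : ∀ {U : Family} → Upward U → ∀ u {y c} (τ : y ⊑ c) → U τ → U (u ∷ʳ τ)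
    grow {U = U} up u τ x = subst (λ ρ → U (u ∷ʳ ρ)) ⊆-trans-idʳ (up τ (u ∷ʳ ⊆-refl) x)

    record Ascending (U : ℕ → Family) : Set ℓ where
      field
        upward     : ∀ i → Upward (U i)
        increasing : ∀ {i j} → i ≤ j → ∀ {y c} (τ : y ⊑ c) → U i τ → U j τ

    open Ascending

    skips-chain : ∀ u {U : Family} → Upward U → Ascending (λ j → skips j u U)
    skips-chain u {U} up .upward j = skips-upward j {U} u up
    skips-chain u {U} up .increasing {zero}  {zero}  _ τ x = x
    skips-chain u {U} up .increasing {zero}  {suc j} _ τ x =
      skips-chain u {U} up .increasing {0} {j} z≤n (u ∷ʳ τ) (grow {U} up u τ x)
    skips-chain u {U} up .increasing {suc i} {suc j} (s≤s p) τ x =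
      skips-chain u {U} up .increasing p (u ∷ʳ τ) x

    -- The bound `D` serves as an induction variable: keeping a letter lowers it. Only ambient words
    -- of the shape `word us m` occur, so chains are compared on these alone.
    Within : Vec A r → ℕ → Family → Family → Set ℓ
    Within us D U W = ∀ m {y} (τ : y ⊑ word us m) → length y ≤ D → U τ → W τ

    Noetherian : Vec A r → ℕ → Set (Level.suc ℓ)
    Noetherian us D = ∀ {U : ℕ → Family} → Ascending U → ∃[ J ] (∀ i → Within us D (U i) (U J))

    -- Beyond the stabilisation point of the diagonal nothing changes; each of
    -- the finitely many chains before it stabilises by itself.
    noetherian² : (us : Vec A r) (D : ℕ) → Noetherian us D →
      (U : ℕ → ℕ → Family) → (∀ j → Ascending (λ i → U i j)) → (∀ i → Ascending (λ j → U i j)) →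
      ∃[ J ] (∀ j i → Within us D (U i j) (U J j))
    noetherian² us D noeth U row column = J₀ ⊔ J₁ , stable
      where
      diagonal : Ascending (λ i → U i i)
      diagonal .upward i = row i .upward i
      diagonal .increasing {i} {j} p τ x = row j .increasing p τ (column i .increasing p τ x)
      J₀ : ℕ
      J₀ = proj₁ (noeth diagonal)
      early : ∀ n → ∃[ J ] (∀ j → suc j ≤ n → ∀ i → Within us D (U i j) (U J j))
      early zero    = 0 , λ _ ()
      early (suc n) with early n | noeth (row n)
      ... | J , stable | J′ , stable′ = J ⊔ J′ , both
        where
        both : ∀ j → suc j ≤ suc n → ∀ i → Within us D (U i j) (U (J ⊔ J′) j)
        both j (s≤s j≤n) i m τ short x with m≤n⇒m<n∨m≡n j≤n
        ... | inj₁ j<n  = row j .increasing (m≤m⊔n J J′) τ (stable j j<n i m τ short x)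
        ... | inj₂ refl = row j .increasing (m≤n⊔m J J′) τ (stable′ i m τ short x)
      J₁ : ℕ
      J₁ = proj₁ (early J₀)
      stable : ∀ j i → Within us D (U i j) (U (J₀ ⊔ J₁) j)
      stable j i m τ short x with J₀ ≤? j
      ... | no J₀≰j = row j .increasing (m≤n⊔m J₀ J₁) τ (proj₂ (early J₀) j (≰⇒> J₀≰j) i m τ short x)
      ... | yes J₀≤j = row j .increasing (m≤m⊔n J₀ J₁) τ (column J₀ .increasing J₀≤j τ
              (proj₂ (noeth diagonal) (i ⊔ j) m τ short
                (row (i ⊔ j) .increasing (m≤m⊔n i j) τ (column i .increasing (m≤n⊔m i j) τ x))))

    -- An embedding into a word over `u ∷ us` first skips some number `j` of copies of `u`. Either
    -- it has then used them all up, and what remains is an embedding into a word over `us`; or it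
    -- keeps the next copy, and `D` drops by one. In both cases the chain acquires the second index
    -- `j`, and `noetherian²` gives a stabilisation point that serves all `j`.
    noetherian : (us : Vec A r) (D : ℕ) → Noetherian us D
    noetherian-keep : (u : A) (us : Vec A r) (D : ℕ) (U : ℕ → ℕ → Family) →
      (∀ j → Ascending (λ i → U i j)) → (∀ i → Ascending (λ j → U i j)) →
      ∃[ J ] (∀ j i m {y} (τ : y ⊑ word (u ∷ us) m) → suc (length y) ≤ D →
               keep u (U i j) τ → keep u (U J j) τ)

    noetherian-keep u us zero    U row column = 0 , λ _ _ _ _ ()
    noetherian-keep u us (suc D) U row column =
      let J , stable = noetherian² (u ∷ us) D (noetherian (u ∷ us) D) (λ i j → keep u (U i j))
                         (λ j → keep-chain (row j)) (λ i → keep-chain (column i))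
      in J , λ { j i m τ (s≤s short) → stable j i m τ short }
      where
      keep-chain : {U : ℕ → Family} → Ascending U → Ascending (λ i → keep u (U i))
      keep-chain {U} C .upward i = keep-upward {U i} u (C .upward i)
      keep-chain C .increasing p τ = C .increasing p (refl ∷ τ)

    noetherian [] D {U} C with em {∃[ i ] U i []}
    ... | yes (J , x) = J , λ { i [] [] _ y → x }
    ... | no ∄        = 0 , λ { i [] [] _ y → ⊥-elim (∄ (i , y)) }
    noetherian (u ∷ us) D {U} C = J₁ ⊔ J₂ , λ { i (m ∷ ms) τ short → stable m i ms τ short 0 }
      where
      skipped : ℕ → ℕ → Family
      skipped i j = skips j u (U i)
      row : ∀ j → Ascending (λ i → skipped i j)
      row j .upward i = skips-upward j {U i} u (C .upward i)
      row j .increasing {i} {i′} p τ = skips-mono j u {U i} {U i′} (C .increasing p) τ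
      column : ∀ i → Ascending (λ j → skipped i j)
      column i = skips-chain u {U i} (C .upward i)
      skipping = noetherian² us D (noetherian us D) skipped row column
      keeping  = noetherian-keep u us D skipped row column
      J₁ J₂ : ℕ
      J₁ = proj₁ skipping
      J₂ = proj₁ keeping
      -- Here `m` copies of `u` are still ahead and `j` copies have been skipped.
      stable : ∀ m i ms {y} (τ : y ⊑ word (u ∷ us) (m ∷ ms)) → length y ≤ D →
               ∀ j → skipped i j τ → skipped (J₁ ⊔ J₂) j τ
      stable zero i ms τ short j x = row j .increasing (m≤m⊔n J₁ J₂) τ (proj₂ skipping j i ms τ short x)
      stable (suc m) i ms (.u ∷ʳ τ) short j x = stable m i ms τ short (suc j) x
      stable (suc m) i ms (refl ∷ τ) short j x =
        row j .increasing (m≤n⊔m J₁ J₂) (refl ∷ τ) (proj₂ keeping j i (m ∷ ms) τ short x)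

    count : ℕ → Family → List A → ℕ
    count D       U []      = indicator (U [])
    count zero    U (a ∷ c) = count zero (skip a U) c
    count (suc D) U (a ∷ c) = count D (keep a U) c + count (suc D) (skip a U) c

    count-cong : ∀ D (U W : Family) c →
      (∀ {y} (τ : y ⊑ c) → length y ≤ D → U τ → W τ) →
      (∀ {y} (τ : y ⊑ c) → length y ≤ D → W τ → U τ) →
      count D U c ≡ count D W c
    count-cong D       U W []      f g = indicator-cong (f [] z≤n) (g [] z≤n)
    count-cong zero    U W (a ∷ c) f g = count-cong zero _ _ c (λ τ → f (a ∷ʳ τ)) (λ τ → g (a ∷ʳ τ))
    count-cong (suc D) U W (a ∷ c) f g = cong₂ _+_
      (count-cong D _ _ c (λ τ p → f (refl ∷ τ) (s≤s p)) (λ τ p → g (refl ∷ τ) (s≤s p)))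
      (count-cong (suc D) _ _ c (λ τ → f (a ∷ʳ τ)) (λ τ → g (a ∷ʳ τ)))

    -- The predicate concerns one fixed word, since a basis is computed in one vector space at a
    -- time; `count` needs a whole family because its recursion has to be compared across words.
    countAll : (c : List A) → (∀ {y} → y ⊑ c → Set ℓ) → ℕ
    countAll []      U = indicator (U [])
    countAll (a ∷ c) U = countAll c (λ τ → U (refl {x = a} ∷ τ)) + countAll c (λ τ → U (a ∷ʳ τ))

    countAll-∅ : (c : List A) (U : ∀ {y} → y ⊑ c → Set ℓ) → (∀ {y} (τ : y ⊑ c) → ¬ U τ) → countAll c U ≡ 0
    countAll-∅ [] U ∅ with em {U []}
    ... | yes u = ⊥-elim (∅ [] u)
    ... | no _  = refl
    countAll-∅ (a ∷ c) U ∅ = cong₂ _+_ (countAll-∅ c _ (λ τ → ∅ (refl ∷ τ))) (countAll-∅ c _ (λ τ → ∅ (a ∷ʳ τ)))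

    -- Both families may contain embeddings with more than `D` letters, which `count` ignores.
    -- Nothing is lost, because such embeddings lie in both or in neither.
    countAll-∖ : ∀ D (U W : Family) (c : List A) →
      (∀ {y} (τ : y ⊑ c) → W τ → U τ) →
      (∀ {y} (τ : y ⊑ c) → U τ × ¬ W τ → length y ≤ D) →
      countAll c (λ τ → U τ × ¬ W τ) + count D W c ≡ count D U c
    countAll-∖ D U W [] W⊆U short = indicator-∖ (W⊆U [])
    countAll-∖ zero U W (a ∷ c) W⊆U short = trans
      (cong (λ n → n + countAll c (λ τ → U (a ∷ʳ τ) × ¬ W (a ∷ʳ τ)) + count zero (skip a W) c)
        (countAll-∅ c (λ τ → U (refl {x = a} ∷ τ) × ¬ W (refl {x = a} ∷ τ)) (λ τ u∖w → 1+n≰0 (short (refl ∷ τ) u∖w))))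
      (countAll-∖ zero (skip a U) (skip a W) c (λ τ → W⊆U (a ∷ʳ τ)) (λ τ → short (a ∷ʳ τ)))
      where
      1+n≰0 : ∀ {n} → ¬ suc n ≤ 0
      1+n≰0 ()
    countAll-∖ (suc D) U W (a ∷ c) W⊆U short = trans
      (interchange (countAll c (λ τ → U (refl ∷ τ) × ¬ W (refl ∷ τ))) _ _ _)
      (cong₂ _+_
        (countAll-∖ D (keep a U) (keep a W) c (λ τ → W⊆U (refl ∷ τ)) (λ τ u∖w → s≤s⁻¹ (short (refl ∷ τ) u∖w)))
        (countAll-∖ (suc D) (skip a U) (skip a W) c (λ τ → W⊆U (a ∷ʳ τ)) (λ τ → short (a ∷ʳ τ))))
      where
      open import Algebra.Properties.CommutativeSemigroup +-commutativeSemigroup using (interchange)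

    record Counted (us : Vec A r) (D : ℕ) (U : Family) : Set where
      field
        series  : List (Series r)
        bounded : All (λ g → growth g ≤ D) series
        counts  : ∀ m → count D U (word us m) ≡ sumCoefficientsAt series m

    open Counted

    -- With `D` zero no letter may be kept, so there is no series to provide.
    KeepCounted : A → Vec A r → ℕ → Family → Set
    KeepCounted u us zero    U = ⊤
    KeepCounted u us (suc D) U = Counted (u ∷ us) D (keep u U)

    -- A word either contains no `u` or begins with one. Writing F for generating functions and B
    -- for the part free of t, this reads F(U) = B + t (F(keep u U) + F(skip u U)).
    counted-prepend : ∀ u (us : Vec A r) D (U : Family) → Counted us D U → KeepCounted u us D U →
                      Counted (u ∷ us) D (skip u U) → Counted (u ∷ us) D U
    counted-prepend u us D U B K S = record
      { series  = start ++ List.map times-t (rest D K S)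
      ; bounded = All.++⁺ (start-bounded (B .bounded)) (degree-times-t (rest-bounded D K S))
      ; counts  = λ
          { (zero ∷ ms)  → sym (trans (sumCoefficientsAt-++ start _ (0 ∷ ms))
              (trans (cong₂ _+_ (constant-at-0 (B .series) ms) (times-t-at-0 (rest D K S) ms))
              (trans (+-identityʳ _) (sym (B .counts ms)))))
          ; (suc m ∷ ms) → sym (trans (sumCoefficientsAt-++ start _ (suc m ∷ ms))
              (trans (cong₂ _+_ (constant-at-suc (B .series) ms m) (times-t-at-suc (rest D K S) m ms))
              (sym (rest-counts D K S m ms)))) }
      }
      where
      start : List (Series (suc _))
      start = List.map ((0 , 0) ∷_) (B .series)
      start-bounded : ∀ {gs} → All (λ g → growth g ≤ D) gs → All (λ g → growth g ≤ D) (List.map ((0 , 0) ∷_) gs)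
      start-bounded = All.map⁺
      rest : ∀ D → KeepCounted u us D U → Counted (u ∷ us) D (skip u U) → List (Series (suc _))
      rest zero    K S = S .series
      rest (suc D) K S = K .series ++ S .series
      rest-bounded : ∀ D K S → All (λ g → growth g ≤ D) (rest D K S)
      rest-bounded zero    K S = S .bounded
      rest-bounded (suc D) K S = All.++⁺ (All.map m≤n⇒m≤1+n (K .bounded)) (S .bounded)
      rest-counts : ∀ D K S m ms →
        count D U (u ∷ word (u ∷ us) (m ∷ ms)) ≡ sumCoefficientsAt (rest D K S) (m ∷ ms)
      rest-counts zero    K S m ms = S .counts (m ∷ ms)
      rest-counts (suc D) K S m ms = trans (cong₂ _+_ (K .counts (m ∷ ms)) (S .counts (m ∷ ms)))
        (sym (sumCoefficientsAt-++ (K .series) (S .series) (m ∷ ms)))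

    -- When skipping `u` changes nothing, F = B + t F(keep u U) + t F, so F = B / (1 - t) + t / (1 -
    -- t) F(keep u U). The first summand has no larger growth than B. The second gains at most one
    -- degree, which is paid for by the letter kept.
    counted-stable : ∀ u (us : Vec A r) D (U : Family) → Counted us D U → KeepCounted u us D U →
                     Within (u ∷ us) D U (skip u U) → Within (u ∷ us) D (skip u U) U →
                     Counted (u ∷ us) D U
    counted-stable u us D U B K f g = record
      { series  = start ++ List.map times-t/[1-t] (kept D K)
      ; bounded = All.++⁺ (All.map⁺ (B .bounded)) (kept-bounded D K)
      ; counts  = λ { (m ∷ ms) → sym (trans (sumCoefficientsAt-++ start _ (m ∷ ms))
          (trans (cong₂ _+_ (geometric (B .series) ms m) refl) (sym (go D B K f g m ms)))) }
      }
      where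
      start : List (Series (suc _))
      start = List.map ((0 , 1) ∷_) (B .series)
      kept : ∀ D → KeepCounted u us D U → List (Series (suc _))
      kept zero    K = []
      kept (suc D) K = K .series
      kept-bounded : ∀ D K → All (λ g → growth g ≤ D) (List.map times-t/[1-t] (kept D K))
      kept-bounded zero    K = []
      kept-bounded (suc D) K = degree-times-t/[1-t] (K .bounded)
      go : ∀ D (B : Counted us D U) (K : KeepCounted u us D U) →
           Within (u ∷ us) D U (skip u U) → Within (u ∷ us) D (skip u U) U → ∀ m ms →
           count D U (word (u ∷ us) (m ∷ ms)) ≡
           sumCoefficientsAt (B .series) ms + sumCoefficientsAt (List.map times-t/[1-t] (kept D K)) (m ∷ ms)
      go D B K f g zero ms = trans (B .counts ms) (sym (trans
        (cong (sumCoefficientsAt (B .series) ms +_) (times-t/[1-t]-at-0 (kept D K) ms)) (+-identityʳ _)))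
      go zero B K f g (suc m) ms = trans
        (count-cong zero (skip u U) U (word (u ∷ us) (m ∷ ms)) (g (m ∷ ms)) (f (m ∷ ms)))
        (go zero B K f g m ms)
      go (suc D) B K f g (suc m) ms = begin
        count D (keep u U) w + count (suc D) (skip u U) w
          ≡⟨ cong₂ _+_ (K .counts (m ∷ ms)) (count-cong (suc D) (skip u U) U w (g (m ∷ ms)) (f (m ∷ ms))) ⟩
        k + count (suc D) U w
          ≡⟨ cong (k +_) (go (suc D) B K f g m ms) ⟩
        k + (b + k⁺)
          ≡⟨ x∙yz≈y∙xz k b k⁺ ⟩
        b + (k + k⁺)
          ≡⟨ cong (b +_) (times-t/[1-t]-at-suc (K .series) m ms) ⟨
        b + sumCoefficientsAt (List.map times-t/[1-t] (K .series)) (suc m ∷ ms)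
          ∎
        where
        open ≡-Reasoning
        open import Algebra.Properties.CommutativeSemigroup +-commutativeSemigroup using (x∙yz≈y∙xz)
        w : List A
        w = word (u ∷ us) (m ∷ ms)
        b k k⁺ : ℕ
        b  = sumCoefficientsAt (B .series) ms
        k  = sumCoefficientsAt (K .series) (m ∷ ms)
        k⁺ = sumCoefficientsAt (List.map times-t/[1-t] (K .series)) (m ∷ ms)

    counted : (us : Vec A r) (D : ℕ) (U : Family) → Upward U → Counted us D U
    keepCounted : (u : A) (us : Vec A r) (D : ℕ) (U : Family) → Upward U → KeepCounted u us D U

    keepCounted u us zero    U up = tt
    keepCounted u us (suc D) U up = counted (u ∷ us) D (keep u U) (keep-upward {U} u up)

    counted [] D U up = record
      { series  = List.replicate (indicator (U [])) []
      ; bounded = All.replicate⁺ (indicator (U [])) z≤n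
      ; counts  = λ { [] → base (indicator (U [])) }
      }
      where
      base : ∀ n → n ≡ sumCoefficientsAt (List.replicate n []) []
      base zero    = refl
      base (suc n) = cong suc (base n)
    counted (u ∷ us) D U up = descend (proj₁ stabilises) 0 (+-identityʳ _)
      where
      stabilises = noetherian (u ∷ us) D (skips-chain u {U} up)
      base : ∀ j → Counted us D (skips j u U)
      base j = counted us D (skips j u U) (skips-upward j {U} u up)
      kept : ∀ j → KeepCounted u us D (skips j u U)
      kept j = keepCounted u us D (skips j u U) (skips-upward j {U} u up)
      -- Downward induction from the stabilisation point of `skips j u U` to `j = 0`; `n` is the
      -- distance still to go up.
      descend : ∀ n j → n + j ≡ proj₁ stabilises → Counted (u ∷ us) D (skips j u U)
      descend zero j refl = counted-stable u us D (skips j u U) (base j) (kept j)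
        (λ m τ short → grow {skips j u U} (skips-upward j {U} u up) u τ)
        (proj₂ stabilises (suc j))
      descend (suc n) j p = counted-prepend u us D (skips j u U) (base j) (kept j)
        (descend n (suc j) (trans (+-suc n j) p))

open Combinatorics

-- Functions that are eventually polynomial, with rational coefficients

module Polynomials where

  open import Algebra.Bundles using (CommutativeRing)
  open import Data.Rational.Base using (ℚ; 0ℚ; 1ℚ; _+_; _*_; -_; _-_; toℚᵘ; fromℚᵘ)
  open import Data.Rational.Properties
  open import Data.Rational.Solver using (module +-*-Solver)
  import Data.Rational.Unnormalised.Base as ℚᵘ
  import Data.Rational.Unnormalised.Properties as ℚᵘ
  open import Algebra.Definitions.RawSemiring +-*-rawSemiring using (product; _^_)

  private variable
    r D : ℕ

  -- Normalising fractions does not compute on a variable, so identities about `fromℕℚ` are checked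
  -- on unnormalised rationals.
  fromℕℚ-toℚᵘ : ∀ n → toℚᵘ (fromℕℚ n) ℚᵘ.≃ ℚᵘ.mkℚᵘ (ℤ.+ n) 0
  fromℕℚ-toℚᵘ n = toℚᵘ-fromℚᵘ (ℚᵘ.mkℚᵘ (ℤ.+ n) 0)

  fromℕℚ-+ : ∀ m n → fromℕℚ (m ℕ.+ n) ≡ fromℕℚ m + fromℕℚ n
  fromℕℚ-+ m n = toℚᵘ-injective (ℚᵘ.≃-trans (fromℕℚ-toℚᵘ (m ℕ.+ n)) (ℚᵘ.≃-trans
    (ℚᵘ.*≡* (cong (ℤ._* ℤ.+ 1) (trans (ℤ.pos-+ m n) (sym (cong₂ ℤ._+_ (ℤ.*-identityʳ (ℤ.+ m)) (ℤ.*-identityʳ (ℤ.+ n)))))))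
    (ℚᵘ.≃-sym (ℚᵘ.≃-trans (toℚᵘ-homo-+ (fromℕℚ m) (fromℕℚ n)) (ℚᵘ.+-cong (fromℕℚ-toℚᵘ m) (fromℕℚ-toℚᵘ n))))))

  fromℕℚ-* : ∀ m n → fromℕℚ (m ℕ.* n) ≡ fromℕℚ m * fromℕℚ n
  fromℕℚ-* m n = toℚᵘ-injective (ℚᵘ.≃-trans (fromℕℚ-toℚᵘ (m ℕ.* n)) (ℚᵘ.≃-trans
    (ℚᵘ.*≡* (cong (ℤ._* ℤ.+ 1) (ℤ.pos-* m n)))
    (ℚᵘ.≃-sym (ℚᵘ.≃-trans (toℚᵘ-homo-* (fromℕℚ m) (fromℕℚ n)) (ℚᵘ.*-cong (fromℕℚ-toℚᵘ m) (fromℕℚ-toℚᵘ n))))))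

  reciprocal : ∀ k → Σ[ q ∈ ℚ ] q * fromℕℚ (suc k) ≡ 1ℚ
  reciprocal k = fromℚᵘ⁻¹ , toℚᵘ-injective (ℚᵘ.≃-trans (toℚᵘ-homo-* fromℚᵘ⁻¹ (fromℕℚ (suc k)))
    (ℚᵘ.≃-trans (ℚᵘ.*-cong (toℚᵘ-fromℚᵘ (ℚᵘ.mkℚᵘ (ℤ.+ 1) k)) (fromℕℚ-toℚᵘ (suc k)))
    (ℚᵘ.*-inverseˡ (ℚᵘ.mkℚᵘ (ℤ.+ suc k) 0))))
    where
    fromℚᵘ⁻¹ : ℚ
    fromℚᵘ⁻¹ = Data.Rational.Base.fromℚᵘ (ℚᵘ.mkℚᵘ (ℤ.+ 1) k)

  evaluate-++ : ∀ (p q : Polynomial r) x → evaluate (p ++ q) x ≡ evaluate p x + evaluate q x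
  evaluate-++ []      q x = sym (+-identityˡ _)
  evaluate-++ (t ∷ p) q x = trans (cong (head +_) (evaluate-++ p q x)) (sym (+-assoc head (evaluate p x) (evaluate q x)))
    where
    head : ℚ
    head = Term.coeff t * product (λ i → x i ^ Term.exponent t i)

  scaleTerm : ℚ → Term r → Term r
  scaleTerm a t = record { coeff = a * Term.coeff t ; exponent = Term.exponent t }

  raiseTerm : Fin r → Term r → Term r
  raiseTerm i t = record { coeff = Term.coeff t ; exponent = updateAt (Term.exponent t) i suc }

  evaluate-scale : ∀ a (p : Polynomial r) x → evaluate (List.map (scaleTerm a) p) x ≡ a * evaluate p x
  evaluate-scale a []      x = sym (*-zeroʳ a)
  evaluate-scale a (t ∷ p) x = trans
    (cong₂ _+_ (*-assoc a (Term.coeff t) _) (evaluate-scale a p x))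
    (sym (*-distribˡ-+ a _ (evaluate p x)))

  monomial-raise : ∀ (x : Vector ℚ r) (e : Vector ℕ r) i →
    product (λ j → x j ^ updateAt e i suc j) ≡ x i * product (λ j → x j ^ e j)
  monomial-raise x e zero    = *-assoc (x zero) _ _
  monomial-raise x e (suc i) = trans
    (cong (x zero ^ e zero *_) (monomial-raise (x ∘ suc) (e ∘ suc) i))
    (x∙yz≈y∙xz (x zero ^ e zero) (x (suc i)) _)
    where open import Algebra.Properties.CommutativeSemigroup (CommutativeRing.*-commutativeSemigroup +-*-commutativeRing)

  evaluate-raise : ∀ i (p : Polynomial r) x → evaluate (List.map (raiseTerm i) p) x ≡ x i * evaluate p x
  evaluate-raise i []      x = sym (*-zeroʳ (x i))
  evaluate-raise i (t ∷ p) x = trans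
    (cong₂ _+_ (trans (cong (Term.coeff t *_) (monomial-raise x (Term.exponent t) i))
                      (x∙yz≈y∙xz (Term.coeff t) (x i) _))
               (evaluate-raise i p x))
    (sym (*-distribˡ-+ (x i) _ (evaluate p x)))
    where open import Algebra.Properties.CommutativeSemigroup (CommutativeRing.*-commutativeSemigroup +-*-commutativeRing)

  size-raise : ∀ (e : Vector ℕ r) i → ∑ℕ (updateAt e i suc) ≡ suc (∑ℕ e)
  size-raise e zero    = refl
  size-raise e (suc i) = trans (cong (e zero ℕ.+_) (size-raise (e ∘ suc) i)) (ℕ.+-suc (e zero) _)

  degree-scale : ∀ a {p : Polynomial r} → TotalDegree≤ D p → TotalDegree≤ D (List.map (scaleTerm a) p)
  degree-scale a h = All.map⁺ h

  degree-raise : ∀ i {p : Polynomial r} → TotalDegree≤ D p → TotalDegree≤ (suc D) (List.map (raiseTerm i) p)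
  degree-raise i h = All.map⁺ (All.map (λ {t} b → ℕ.≤-trans (ℕ.≤-reflexive (size-raise (Term.exponent t) i)) (s≤s b)) h)

  timesLinear : Fin r → ℚ → ℚ → Polynomial r → Polynomial r
  timesLinear i a b p = List.map (scaleTerm a) (List.map (raiseTerm i) p) ++ List.map (scaleTerm b) p

  evaluate-timesLinear : ∀ i a b (p : Polynomial r) x →
    evaluate (timesLinear i a b p) x ≡ (a * x i + b) * evaluate p x
  evaluate-timesLinear i a b p x = begin
    evaluate (timesLinear i a b p) x
      ≡⟨ evaluate-++ (List.map (scaleTerm a) (List.map (raiseTerm i) p)) _ x ⟩
    evaluate (List.map (scaleTerm a) (List.map (raiseTerm i) p)) x + evaluate (List.map (scaleTerm b) p) x
      ≡⟨ cong₂ _+_ (trans (evaluate-scale a (List.map (raiseTerm i) p) x) (cong (a *_) (evaluate-raise i p x)))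
                   (evaluate-scale b p x) ⟩
    a * (x i * evaluate p x) + b * evaluate p x
      ≡⟨ cong (_+ b * evaluate p x) (*-assoc a (x i) _) ⟨
    a * x i * evaluate p x + b * evaluate p x
      ≡⟨ *-distribʳ-+ (evaluate p x) (a * x i) b ⟨
    (a * x i + b) * evaluate p x
      ∎
    where open ≡-Reasoning

  degree-timesLinear : ∀ i a b {p : Polynomial r} → TotalDegree≤ D p → TotalDegree≤ (suc D) (timesLinear i a b p)
  degree-timesLinear i a b h =
    All.++⁺ (degree-scale a (degree-raise i h)) (degree-scale b (All.map ℕ.m≤n⇒m≤1+n h))

  -- `coeff 0 (suc k) t` is the binomial coefficient of t + k over k. The two absorption identities
  -- are proved together: after Pascal's rule each of them needs both at smaller arguments.
  binomial-rowˡ : ∀ k t → suc t ℕ.* coeff 0 (suc k) (suc t) ≡ (t ℕ.+ suc k) ℕ.* coeff 0 (suc k) t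
  binomial-rowʳ : ∀ k t → suc k ℕ.* coeff 0 (suc (suc k)) t ≡ (t ℕ.+ suc k) ℕ.* coeff 0 (suc k) t

  binomial-rowˡ zero t = cong₂ ℕ._*_ (ℕ.+-comm 1 t) refl
  binomial-rowˡ (suc k) zero = trans (ℕ.*-distribˡ-+ 1 (coeff 0 (suc k) 1) 1)
    (trans (cong (ℕ._+ 1) (binomial-rowˡ k zero)) (ℕ.+-comm _ 1))
  binomial-rowˡ (suc k) (suc t) = begin
    suc (suc t) ℕ.* (coeff 0 (suc k) (suc (suc t)) ℕ.+ b)
      ≡⟨ ℕ.*-distribˡ-+ (suc (suc t)) (coeff 0 (suc k) (suc (suc t))) b ⟩
    suc (suc t) ℕ.* coeff 0 (suc k) (suc (suc t)) ℕ.+ suc (suc t) ℕ.* b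
      ≡⟨ cong (ℕ._+ suc (suc t) ℕ.* b) (trans (binomial-rowˡ k (suc t)) (sym (binomial-rowʳ k (suc t)))) ⟩
    suc k ℕ.* b ℕ.+ suc (suc t) ℕ.* b
      ≡⟨ collect k t b ⟩
    (suc t ℕ.+ suc (suc k)) ℕ.* b ∎
    where
    open ≡-Reasoning
    b : ℕ
    b = coeff 0 (suc (suc k)) (suc t)
    collect : ∀ k t b → suc k ℕ.* b ℕ.+ suc (suc t) ℕ.* b ≡ (suc t ℕ.+ suc (suc k)) ℕ.* b
    collect = ℕ.solve-∀
  binomial-rowʳ k zero = refl
  binomial-rowʳ k (suc t) = begin
    suc k ℕ.* (b ℕ.+ coeff 0 (suc (suc k)) t)
      ≡⟨ ℕ.*-distribˡ-+ (suc k) b _ ⟩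
    suc k ℕ.* b ℕ.+ suc k ℕ.* coeff 0 (suc (suc k)) t
      ≡⟨ cong (suc k ℕ.* b ℕ.+_) (trans (binomial-rowʳ k t) (sym (binomial-rowˡ k t))) ⟩
    suc k ℕ.* b ℕ.+ suc t ℕ.* b
      ≡⟨ collect k t b ⟩
    (suc t ℕ.+ suc k) ℕ.* b ∎
    where
    open ≡-Reasoning
    b : ℕ
    b = coeff 0 (suc k) (suc t)
    collect : ∀ k t b → suc k ℕ.* b ℕ.+ suc t ℕ.* b ≡ (suc t ℕ.+ suc k) ℕ.* b
    collect = ℕ.solve-∀

  coeff-≤ : ∀ c k m → c ≤ m → coeff c k m ≡ coeff 0 k (m ∸ c)
  coeff-≤ zero    k m       z≤n     = refl
  coeff-≤ (suc c) k (suc m) (s≤s p) = coeff-≤ c k m p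

  -- The coefficient of t^m in t^c / (1 - t)^(k+2) is the one in
  -- t^c / (1 - t)^(k+1) multiplied by (m - c + k + 1) / (k + 1).
  timesBinomial : Fin r → ℕ → ℕ → Polynomial r → Polynomial r
  timesBinomial i c zero    p = p
  timesBinomial i c (suc k) p =
    timesLinear i q (q * (fromℕℚ (suc k) - fromℕℚ c)) (timesBinomial i c k p)
    where
    q : ℚ
    q = proj₁ (reciprocal k)

  degree-timesBinomial : ∀ i c k {p : Polynomial r} →
    TotalDegree≤ D p → TotalDegree≤ (k ℕ.+ D) (timesBinomial i c k p)
  degree-timesBinomial i c zero    h = h
  degree-timesBinomial i c (suc k) h = degree-timesLinear i (proj₁ (reciprocal k))
          (proj₁ (reciprocal k) * (fromℕℚ (suc k) - fromℕℚ c)) (degree-timesBinomial i c k h)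

  evaluate-timesBinomial : ∀ i c k (p : Polynomial r) (m : Vector ℕ r) → c ≤ m i →
    evaluate (timesBinomial i c k p) (fromℕℚ ∘ m) ≡ fromℕℚ (coeff c (suc k) (m i)) * evaluate p (fromℕℚ ∘ m)
  evaluate-timesBinomial i c zero p m c≤m =
    sym (trans (cong (λ n → fromℕℚ n * evaluate p (fromℕℚ ∘ m)) (trans (coeff-≤ c 1 (m i) c≤m) (coeff-0-1 (m i ∸ c))))
               (*-identityˡ _))
  evaluate-timesBinomial i c (suc k) p m c≤m = begin
    evaluate (timesLinear i q (q * (K - C)) (timesBinomial i c k p)) x
      ≡⟨ evaluate-timesLinear i q (q * (K - C)) (timesBinomial i c k p) x ⟩
    (q * x i + q * (K - C)) * evaluate (timesBinomial i c k p) x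
      ≡⟨ cong₂ (λ y z → (q * y + q * (K - C)) * z)
           (trans (cong fromℕℚ (sym (ℕ.m+[n∸m]≡n c≤m))) (fromℕℚ-+ c t))
           (trans (evaluate-timesBinomial i c k p m c≤m) (cong (λ n → fromℕℚ n * y) (coeff-≤ c (suc k) (m i) c≤m))) ⟩
    (q * (C + fromℕℚ t) + q * (K - C)) * (fromℕℚ (coeff 0 (suc k) t) * y)
      ≡⟨ rearrange q K C (fromℕℚ t) (fromℕℚ (coeff 0 (suc k) t)) y ⟩
    q * ((fromℕℚ t + K) * fromℕℚ (coeff 0 (suc k) t)) * y
      ≡⟨ cong (λ z → q * z * y) (begin
           (fromℕℚ t + K) * fromℕℚ (coeff 0 (suc k) t)        ≡⟨ cong (_* fromℕℚ (coeff 0 (suc k) t))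
                   (fromℕℚ-+ t (suc k)) ⟨
           fromℕℚ (t ℕ.+ suc k) * fromℕℚ (coeff 0 (suc k) t)  ≡⟨ fromℕℚ-* (t ℕ.+ suc k) (coeff 0 (suc k) t) ⟨
           fromℕℚ ((t ℕ.+ suc k) ℕ.* coeff 0 (suc k) t)       ≡⟨ cong fromℕℚ (binomial-rowʳ k t) ⟨
           fromℕℚ (suc k ℕ.* coeff 0 (suc (suc k)) t)         ≡⟨ fromℕℚ-* (suc k) (coeff 0 (suc (suc k)) t) ⟩
           K * fromℕℚ (coeff 0 (suc (suc k)) t)               ∎) ⟩
    q * (K * fromℕℚ (coeff 0 (suc (suc k)) t)) * y
      ≡⟨ cong (_* y) (trans (sym (*-assoc q K b)) (trans (cong (_* b) qK≡1) (*-identityˡ b))) ⟩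
    fromℕℚ (coeff 0 (suc (suc k)) t) * y
      ≡⟨ cong (λ n → fromℕℚ n * y) (coeff-≤ c (suc (suc k)) (m i) c≤m) ⟨
    fromℕℚ (coeff c (suc (suc k)) (m i)) * y
      ∎
    where
    open ≡-Reasoning
    x : Vector ℚ _
    x = fromℕℚ ∘ m
    q K C y : ℚ
    q = proj₁ (reciprocal k)
    K = fromℕℚ (suc k)
    C = fromℕℚ c
    y = evaluate p x
    qK≡1 : q * K ≡ 1ℚ
    qK≡1 = proj₂ (reciprocal k)
    t : ℕ
    t = m i ∸ c
    b : ℚ
    b = fromℕℚ (coeff 0 (suc (suc k)) t)
    rearrange : ∀ q K C T b y → (q * (C + T) + q * (K - C)) * (b * y) ≡ q * ((T + K) * b) * y
    rearrange = solve 6 (λ q K C T b y →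
      (q :* (C :+ T) :+ q :* (K :+ :- C)) :* (b :* y) := q :* ((T :+ K) :* b) :* y) refl
      where open +-*-Solver

  record EventuallyPolynomial (D : ℕ) (f : Vector ℕ r → ℕ) : Set where
    constructor eventually
    field
      polynomial   : Polynomial r
      totalDegree≤ : TotalDegree≤ D polynomial
      threshold    : ℕ
      agrees       : ∀ m → (∀ i → threshold ≤ m i) → fromℕℚ (f m) ≡ evaluate polynomial (fromℕℚ ∘ m)

  eventually-0 : EventuallyPolynomial {r} D (λ _ → 0)
  eventually-0 = eventually [] [] 0 (λ _ _ → refl)

  eventually-+ : ∀ {f g : Vector ℕ r → ℕ} → EventuallyPolynomial D f → EventuallyPolynomial D g →
                 EventuallyPolynomial D (λ m → f m ℕ.+ g m)
  eventually-+ {f = f} {g} (eventually p dp N hp) (eventually q dq N′ hq) =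
    eventually (p ++ q) (All.++⁺ dp dq) (N ⊔ N′) (λ m large → begin
      fromℕℚ (f m ℕ.+ g m)
        ≡⟨ fromℕℚ-+ (f m) (g m) ⟩
      fromℕℚ (f m) + fromℕℚ (g m)
        ≡⟨ cong₂ _+_ (hp m (λ i → ℕ.≤-trans (ℕ.m≤m⊔n N N′) (large i)))
                     (hq m (λ i → ℕ.≤-trans (ℕ.m≤n⊔m N N′) (large i))) ⟩
      evaluate p (fromℕℚ ∘ m) + evaluate q (fromℕℚ ∘ m)
        ≡⟨ evaluate-++ p q (fromℕℚ ∘ m) ⟨
      evaluate (p ++ q) (fromℕℚ ∘ m) ∎)
    where open ≡-Reasoning

  -- Meant for the number of pairs that lead in S but not in T, which is known only as a difference
  -- of two counts.
  eventually-∸ : ∀ {f g h : Vector ℕ r → ℕ} → (∀ m → f m ℕ.+ g m ≡ h m) →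
                 EventuallyPolynomial D h → EventuallyPolynomial D g → EventuallyPolynomial D f
  eventually-∸ {f = f} {g} {h} f+g≡h (eventually p dp N hp) (eventually q dq N′ hq) =
    eventually (p ++ List.map (scaleTerm (- 1ℚ)) q) (All.++⁺ dp (degree-scale (- 1ℚ) dq)) (N ⊔ N′) (λ m large → begin
      fromℕℚ (f m)
        ≡⟨ +-identityʳ (fromℕℚ (f m)) ⟨
      fromℕℚ (f m) + 0ℚ
        ≡⟨ cong (fromℕℚ (f m) +_) (+-inverseʳ (fromℕℚ (g m))) ⟨
      fromℕℚ (f m) + (fromℕℚ (g m) - fromℕℚ (g m))
        ≡⟨ +-assoc (fromℕℚ (f m)) (fromℕℚ (g m)) (- fromℕℚ (g m)) ⟨
      (fromℕℚ (f m) + fromℕℚ (g m)) - fromℕℚ (g m)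
        ≡⟨ cong₂ _+_ (trans (sym (fromℕℚ-+ (f m) (g m))) (cong fromℕℚ (f+g≡h m)))
                     (trans (cong -_ (sym (*-identityˡ (fromℕℚ (g m))))) (neg-distribˡ-* 1ℚ (fromℕℚ (g m)))) ⟩
      fromℕℚ (h m) + (- 1ℚ) * fromℕℚ (g m)
        ≡⟨ cong₂ (λ x y → x + (- 1ℚ) * y) (hp m (λ i → ℕ.≤-trans (ℕ.m≤m⊔n N N′) (large i)))
                                          (hq m (λ i → ℕ.≤-trans (ℕ.m≤n⊔m N N′) (large i))) ⟩
      evaluate p (fromℕℚ ∘ m) + (- 1ℚ) * evaluate q (fromℕℚ ∘ m)
        ≡⟨ cong (evaluate p (fromℕℚ ∘ m) +_) (evaluate-scale (- 1ℚ) q (fromℕℚ ∘ m)) ⟨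
      evaluate p (fromℕℚ ∘ m) + evaluate (List.map (scaleTerm (- 1ℚ)) q) (fromℕℚ ∘ m)
        ≡⟨ evaluate-++ p _ (fromℕℚ ∘ m) ⟨
      evaluate (p ++ List.map (scaleTerm (- 1ℚ)) q) (fromℕℚ ∘ m) ∎)
    where open ≡-Reasoning

  eventually-weaken : ∀ {D′} {f : Vector ℕ r → ℕ} → D ≤ D′ → EventuallyPolynomial D f → EventuallyPolynomial D′ f
  eventually-weaken D≤D′ (eventually p dp N hp) = eventually p (All.map (λ b → ℕ.≤-trans b D≤D′) dp) N hp

  eventually-∑ : ∀ n {f : Fin n → Vector ℕ r → ℕ} → (∀ i → EventuallyPolynomial D (f i)) →
                 EventuallyPolynomial D (λ m → ∑ℕ (λ i → f i m))
  eventually-∑ zero        h = eventually-0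
  eventually-∑ (suc n) {f} h = eventually-+ {f = f zero} {λ m → ∑ℕ (λ i → f (suc i) m)} (h zero)
          (eventually-∑ n (h ∘ suc))

  -- The induction removes factors of the series one by one, whereas the polynomial stays in all `r`
  -- variables; `ι` tells which variables the remaining factors belong to.
  eventually-coefficient : ∀ {n} (g : Series n) (ι : Fin n → Fin r) →
    EventuallyPolynomial (growth g) (λ m → coefficientAt g (Vec.tabulate (m ∘ ι)))
  eventually-coefficient {r} [] ι =
    eventually (record { coeff = 1ℚ ; exponent = λ _ → 0 } ∷ []) (ℕ.≤-reflexive (∑0 r) ∷ []) 0 (λ m _ →
      sym (trans (+-identityʳ _) (trans (*-identityˡ _) (constant r (fromℕℚ ∘ m)))))
    where
    ∑0 : ∀ r → ∑ℕ {r} (λ _ → 0) ≡ 0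
    ∑0 zero    = refl
    ∑0 (suc r) = ∑0 r
    constant : ∀ r (x : Vector ℚ r) → product (λ i → x i ^ 0) ≡ 1ℚ
    constant zero    x = refl
    constant (suc r) x = trans (*-identityˡ _) (constant r (x ∘ suc))
  -- The factor t^c has its only non-zero coefficient at c, so past c the product is zero.
  eventually-coefficient ((c , zero) ∷ g) ι = eventually [] [] (suc c) (λ m large →
    cong (λ n → fromℕℚ (n ℕ.* coefficientAt g (Vec.tabulate (m ∘ ι ∘ suc)))) (vanishes c _ (large (ι zero))))
    where
    vanishes : ∀ c m → suc c ≤ m → coeff c 0 m ≡ 0
    vanishes zero    (suc m) _       = refl
    vanishes (suc c) (suc m) (s≤s p) = vanishes c m p
  eventually-coefficient ((c , suc k) ∷ g) ι with eventually-coefficient g (ι ∘ suc)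
  ... | eventually p dp N hp = eventually (timesBinomial (ι zero) c k p) (degree-timesBinomial (ι zero) c k dp)
          (c ⊔ N) (λ m large →
    trans (fromℕℚ-* (coeff c (suc k) (m (ι zero))) _)
    (trans (cong (fromℕℚ (coeff c (suc k) (m (ι zero))) *_) (hp m (λ i → ℕ.≤-trans (ℕ.m≤n⊔m c N) (large i))))
    (sym (evaluate-timesBinomial (ι zero) c k p m (ℕ.≤-trans (ℕ.m≤m⊔n c N) (large (ι zero)))))))

  eventually-sumCoefficients : ∀ {gs : List (Series r)} → All (λ g → growth g ≤ D) gs →
    EventuallyPolynomial D (λ m → sumCoefficientsAt gs (Vec.tabulate m))
  eventually-sumCoefficients [] = eventually-0
  eventually-sumCoefficients {gs = g ∷ gs} (b ∷ bs) =
    eventually-+ {f = λ m → coefficientAt g (Vec.tabulate m)} {λ m → sumCoefficientsAt gs (Vec.tabulate m)}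
      (eventually-weaken b (eventually-coefficient g id)) (eventually-sumCoefficients bs)

open Polynomials

-- Leading terms in a vector space

module Subspaces {c} (em : ExcludedMiddle c) (k : Field c) (A : Module (Field.commutativeRing k) c c) where

  open Field k using (commutativeRing; 0#; 1#; inverse) renaming (Carrier to K; _≈_ to _≈ᴷ_; _*_ to _*ᴷ_)
  module K = Field k
  open LinearAlgebra commutativeRing
  open Module A
  open AbelianGroupProperties +ᴹ-abelianGroup using (⁻¹-∙-comm)
  open CommutativeSemigroupProperties (CommutativeMonoid.commutativeSemigroup +ᴹ-commutativeMonoid)
    using (interchange)
  open Indicator em

  linearCombination : ∀ {n} → Vector K n → Vector Carrierᴹ n → Carrierᴹ
  linearCombination a b = ∑ᴹ A (λ i → a i *ₗ b i)

  linearCombination∈ : ∀ {S} → IsSubmodule A S → ∀ {n} (a : Vector K n) {b : Vector Carrierᴹ n} →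
                 (∀ i → S (b i)) → S (linearCombination a b)
  linearCombination∈ isS {zero}  a h = IsSubmodule.0∈ isS
  linearCombination∈ isS {suc n} a h = IsSubmodule.+∈ isS (IsSubmodule.*ₗ∈ isS (a zero) (h zero))
                                                    (linearCombination∈ isS (a ∘ suc) (h ∘ suc))

  -- A basis of S / (S ∩ T).
  record RelativeBasis (S T : Pred Carrierᴹ c) (n : ℕ) : Set c where
    field
      basis       : Vector Carrierᴹ n
      basis∈      : ∀ i → S (basis i)
      spanning    : ∀ {x} → S x → ∃[ a ] ∃[ t ] T t × x ≈ᴹ linearCombination a basis +ᴹ t
      independent : ∀ a → T (linearCombination a basis) → ∀ i → a i ≈ᴷ 0#

  open RelativeBasis

  relativeBasis-zero : ∀ {S T} → (∀ {x} → S x → T x) → RelativeBasis S T 0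
  relativeBasis-zero S⊆T = record
    { basis       = λ ()
    ; basis∈      = λ ()
    ; spanning    = λ {x} s → (λ ()) , x , S⊆T s , ≈ᴹ-sym (+ᴹ-identityˡ x)
    ; independent = λ _ _ ()
    }

  relativeBasis-suc : ∀ {S S′ T n} → IsSubmodule A S → IsSubmodule A T → RelativeBasis S T n →
    (∀ {x} → S x → S′ x) → ∀ s → S′ s →
    (∀ {x} → S′ x → ∃[ α ] ∃[ y ] S y × x ≈ᴹ α *ₗ s +ᴹ y) →
    (∀ α {y} → S y → T (α *ₗ s +ᴹ y) → α ≈ᴷ 0#) →
    RelativeBasis S′ T (suc n)
  relativeBasis-suc isS isT B S⊆S′ s s∈S′ split unique = record
    { basis       = s Vector.∷ B .basis
    ; basis∈      = λ { zero → s∈S′ ; (suc i) → S⊆S′ (B .basis∈ i) }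
    ; spanning    = λ x∈S′ →
        let α , y , y∈S , x≈ = split x∈S′
            a , t , t∈T , y≈ = B .spanning y∈S
        in α Vector.∷ a , t , t∈T , ≈ᴹ-trans x≈ (≈ᴹ-trans (+ᴹ-congˡ y≈) (≈ᴹ-sym (+ᴹ-assoc _ _ _)))
    ; independent = λ a h →
        let a₀≈0 = unique (a zero) (linearCombination∈ isS (a ∘ suc) (B .basis∈)) h
        in λ { zero    → a₀≈0
             ; (suc i) → B .independent (a ∘ suc) (IsSubmodule.resp isT
                 (≈ᴹ-trans (+ᴹ-congʳ (≈ᴹ-trans (*ₗ-congʳ a₀≈0) (*ₗ-zeroˡ s))) (+ᴹ-identityˡ _)) h) i }
    }

  -- Elements of `T` vanish in the quotient, so enlarging `S` inside `S + T` leaves the quotient as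
  -- it is.
  relativeBasis-mod : ∀ {S S′ T n} → IsSubmodule A T → RelativeBasis S T n → (∀ {x} → S x → S′ x) →
    (∀ {x} → S′ x → ∃[ y ] ∃[ t ] S y × T t × x ≈ᴹ y +ᴹ t) → RelativeBasis S′ T n
  relativeBasis-mod isT B S⊆S′ split = record
    { basis       = B .basis
    ; basis∈      = λ i → S⊆S′ (B .basis∈ i)
    ; spanning    = λ x∈S′ →
        let y , t , y∈S , t∈T , x≈ = split x∈S′
            a , t′ , t′∈T , y≈ = B .spanning y∈S
        in a , t′ +ᴹ t , IsSubmodule.+∈ isT t′∈T t∈T ,
           ≈ᴹ-trans x≈ (≈ᴹ-trans (+ᴹ-congʳ y≈) (+ᴹ-assoc _ _ _))
    ; independent = B .independent
    }

  ∑-cong : ∀ {n} {u w : Vector Carrierᴹ n} → (∀ i → u i ≈ᴹ w i) → ∑ᴹ A u ≈ᴹ ∑ᴹ A w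
  ∑-cong {zero}  h = ≈ᴹ-refl
  ∑-cong {suc n} h = +ᴹ-cong (h zero) (∑-cong (h ∘ suc))

  ∑-split : ∀ m {n} (u : Vector Carrierᴹ (m ℕ.+ n)) →
            ∑ᴹ A u ≈ᴹ ∑ᴹ A (λ i → u (i ↑ˡ n)) +ᴹ ∑ᴹ A (λ j → u (m ↑ʳ j))
  ∑-split zero    u = ≈ᴹ-sym (+ᴹ-identityˡ _)
  ∑-split (suc m) u = ≈ᴹ-trans (+ᴹ-congˡ (∑-split m (u ∘ suc))) (≈ᴹ-sym (+ᴹ-assoc (u zero) _ _))

  either : ∀ m {n} (P : Fin (m ℕ.+ n) → Set c) → (∀ i → P (i ↑ˡ n)) → (∀ j → P (m ↑ʳ j)) → ∀ i → P i
  either m {n} P l r i with splitAt m i | join-splitAt m n i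
  ... | inj₁ j | p = subst P p (l j)
  ... | inj₂ j | p = subst P p (r j)

  relativeBasis-++ : ∀ {S T Q m n} → IsSubmodule A Q → IsSubmodule A T →
    (∀ {x} → Q x → T x) → (∀ {x} → T x → S x) →
    RelativeBasis S T m → RelativeBasis T Q n → RelativeBasis S Q (m ℕ.+ n)
  relativeBasis-++ {S} {T} {Q} {m} {n} isQ isT Q⊆T T⊆S B C = record
    { basis       = b
    ; basis∈      = either m (λ i → S (b i))
        (λ i → subst S (sym (lookup-++ˡ (B .basis) (C .basis) i)) (B .basis∈ i))
        (λ j → subst S (sym (lookup-++ʳ (B .basis) (C .basis) j)) (T⊆S (C .basis∈ j)))
    ; spanning    = λ x∈S →
        let a , t , t∈T , x≈ = B .spanning x∈S
            a′ , q , q∈Q , t≈ = C .spanning t∈T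
        in a Vector.++ a′ , q , q∈Q ,
           ≈ᴹ-trans x≈ (≈ᴹ-trans (+ᴹ-congˡ t≈) (≈ᴹ-trans (≈ᴹ-sym (+ᴹ-assoc _ _ _))
             (+ᴹ-congʳ (≈ᴹ-sym (≈ᴹ-trans (split (a Vector.++ a′)) (+ᴹ-cong
               (∑-cong (λ i → *ₗ-congʳ (K.reflexive (lookup-++ˡ a a′ i))))
               (∑-cong (λ j → *ₗ-congʳ (K.reflexive (lookup-++ʳ a a′ j))))))))))
    ; independent = λ a h →
        let left = B .independent (λ i → a (i ↑ˡ n)) (IsSubmodule.resp isT
                     (≈ᴹ-trans (+ᴹ-congʳ (split a)) (cancel _ _))
                     (IsSubmodule.+∈ isT (Q⊆T h) (IsSubmodule.-∈ isT
                             (linearCombination∈ isT (λ j → a (m ↑ʳ j)) (C .basis∈)))))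
            right = C .independent (λ j → a (m ↑ʳ j)) (IsSubmodule.resp isQ
                      (≈ᴹ-trans (split a) (≈ᴹ-trans (+ᴹ-congʳ (vanishes left)) (+ᴹ-identityˡ _))) h)
        in either m (λ i → a i ≈ᴷ 0#) left right
    }
    where
    b : Vector Carrierᴹ (m ℕ.+ n)
    b = B .basis Vector.++ C .basis
    split : ∀ a → linearCombination a b ≈ᴹ linearCombination (λ i → a (i ↑ˡ n)) (B .basis) +ᴹ
                                    linearCombination (λ j → a (m ↑ʳ j)) (C .basis)
    split a = ≈ᴹ-trans (∑-split m (λ i → a i *ₗ b i)) (+ᴹ-cong
      (∑-cong (λ i → *ₗ-congˡ (≈ᴹ-reflexive (lookup-++ˡ (B .basis) (C .basis) i))))
      (∑-cong (λ j → *ₗ-congˡ (≈ᴹ-reflexive (lookup-++ʳ (B .basis) (C .basis) j)))))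
    cancel : ∀ x y → (x +ᴹ y) +ᴹ -ᴹ y ≈ᴹ x
    cancel x y = ≈ᴹ-trans (+ᴹ-assoc x y (-ᴹ y)) (≈ᴹ-trans (+ᴹ-congˡ (-ᴹ‿inverseʳ y)) (+ᴹ-identityʳ x))
    vanishes : ∀ {l} {a : Vector K l} {b : Vector Carrierᴹ l} → (∀ i → a i ≈ᴷ 0#) → linearCombination a b ≈ᴹ 0ᴹ
    vanishes {zero}  h = ≈ᴹ-refl
    vanishes {suc l} h = ≈ᴹ-trans (+ᴹ-cong (≈ᴹ-trans (*ₗ-congʳ (h zero)) (*ₗ-zeroˡ _)) (vanishes (h ∘ suc)))
                                  (+ᴹ-identityˡ 0ᴹ)

  Adjoin : Pred Carrierᴹ c → Carrierᴹ → Pred Carrierᴹ c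
  Adjoin Q e x = ∃[ α ] ∃[ z ] Q z × x ≈ᴹ α *ₗ e +ᴹ z

  -- e is the leading term of an element of S, the lower terms being those in Q.
  Leads : Pred Carrierᴹ c → Pred Carrierᴹ c → Pred Carrierᴹ c
  Leads S Q e = ∃[ z ] Q z × S (e +ᴹ z)

  module _ {Q : Pred Carrierᴹ c} (isQ : IsSubmodule A Q) where

    private module Q = IsSubmodule isQ

    Adjoin-⊇ : ∀ {e x} → Q x → Adjoin Q e x
    Adjoin-⊇ {e} {x} x∈Q = 0# , x , x∈Q , ≈ᴹ-sym (≈ᴹ-trans (+ᴹ-congʳ (*ₗ-zeroˡ e)) (+ᴹ-identityˡ x))

    Adjoin-∋ : ∀ {e} → Adjoin Q e e
    Adjoin-∋ {e} = 1# , 0ᴹ , Q.0∈ , ≈ᴹ-sym (≈ᴹ-trans (+ᴹ-identityʳ _) (*ₗ-identityˡ e))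

    Adjoin-isSubmodule : ∀ e → IsSubmodule A (Adjoin Q e)
    Adjoin-isSubmodule e = record
      { resp = λ { x≈y (α , z , z∈Q , x≈) → α , z , z∈Q , ≈ᴹ-trans (≈ᴹ-sym x≈y) x≈ }
      ; 0∈   = Adjoin-⊇ Q.0∈
      ; +∈   = λ { (α , z , z∈Q , x≈) (β , w , w∈Q , y≈) → α K.+ β , z +ᴹ w , Q.+∈ z∈Q w∈Q ,
                   ≈ᴹ-trans (+ᴹ-cong x≈ y≈) (≈ᴹ-trans (interchange _ _ _ _) (+ᴹ-congʳ (≈ᴹ-sym (*ₗ-distribʳ e α β)))) }
      ; *ₗ∈  = λ { β (α , z , z∈Q , x≈) → β *ᴷ α , β *ₗ z , Q.*ₗ∈ β z∈Q ,
                   ≈ᴹ-trans (*ₗ-congˡ x≈) (≈ᴹ-trans (*ₗ-distribˡ β _ z) (+ᴹ-congʳ (≈ᴹ-sym (*ₗ-assoc β α e)))) }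
      }

  -- Leading terms compute dimensions: S ∩ (Q + ke) is larger than S ∩ Q exactly
  -- when e leads an element of S.
  module _ {S T Q : Pred Carrierᴹ c} (isS : IsSubmodule A S) (isT : IsSubmodule A T) (isQ : IsSubmodule A Q)
           (T⊆S : ∀ {x} → T x → S x) (e : Carrierᴹ) where

    private
      module S = IsSubmodule isS
      module T = IsSubmodule isT
      module Q = IsSubmodule isQ

      S∩Q-isSubmodule : IsSubmodule A (λ x → S x × Q x)
      S∩Q-isSubmodule = record
        { resp = λ { p (s , q) → S.resp p s , Q.resp p q }
        ; 0∈   = S.0∈ , Q.0∈
        ; +∈   = λ { (s , q) (s′ , q′) → S.+∈ s s′ , Q.+∈ q q′ }
        ; *ₗ∈  = λ { a (s , q) → S.*ₗ∈ a s , Q.*ₗ∈ a q }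
        }

      split : ∀ {x z₀} → S (e +ᴹ z₀) → Q z₀ → S x × Adjoin Q e x →
              ∃[ α ] ∃[ y ] (S y × Q y) × x ≈ᴹ α *ₗ (e +ᴹ z₀) +ᴹ y
      split {x} {z₀} s z₀∈Q (x∈S , α , z , z∈Q , x≈) =
        α , x +ᴹ -ᴹ (α *ₗ (e +ᴹ z₀)) ,
        (S.+∈ x∈S (S.-∈ (S.*ₗ∈ α s)) , Q.resp (≈ᴹ-sym y≈) (Q.+∈ z∈Q (Q.-∈ (Q.*ₗ∈ α z₀∈Q)))) ,
        ≈ᴹ-sym (≈ᴹ-trans (+ᴹ-comm _ _) (≈ᴹ-trans (+ᴹ-assoc x _ _)
          (≈ᴹ-trans (+ᴹ-congˡ (-ᴹ‿inverseˡ _)) (+ᴹ-identityʳ x))))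
        where
        y≈ : x +ᴹ -ᴹ (α *ₗ (e +ᴹ z₀)) ≈ᴹ z +ᴹ -ᴹ (α *ₗ z₀)
        y≈ = ≈ᴹ-trans
          (+ᴹ-cong x≈ (≈ᴹ-trans (-ᴹ‿cong (*ₗ-distribˡ α e z₀)) (≈ᴹ-sym (⁻¹-∙-comm (α *ₗ e) (α *ₗ z₀)))))
          (≈ᴹ-trans (interchange (α *ₗ e) z _ _)
          (≈ᴹ-trans (+ᴹ-congʳ (-ᴹ‿inverseʳ (α *ₗ e))) (+ᴹ-identityˡ _)))

      -- Division by `α` makes the leading coefficient one. The summand `w` allows for the basis
      -- vector `e + z₀`; elsewhere it is zero.
      leads : ∀ {S} → IsSubmodule A S → ∀ α → ¬ α ≈ᴷ 0# → ∀ {z w} → Q z → S (α *ₗ (e +ᴹ w) +ᴹ z) → Q w → Leads S Q e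
      leads isS α α≉0 {z} {w} z∈Q s w∈Q =
        let β , αβ≈1 = inverse α α≉0
            βα≈1 = K.trans (K.*-comm β α) αβ≈1
        in w +ᴹ β *ₗ z , Q.+∈ w∈Q (Q.*ₗ∈ β z∈Q) ,
           IsSubmodule.resp isS
             (≈ᴹ-trans (*ₗ-distribˡ β _ z) (≈ᴹ-trans
               (+ᴹ-congʳ (≈ᴹ-trans (≈ᴹ-sym (*ₗ-assoc β α _)) (≈ᴹ-trans (*ₗ-congʳ βα≈1) (*ₗ-identityˡ _))))
               (+ᴹ-assoc e w _)))
             (IsSubmodule.*ₗ∈ isS β s)

    relativeBasis-adjoin : ∀ {n} → RelativeBasis (λ x → S x × Q x) T n →
      RelativeBasis (λ x → S x × Adjoin Q e x) T (indicator (Leads S Q e × ¬ Leads T Q e) ℕ.+ n)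
    relativeBasis-adjoin B with em {Leads S Q e × ¬ Leads T Q e}
    ... | yes ((z₀ , z₀∈Q , s) , ¬leadsT) = relativeBasis-suc S∩Q-isSubmodule isT B
      (λ { (x∈S , x∈Q) → x∈S , Adjoin-⊇ isQ x∈Q })
      (e +ᴹ z₀) (s , 1# , z₀ , z₀∈Q , +ᴹ-congʳ (≈ᴹ-sym (*ₗ-identityˡ e)))
      (split s z₀∈Q)
      unique
      where
      unique : ∀ α {y} → S y × Q y → T (α *ₗ (e +ᴹ z₀) +ᴹ y) → α ≈ᴷ 0#
      unique α (_ , y∈Q) t with em {α ≈ᴷ 0#}
      ... | yes α≈0 = α≈0
      ... | no  α≉0 = ⊥-elim (¬leadsT (leads isT α α≉0 y∈Q t z₀∈Q))
    ... | no ¬new with em {Leads T Q e}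
    -- `T` itself contains `e + z₀`, so the multiple of `e` in any new element is absorbed by `T`.
    ...   | yes (z₀ , z₀∈Q , t) = relativeBasis-mod isT B
      (λ { (x∈S , x∈Q) → x∈S , Adjoin-⊇ isQ x∈Q })
      (λ x∈ → let α , y , y∈ , x≈ = split (T⊆S t) z₀∈Q x∈
              in y , α *ₗ (e +ᴹ z₀) , y∈ , T.*ₗ∈ α t , ≈ᴹ-trans x≈ (+ᴹ-comm _ _))
    -- Now `e` leads no element of `S` either, so `e` has coefficient zero in every element of `S`
    -- that lies in `Adjoin Q e`.
    ...   | no ¬leadsT = relativeBasis-mod isT B
      (λ { (x∈S , x∈Q) → x∈S , Adjoin-⊇ isQ x∈Q })
      (λ { {x} (x∈S , α , z , z∈Q , x≈) → x , 0ᴹ , (x∈S , lower x∈S α z∈Q x≈) , T.0∈ , ≈ᴹ-sym (+ᴹ-identityʳ x) })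
      where
      lower : ∀ {x} → S x → ∀ α {z} → Q z → x ≈ᴹ α *ₗ e +ᴹ z → Q x
      lower x∈S α {z} z∈Q x≈ with em {α ≈ᴷ 0#}
      ... | yes α≈0 = Q.resp (≈ᴹ-sym (≈ᴹ-trans x≈ (≈ᴹ-trans (+ᴹ-congʳ (≈ᴹ-trans (*ₗ-congʳ α≈0) (*ₗ-zeroˡ e)))
              (+ᴹ-identityˡ z)))) z∈Q
      ... | no α≉0 = ⊥-elim (¬new (leads isS α α≉0 z∈Q
                       (S.resp (≈ᴹ-trans x≈ (+ᴹ-congʳ (*ₗ-congˡ (≈ᴹ-sym (+ᴹ-identityʳ e))))) x∈S) Q.0∈ , ¬leadsT))

  module _ {X : Set} where

    open Counting em {X} using (countAll)

    Vectors : List X → Set c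
    Vectors c = ∀ {y} → y ⊑ c → Carrierᴹ

    -- The sublists of a ∷ c that skip a come before those that keep it:
    -- Full adjoins all vectors, Lower only those before the given one.
    Full : ∀ {l} → Pred Carrierᴹ c → Vectors l → Pred Carrierᴹ c
    Full {[]}    Q e = Adjoin Q (e [])
    Full {a ∷ l} Q e = Full (Full Q (λ τ → e (a ∷ʳ τ))) (λ τ → e (refl {x = a} ∷ τ))

    Lower : ∀ {l} → Pred Carrierᴹ c → Vectors l → ∀ {y} → y ⊑ l → Pred Carrierᴹ c
    Lower Q e []                = Q
    Lower Q e (a ∷ʳ τ)          = Lower Q (λ τ → e (a ∷ʳ τ)) τ
    Lower Q e (_∷_ {x = a} refl τ) = Lower (Full Q (λ τ → e (a ∷ʳ τ))) (λ τ → e (refl {x = a} ∷ τ)) τ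

    Leading : Pred Carrierᴹ c → ∀ {l} → Pred Carrierᴹ c → Vectors l → ∀ {y} → y ⊑ l → Set c
    Leading S Q e τ = Leads S (Lower Q e τ) (e τ)

    Full-isSubmodule : ∀ {l} {Q} → IsSubmodule A Q → (e : Vectors l) → IsSubmodule A (Full Q e)
    Full-isSubmodule {[]}    isQ e = Adjoin-isSubmodule isQ (e [])
    Full-isSubmodule {a ∷ l} isQ e = Full-isSubmodule (Full-isSubmodule isQ (λ τ → e (a ∷ʳ τ))) (λ τ → e (refl ∷ τ))

    Full-⊇ : ∀ {l} {Q} → IsSubmodule A Q → (e : Vectors l) → ∀ {x} → Q x → Full Q e x
    Full-⊇ {[]}    isQ e x∈Q = Adjoin-⊇ isQ x∈Q
    Full-⊇ {a ∷ l} isQ e x∈Q =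
      Full-⊇ (Full-isSubmodule isQ (λ τ → e (a ∷ʳ τ))) (λ τ → e (refl ∷ τ)) (Full-⊇ isQ (λ τ → e (a ∷ʳ τ)) x∈Q)

    Full-∋ : ∀ {l} {Q} → IsSubmodule A Q → (e : Vectors l) → ∀ {y} (τ : y ⊑ l) → Full Q e (e τ)
    Full-∋ isQ e []       = Adjoin-∋ isQ
    Full-∋ isQ e (a ∷ʳ τ) = Full-⊇ (Full-isSubmodule isQ (λ τ → e (a ∷ʳ τ))) (λ τ → e (refl ∷ τ))
                                   (Full-∋ isQ (λ τ → e (a ∷ʳ τ)) τ)
    Full-∋ isQ e (_∷_ {x = a} refl τ) = Full-∋ (Full-isSubmodule isQ (λ τ → e (a ∷ʳ τ))) (λ τ → e (refl ∷ τ)) τ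

    Lower-∋0 : ∀ {l} {Q} → IsSubmodule A Q → (e : Vectors l) → ∀ {y} (τ : y ⊑ l) → Lower Q e τ 0ᴹ
    Lower-∋0 isQ e []       = IsSubmodule.0∈ isQ
    Lower-∋0 isQ e (a ∷ʳ τ) = Lower-∋0 isQ (λ τ → e (a ∷ʳ τ)) τ
    Lower-∋0 isQ e (_∷_ {x = a} refl τ) = Lower-∋0 (Full-isSubmodule isQ (λ τ → e (a ∷ʳ τ))) (λ τ → e (refl ∷ τ)) τ

    -- The vectors are adjoined one at a time in increasing order. Each contributes the indicator
    -- from `relativeBasis-adjoin`, and `countAll` adds these up along the same recursion.
    relativeBasis-full : ∀ {S T} → IsSubmodule A S → IsSubmodule A T → (∀ {x} → T x → S x) →
      ∀ {l} {Q} → IsSubmodule A Q → (e : Vectors l) → ∀ {n} → RelativeBasis (λ x → S x × Q x) T n →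
      RelativeBasis (λ x → S x × Full Q e x) T (countAll l (λ τ → Leading S Q e τ × ¬ Leading T Q e τ) ℕ.+ n)
    relativeBasis-full isS isT T⊆S {[]}    isQ e B = relativeBasis-adjoin isS isT isQ T⊆S (e []) B
    relativeBasis-full {S} {T} isS isT T⊆S {a ∷ l} isQ e B = subst (RelativeBasis _ T)
            (sym (ℕ.+-assoc (countAll l _) _ _))
      (relativeBasis-full isS isT T⊆S (Full-isSubmodule isQ (λ τ → e (a ∷ʳ τ))) (λ τ → e (refl ∷ τ))
        (relativeBasis-full isS isT T⊆S isQ (λ τ → e (a ∷ʳ τ)) B))

  0-isSubmodule : IsSubmodule A (_≈ᴹ 0ᴹ)
  0-isSubmodule = record
    { resp = λ p q → ≈ᴹ-trans (≈ᴹ-sym p) q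
    ; 0∈   = ≈ᴹ-refl
    ; +∈   = λ p q → ≈ᴹ-trans (+ᴹ-cong p q) (+ᴹ-identityˡ 0ᴹ)
    ; *ₗ∈  = λ a p → ≈ᴹ-trans (*ₗ-congˡ p) (*ₗ-zeroʳ a)
    }

  relativeBasis-dimension : ∀ {S T n} → (∀ x → S x) → (∀ {x} → T x → x ≈ᴹ 0ᴹ) → IsSubmodule A T →
                            RelativeBasis S T n → HasDimension A n
  relativeBasis-dimension {n = n} whole T⊆0 isT B = record
    { basis       = B .basis
    ; spanning    = λ x → let a , t , t∈T , x≈ = B .spanning (whole x)
                          in n , a , (λ i → i) , ≈ᴹ-trans x≈ (≈ᴹ-trans (+ᴹ-congˡ (T⊆0 t∈T)) (+ᴹ-identityʳ _))
    ; independent = λ a p → B .independent a (IsSubmodule.resp isT (≈ᴹ-sym p) (IsSubmodule.0∈ isT))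
    }

  relativeBasis-filtration : ∀ l (step : Fin (suc l) → Pred Carrierᴹ c) → (∀ i → IsSubmodule A (step i)) →
    (∀ i {x} → step (inject₁ i) x → step (suc i) x) →
    (n : Fin l → ℕ) → (∀ i → RelativeBasis (step (suc i)) (step (inject₁ i)) (n i)) →
    RelativeBasis (step (fromℕ l)) (step zero) (∑ℕ n)
  relativeBasis-filtration zero    step isSub mono n B = relativeBasis-zero (λ x∈ → x∈)
  relativeBasis-filtration (suc l) step isSub mono n B =
    subst (RelativeBasis _ _) (ℕ.+-comm (∑ℕ (n ∘ suc)) (n zero))
      (relativeBasis-++ (isSub zero) (isSub (suc zero)) (mono zero) (to-top l (step ∘ suc) (λ i → mono (suc i)))
        (relativeBasis-filtration l (step ∘ suc) (isSub ∘ suc) (λ i → mono (suc i)) (n ∘ suc) (B ∘ suc))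
        (B zero))
    where
    to-top : ∀ l (step : Fin (suc l) → Pred Carrierᴹ c) → (∀ i {x} → step (inject₁ i) x → step (suc i) x) →
             ∀ {x} → step zero x → step (fromℕ l) x
    to-top zero    step mono x∈ = x∈
    to-top (suc l) step mono x∈ = to-top l (step ∘ suc) (λ i → mono (suc i)) (mono zero x∈)

-- Transport of leading terms and bases along linear maps and relations

module _ {c} (em : ExcludedMiddle c) (k : Field c) {A B : Module (Field.commutativeRing k) c c} where

  open Field k using (commutativeRing; 0#; 1#) renaming (Carrier to K; -_ to -ᴷ_)
  open LinearAlgebra commutativeRing
  private
    module A = Module A
    module B = Module B
    module SA = Subspaces em k A
    module SB = Subspaces em k B

  module _ {f : A.Carrierᴹ → B.Carrierᴹ} (linear : IsLinear A B f) where

    private module f = ModuleMorphisms.IsModuleHomomorphism linear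

    linearCombination-homo : ∀ {n} (a : Vector K n) b → f (SA.linearCombination a b) B.≈ᴹ SB.linearCombination a (f ∘ b)
    linearCombination-homo {zero}  a b = f.0ᴹ-homo
    linearCombination-homo {suc n} a b = B.≈ᴹ-trans (f.+ᴹ-homo _ _)
      (B.+ᴹ-cong (f.*ₗ-homo (a zero) (b zero)) (linearCombination-homo (a ∘ suc) (b ∘ suc)))

    Adjoin-map : ∀ {Q Q′ e e′} → (∀ {x} → Q x → Q′ (f x)) → f e B.≈ᴹ e′ →
                 ∀ {x} → SA.Adjoin Q e x → SB.Adjoin Q′ e′ (f x)
    Adjoin-map {e = e} Q→Q′ p (α , z , z∈Q , x≈) = α , f z , Q→Q′ z∈Q ,
      B.≈ᴹ-trans (f.⟦⟧-cong x≈) (B.≈ᴹ-trans (f.+ᴹ-homo _ z)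
        (B.+ᴹ-congʳ (B.≈ᴹ-trans (f.*ₗ-homo α e) (B.*ₗ-congˡ p))))

    module _ {X : Set} where

      Full-map : ∀ {l l′ : List X} (σ : l ⊑ l′) {Q Q′} → IsSubmodule B Q′ → (∀ {x} → Q x → Q′ (f x)) →
        (e : SA.Vectors l) (e′ : SB.Vectors l′) → (∀ {y} (τ : y ⊑ l) → f (e τ) B.≈ᴹ e′ (⊆-trans τ σ)) →
        ∀ {x} → SA.Full Q e x → SB.Full Q′ e′ (f x)
      Full-map []         isQ′ Q→Q′ e e′ p = Adjoin-map Q→Q′ (p [])
      Full-map (a ∷ʳ σ)   isQ′ Q→Q′ e e′ p x∈ =
        SB.Full-⊇ (SB.Full-isSubmodule isQ′ (λ τ → e′ (a ∷ʳ τ))) (λ τ → e′ (refl ∷ τ))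
          (Full-map σ isQ′ Q→Q′ e (λ τ → e′ (a ∷ʳ τ)) p x∈)
      Full-map (_∷_ {x = a} refl σ) isQ′ Q→Q′ e e′ p =
        Full-map σ (SB.Full-isSubmodule isQ′ (λ τ → e′ (a ∷ʳ τ)))
          (Full-map σ isQ′ Q→Q′ (λ τ → e (a ∷ʳ τ)) (λ τ → e′ (a ∷ʳ τ)) (λ τ → p (a ∷ʳ τ)))
          (λ τ → e (refl ∷ τ)) (λ τ → e′ (refl ∷ τ)) (λ τ → p (refl ∷ τ))

      -- Composition with `σ` is monotone for the order on embeddings: a letter that `σ` adds is
      -- skipped by all of them, and at a letter of `l` the skipping half goes to the skipping half
      -- and the keeping half to the keeping half.
      Lower-map : ∀ {l l′ : List X} (σ : l ⊑ l′) {Q Q′} → IsSubmodule B Q′ → (∀ {x} → Q x → Q′ (f x)) →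
        (e : SA.Vectors l) (e′ : SB.Vectors l′) → (∀ {y} (τ : y ⊑ l) → f (e τ) B.≈ᴹ e′ (⊆-trans τ σ)) →
        ∀ {y} (τ : y ⊑ l) {x} → SA.Lower Q e τ x → SB.Lower Q′ e′ (⊆-trans τ σ) (f x)
      Lower-map []       isQ′ Q→Q′ e e′ p [] x∈ = Q→Q′ x∈
      Lower-map (a ∷ʳ σ) isQ′ Q→Q′ e e′ p τ  x∈ = Lower-map σ isQ′ Q→Q′ e (λ τ → e′ (a ∷ʳ τ)) p τ x∈
      Lower-map (_∷_ {x = a} refl σ) isQ′ Q→Q′ e e′ p (.a ∷ʳ τ) x∈ =
        Lower-map σ isQ′ Q→Q′ (λ τ → e (a ∷ʳ τ)) (λ τ → e′ (a ∷ʳ τ)) (λ τ → p (a ∷ʳ τ)) τ x∈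
      Lower-map (_∷_ {x = a} refl σ) isQ′ Q→Q′ e e′ p (refl ∷ τ) x∈ =
        Lower-map σ (SB.Full-isSubmodule isQ′ (λ τ → e′ (a ∷ʳ τ)))
          (Full-map σ isQ′ Q→Q′ (λ τ → e (a ∷ʳ τ)) (λ τ → e′ (a ∷ʳ τ)) (λ τ → p (a ∷ʳ τ)))
          (λ τ → e (refl ∷ τ)) (λ τ → e′ (refl ∷ τ)) (λ τ → p (refl ∷ τ)) τ x∈

      Leading-map : ∀ {S S′} → IsSubmodule B S′ → (∀ {x} → S x → S′ (f x)) →
        ∀ {l l′ : List X} (σ : l ⊑ l′) {Q Q′} → IsSubmodule B Q′ → (∀ {x} → Q x → Q′ (f x)) →
        (e : SA.Vectors l) (e′ : SB.Vectors l′) → (∀ {y} (τ : y ⊑ l) → f (e τ) B.≈ᴹ e′ (⊆-trans τ σ)) →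
        ∀ {y} (τ : y ⊑ l) → SA.Leading S Q e τ → SB.Leading S′ Q′ e′ (⊆-trans τ σ)
      Leading-map isS′ S→S′ σ isQ′ Q→Q′ e e′ p τ (z , z∈ , s) =
        f z , Lower-map σ isQ′ Q→Q′ e e′ p τ z∈ ,
        IsSubmodule.resp isS′ (B.≈ᴹ-trans (f.+ᴹ-homo _ z) (B.+ᴹ-congʳ (p τ))) (S→S′ s)

    dimension-iso : {h : B.Carrierᴹ → A.Carrierᴹ} → IsLinear B A h →
      (∀ x → h (f x) A.≈ᴹ x) → (∀ y → f (h y) B.≈ᴹ y) → ∀ {n} → HasDimension A n → HasDimension B n
    dimension-iso {h} linear⁻¹ hf fh D = record
      { basis       = f ∘ basis
      ; spanning    = λ y → let n , a , i , hy≈ = spanning (h y)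
                            in n , a , i , B.≈ᴹ-trans (B.≈ᴹ-sym (fh y))
                                    (B.≈ᴹ-trans (f.⟦⟧-cong hy≈) (linearCombination-homo a (basis ∘ i)))
      ; independent = λ a p → independent a (A.≈ᴹ-trans (A.≈ᴹ-sym (hf _)) (A.≈ᴹ-trans
                        (h.⟦⟧-cong (B.≈ᴹ-trans (linearCombination-homo a basis) p)) h.0ᴹ-homo))
      }
      where
      open HasDimension D
      module h = ModuleMorphisms.IsModuleHomomorphism linear⁻¹

  -- A map of subquotients acts on classes only and need not lift to a linear map of
  -- representatives; a relation between representatives makes such a choice unnecessary.
  record LinearRelation (R : A.Carrierᴹ → B.Carrierᴹ → Set c) : Set c where
    field
      R-resp : ∀ {x x′ y y′} → x A.≈ᴹ x′ → y B.≈ᴹ y′ → R x y → R x′ y′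
      R-0    : R A.0ᴹ B.0ᴹ
      R-+    : ∀ {x x′ y y′} → R x y → R x′ y′ → R (x A.+ᴹ x′) (y B.+ᴹ y′)
      R-*    : ∀ a {x y} → R x y → R (a A.*ₗ x) (a B.*ₗ y)

  -- The hypotheses say that R induces an isomorphism S / T ≅ S′ / T′.
  module _ {R : A.Carrierᴹ → B.Carrierᴹ → Set c} (isR : LinearRelation R) where

    open LinearRelation isR

    relativeBasis-transport : ∀ {S T : Pred A.Carrierᴹ c} {S′ T′ : Pred B.Carrierᴹ c} {n} →
      (∀ {x} → S x → ∃[ y ] R x y) → (∀ {x y} → R x y → S′ y) →
      (∀ {y} → S′ y → ∃[ x ] S x × R x y) →
      (∀ {x y} → R x y → T x → T′ y) → (∀ {x y} → R x y → T′ y → T x) → IsSubmodule A T →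
      SA.RelativeBasis S T n → SB.RelativeBasis S′ T′ n
    relativeBasis-transport {n = n} total into onto T→T′ T′→T isT D = record
      { basis       = b
      ; basis∈      = λ i → into (proj₂ (total (basis∈ i)))
      ; spanning    = λ {y} y∈ →
          let x , x∈ , xRy = onto y∈
              a , t , t∈ , x≈ = spanning x∈
              -- By linearity of `R` this remainder corresponds to `t`, and hence lies in `T′`.
              t′ = y B.+ᴹ (-ᴷ 1#) B.*ₗ SB.linearCombination a b
          in a , t′ , T→T′ (R-resp (difference x≈) B.≈ᴹ-refl (R-+ xRy (R-* (-ᴷ 1#) (related a)))) t∈ ,
             B.≈ᴹ-sym (restore y (SB.linearCombination a b))
      ; independent = λ a h → independent a (T′→T (related a) h)
      }
      where
      open SA.RelativeBasis D
      b : Vector B.Carrierᴹ n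
      b i = proj₁ (total (basis∈ i))
      related-terms : ∀ {n} (a : Vector K n) {u w} → (∀ i → R (u i) (w i)) →
                      R (SA.linearCombination a u) (SB.linearCombination a w)
      related-terms {zero}  a h = R-0
      related-terms {suc n} a h = R-+ (R-* (a zero) (h zero)) (related-terms (a ∘ suc) (h ∘ suc))
      related : ∀ a → R (SA.linearCombination a basis) (SB.linearCombination a b)
      related a = related-terms a (λ i → proj₂ (total (basis∈ i)))
      module _ (N : Module commutativeRing c c) where
        open Module N
        cancel : ∀ x y → (x +ᴹ y) +ᴹ (-ᴷ 1#) *ₗ x ≈ᴹ y
        cancel x y = ≈ᴹ-trans (+ᴹ-congʳ (+ᴹ-comm x y)) (≈ᴹ-trans (+ᴹ-assoc y x _)
          (≈ᴹ-trans (+ᴹ-congˡ (≈ᴹ-trans (+ᴹ-congʳ (≈ᴹ-sym (*ₗ-identityˡ x))) (≈ᴹ-trans (≈ᴹ-sym (*ₗ-distribʳ x 1# (-ᴷ 1#)))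
            (≈ᴹ-trans (*ₗ-congʳ (Field.-‿inverseʳ k 1#)) (*ₗ-zeroˡ x))))) (+ᴹ-identityʳ y)))
      difference : ∀ {x z t} → x A.≈ᴹ z A.+ᴹ t → x A.+ᴹ (-ᴷ 1#) A.*ₗ z A.≈ᴹ t
      difference {x} {z} {t} p = A.≈ᴹ-trans (A.+ᴹ-congʳ p) (cancel A z t)
      restore : ∀ y z → z B.+ᴹ (y B.+ᴹ (-ᴷ 1#) B.*ₗ z) B.≈ᴹ y
      restore y z = B.≈ᴹ-trans (B.≈ᴹ-sym (B.+ᴹ-assoc z y _)) (cancel B z y)

-- Contracting leaves

reverseIf-false : ∀ {H} (x : Cell H) → reverseIf {H} false x ≡ x
reverseIf-false (inj₁ _) = refl
reverseIf-false (inj₂ _) = refl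

-- If φ = χ ∘ ι and ι are contractions, then so is χ.  The section of ι serves to
-- lift cycles from the fibres of χ to those of φ.
module Cancellation {G G′ H : Graph}
  {ι : Morphism G G′} (Ι : IsContraction ι) {φ : Morphism G H} (Φ : IsContraction φ)
  (χ : Morphism G′ H) (χι≈φ : χ ∘ₘ ι ≈ₘ φ)
  (section : Morphism G′ G) (s : E G′ → E G) (s-injective : ∀ {e f} → s e ≡ s f → e ≡ f)
  (section-s : ∀ e → onE section e ≡ inj₂ (s e , false)) (ι-s : ∀ e → onE ι (s e) ≡ inj₂ (e , false))
  where

  open _≈ₘ_

  private
    module Ι = IsContraction Ι
    module Φ = IsContraction Φ

    reverse-vertex : ∀ b (x : Cell H) {w} → reverseIf {H} b x ≡ inj₁ w → x ≡ inj₁ w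
    reverse-vertex b (inj₁ _) p = p

    φ-s : ∀ e → onE φ (s e) ≡ onE χ e
    φ-s e = trans (sym (≈E χι≈φ (s e))) (trans (cong (onCell χ) (ι-s e)) (reverseIf-false (onE χ e)))

    project-edge : ∀ {w x y} → Adjacent (fibre φ w) x y → Star (Adjacent (fibre χ w)) (onV ι x) (onV ι y)
    project-edge {w} (e , t , e∈ , refl , refl) = along (onE ι e) refl
      where
      image : onCell χ (onE ι e) ≡ inj₁ w
      image = trans (≈E χι≈φ e) e∈
      along : ∀ x → onE ι e ≡ x → Star (Adjacent (fibre χ w)) (onV ι (Graph.end G e t)) (onV ι (Graph.end G e (not t)))
      along (inj₁ x) p = subst (Star _ _) (trans (at t) (sym (at (not t)))) ε
        where
        at : ∀ t → onV ι (Graph.end G e t) ≡ x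
        at t = trans (compatible ι e t) (cong (λ y → endᶜ G′ y t) p)
      along (inj₂ (e′ , b)) p =
        (e′ , b xor t , reverse-vertex b _ (trans (cong (onCell χ) (sym p)) image) ,
         sym (at t) , trans (cong (Graph.end G′ e′) (not-xor b t)) (sym (at (not t)))) ◅ ε
        where
        at : ∀ t → onV ι (Graph.end G e t) ≡ Graph.end G′ e′ (b xor t)
        at t = trans (compatible ι e t) (cong (λ y → endᶜ G′ y t) p)
        not-xor : ∀ b t → not (b xor t) ≡ b xor not t
        not-xor true  t = refl
        not-xor false t = refl

    project : ∀ {w x y} → Star (Adjacent (fibre φ w)) x y → Star (Adjacent (fibre χ w)) (onV ι x) (onV ι y)
    project ε            = ε
    project (step ◅ walk) = project-edge step ◅◅ project walk

    module _ {w : V H} (z : Chain G′) (cycle : IsCycle (fibre χ w) z) where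

      open IsCycle cycle

      lifted : Chain G
      lifted = pushforward section z

      lifted-term : ∀ e f → z e ℤ.* coefficient {G} (onE section e) f ≡ z e ℤ.* δ (s e) f
      lifted-term e f rewrite section-s e = cong (z e ℤ.*_) (ℤ.*-identityˡ (δ (s e) f))

      lifted-cycle : IsCycle (fibre φ w) lifted
      lifted-cycle = record
        { supported = λ f f∉ → sum-0 _ (λ e → trans (lifted-term e f) (off-fibre f f∉ e))
        ; boundary  = λ v → trans (∂-pushforward section z v) (sum-0 _ (λ u →
            trans (cong (δ (onV section u) v ℤ.*_) (boundary u)) (ℤ.*-zeroʳ (δ (onV section u) v))))
        }
        where
        off-fibre : ∀ f → onE φ f ≢ inj₁ w → ∀ e → z e ℤ.* δ (s e) f ≡ 0ℤ
        off-fibre f f∉ e with s e ≟ f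
        ... | yes refl = cong (ℤ._* 1ℤ) (supported e (λ e∈ → f∉ (trans (φ-s e) e∈)))
        ... | no _     = ℤ.*-zeroʳ (z e)

      cycle-vanishes : ∀ e → z e ≡ 0ℤ
      -- As `s` is injective, the lift has coefficient exactly `z e` at `s e`; being a cycle in a
      -- tree, it is zero.
      cycle-vanishes e = begin
        z e                                 ≡⟨ sum-δ z e ⟨
        sum (λ f → z f ℤ.* δ e f)           ≡⟨ sum-cong-≗ (λ f → cong (z f ℤ.*_) (δ-s f)) ⟩
        sum (λ f → z f ℤ.* δ (s f) (s e))   ≡⟨ sum-cong-≗ (λ f → lifted-term f (s e)) ⟨
        lifted (s e)                        ≡⟨ acyclic (Contractible.H₁-rank-0 (Φ.vertexFibre w)) lifted
                                                         lifted-cycle (s e) ⟩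
        0ℤ                                  ∎
        where
        open ≡-Reasoning
        δ-s : ∀ f → δ e f ≡ δ (s f) (s e)
        δ-s f with e ≟ f
        ... | yes refl = sym (δ-refl (s e))
        ... | no e≢f   = sym (δ-≢ (λ p → e≢f (sym (s-injective p))))

    edgeFibre : ∀ e″ → ∃! _≡_ (λ e → MapsOnto χ e e″)
    edgeFibre e″ with Φ.edgeFibre e″
    ... | e , (b , p) , unique = over (onE ι e) refl
      where
      over : ∀ x → onE ι e ≡ x → ∃! _≡_ (λ e → MapsOnto χ e e″)
      -- An edge collapsed by `ι` is collapsed by `φ` too, so the edge over `e″` survives in `G′`.
      over (inj₁ x) q with trans (sym (cong (onCell χ) q)) (trans (≈E χι≈φ e) p)
      ... | ()
      over (inj₂ (e′ , b′)) q = e′ , onto (onE χ e′) refl , λ {f} (b″ , r) →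
        only f (unique (b″ , trans (φ-s f) r))
        where
        onto : ∀ x → onE χ e′ ≡ x → MapsOnto χ e′ e″
        onto x r with trans (sym (cong (reverseIf {H} b′) r)) (trans (sym (cong (onCell χ) q)) (trans (≈E χι≈φ e) p))
        onto (inj₂ (_ , b‴)) r | refl = b‴ , r
        only : ∀ f → e ≡ s f → e′ ≡ f
        only f refl with trans (sym q) (ι-s f)
        ... | refl = refl

  isContraction : IsContraction χ
  isContraction = record
    { vertexFibre = λ w → record
        { nonempty  = let v , p = Contractible.nonempty (Φ.vertexFibre w)
                      in onV ι v , trans (≈V χι≈φ v) p
        ; connected = λ u v p q →
            let u₀ , u≡ = Contractible.nonempty (Ι.vertexFibre u)
                v₀ , v≡ = Contractible.nonempty (Ι.vertexFibre v)
            in subst₂ (Star _) u≡ v≡ (project (Contractible.connected (Φ.vertexFibre w) u₀ v₀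
                 (trans (sym (≈V χι≈φ u₀)) (trans (cong (onV χ) u≡) p))
                 (trans (sym (≈V χι≈φ v₀)) (trans (cong (onV χ) v≡) q))))
        ; H₁-rank-0 = acyclic⇒H₁-rank-0 cycle-vanishes
        }
    ; edgeFibre = edgeFibre
    }

-- to i is the leaf that i becomes, or nothing if the edge of i is contracted.
record LeafMap {X : Set} {k′ k : ℕ} (at′ : Fin k′ → X) (at : Fin k → X) : Set where
  field
    to      : Fin k′ → Maybe (Fin k)
    from    : Fin k → Fin k′
    to-from : ∀ j → to (from j) ≡ just j
    from-to : ∀ {i j} → to i ≡ just j → i ≡ from j
    label   : ∀ j → at′ (from j) ≡ at j

  from-injective : ∀ {i j} → from i ≡ from j → i ≡ j
  from-injective {i} {j} p with trans (sym (to-from i)) (trans (cong to p) (to-from j))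
  ... | refl = refl

module _ (G : Graph) {k : ℕ} (at : Fin k → V G) where

  end-old : ∀ e s → Graph.end (attachLeaves G k at) (e ↑ˡ k) s ≡ Graph.end G e s ↑ˡ k
  end-old e s rewrite splitAt-↑ˡ (#E G) e k = refl

  end-leaf : ∀ j s → Graph.end (attachLeaves G k at) (#E G ↑ʳ j) s ≡ (if s then #V G ↑ʳ j else at j ↑ˡ k)
  end-leaf j s rewrite splitAt-↑ʳ (#E G) k j = refl

  -- No other edge ends at the leaf. Consequently a cycle is zero on all leaf edges.
  ∂-leaf : ∀ z j → ∂ (attachLeaves G k at) z (#V G ↑ʳ j) ≡ z (#E G ↑ʳ j)
  ∂-leaf z j = begin
    ∂ (attachLeaves G k at) z (#V G ↑ʳ j)
      ≡⟨ sum-++ (#E G) (λ e → z e ℤ.* incidence G⁺ e (#V G ↑ʳ j)) ⟩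
    sum (λ e → z (e ↑ˡ k) ℤ.* incidence G⁺ (e ↑ˡ k) (#V G ↑ʳ j)) ℤ.+
    sum (λ i → z (#E G ↑ʳ i) ℤ.* incidence G⁺ (#E G ↑ʳ i) (#V G ↑ʳ j))
      ≡⟨ cong₂ ℤ._+_
           (sum-0 _ (λ e → trans (cong (z (e ↑ˡ k) ℤ.*_) (incidence-0 G⁺ (e ↑ˡ k) (#V G ↑ʳ j)
             (λ s p → ↑ˡ≢↑ʳ _ j (trans (sym (end-old e s)) p)))) (ℤ.*-zeroʳ (z (e ↑ˡ k)))))
           (sum-cong-≗ (λ i → cong (z (#E G ↑ʳ i) ℤ.*_) (leaf-incidence i))) ⟩
    0ℤ ℤ.+ sum (λ i → z (#E G ↑ʳ i) ℤ.* δ j i)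
      ≡⟨ trans (ℤ.+-identityˡ _) (sum-δ (λ i → z (#E G ↑ʳ i)) j) ⟩
    z (#E G ↑ʳ j) ∎
    where
    open ≡-Reasoning
    G⁺ : Graph
    G⁺ = attachLeaves G k at
    leaf-incidence : ∀ i → incidence G⁺ (#E G ↑ʳ i) (#V G ↑ʳ j) ≡ δ j i
    leaf-incidence i = trans
      (cong₂ ℤ._-_
        (trans (cong (λ u → δ u (#V G ↑ʳ j)) (end-leaf i true)) (δ-injective (#V G ↑ʳ_) (↑ʳ-injective (#V G) _ _) i j))
        (δ-≢ (λ p → ↑ˡ≢↑ʳ (at i) j (trans (sym (end-leaf i false)) p))))
      (trans (ℤ.+-identityʳ (δ i j)) (δ-comm i j))
      where
      δ-comm : ∀ {n} (a b : Fin n) → δ a b ≡ δ b a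
      δ-comm a b with a ≟ b
      ... | yes refl = sym (δ-refl a)
      ... | no a≢b   = sym (δ-≢ (a≢b ∘ sym))

module _ {G : Graph} {k′ k : ℕ} {at′ : Fin k′ → V G} {at : Fin k → V G} (L : LeafMap at′ at) where

  open LeafMap L

  private
    G⁺ G⁻ : Graph
    G⁺ = attachLeaves G k′ at′
    G⁻ = attachLeaves G k at

    leafV : Fin k′ → Maybe (Fin k) → V G⁻
    leafV i nothing  = at′ i ↑ˡ k
    leafV i (just j) = #V G ↑ʳ j

    leafE : Fin k′ → Maybe (Fin k) → Cell G⁻
    leafE i nothing  = inj₁ (at′ i ↑ˡ k)
    leafE i (just j) = inj₂ (#E G ↑ʳ j , false)

    contractV : V G⁺ → V G⁻
    contractV v = [ _↑ˡ k , (λ i → leafV i (to i)) ]′ (splitAt (#V G) v)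

    contractE : E G⁺ → Cell G⁻
    contractE e = [ (λ e → inj₂ (e ↑ˡ k , false)) , (λ i → leafE i (to i)) ]′ (splitAt (#E G) e)

    contractV-old : ∀ v → contractV (v ↑ˡ k′) ≡ v ↑ˡ k
    contractV-old v rewrite splitAt-↑ˡ (#V G) v k′ = refl

    contractV-leaf : ∀ i → contractV (#V G ↑ʳ i) ≡ leafV i (to i)
    contractV-leaf i rewrite splitAt-↑ʳ (#V G) k′ i = refl

    contractE-old : ∀ e → contractE (e ↑ˡ k′) ≡ inj₂ (e ↑ˡ k , false)
    contractE-old e rewrite splitAt-↑ˡ (#E G) e k′ = refl

    contractE-leaf : ∀ i → contractE (#E G ↑ʳ i) ≡ leafE i (to i)
    contractE-leaf i rewrite splitAt-↑ʳ (#E G) k′ i = refl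

    compatible-leaf : ∀ i m → to i ≡ m → ∀ s →
      contractV (if s then #V G ↑ʳ i else at′ i ↑ˡ k′) ≡ endᶜ G⁻ (leafE i m) s
    compatible-leaf i nothing  p true  = trans (contractV-leaf i) (cong (leafV i) p)
    compatible-leaf i nothing  p false = contractV-old (at′ i)
    compatible-leaf i (just j) p true  = trans (contractV-leaf i) (trans (cong (leafV i) p) (sym (end-leaf G at j true)))
    compatible-leaf i (just j) p false = trans (contractV-old (at′ i))
      (trans (cong (_↑ˡ k) (trans (cong at′ (from-to p)) (label j))) (sym (end-leaf G at j false)))

  contractLeaves : Morphism G⁺ G⁻
  contractLeaves = record
    { onV        = contractV
    ; onE        = contractE
    ; compatible = splitCases (#E G) (λ e → ∀ s → contractV (Graph.end G⁺ e s) ≡ endᶜ G⁻ (contractE e) s)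
        (λ e s → trans (cong contractV (end-old G at′ e s)) (trans (contractV-old _)
          (trans (sym (end-old G at e s)) (cong (λ x → endᶜ G⁻ x s) (sym (contractE-old e))))))
        (λ i s → trans (cong contractV (end-leaf G at′ i s)) (trans (compatible-leaf i (to i) refl s)
          (cong (λ x → endᶜ G⁻ x s) (sym (contractE-leaf i)))))
    }

  contractV-↑ˡ : ∀ v → onV contractLeaves (v ↑ˡ k′) ≡ v ↑ˡ k
  contractV-↑ˡ = contractV-old

  contractE-↑ˡ : ∀ e → onE contractLeaves (e ↑ˡ k′) ≡ inj₂ (e ↑ˡ k , false)
  contractE-↑ˡ = contractE-old

  contractV-just : ∀ {i j} → to i ≡ just j → onV contractLeaves (#V G ↑ʳ i) ≡ #V G ↑ʳ j
  contractV-just {i} p = trans (contractV-leaf i) (cong (leafV i) p)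

  contractE-just : ∀ {i j} → to i ≡ just j → onE contractLeaves (#E G ↑ʳ i) ≡ inj₂ (#E G ↑ʳ j , false)
  contractE-just {i} p = trans (contractE-leaf i) (cong (leafE i) p)

  contractV-nothing : ∀ {i} → to i ≡ nothing → onV contractLeaves (#V G ↑ʳ i) ≡ at′ i ↑ˡ k
  contractV-nothing {i} p = trans (contractV-leaf i) (cong (leafV i) p)

  contractE-nothing : ∀ {i} → to i ≡ nothing → onE contractLeaves (#E G ↑ʳ i) ≡ inj₁ (at′ i ↑ˡ k)
  contractE-nothing {i} p = trans (contractE-leaf i) (cong (leafE i) p)

  private
    -- The fibre over an old vertex u is a star with centre u.
    centre : ∀ u v → contractV v ≡ u ↑ˡ k →
             Star (Adjacent (fibre contractLeaves (u ↑ˡ k))) v (u ↑ˡ k′) ×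
             Star (Adjacent (fibre contractLeaves (u ↑ˡ k))) (u ↑ˡ k′) v
    centre u = splitCases (#V G) (λ v → contractV v ≡ u ↑ˡ k →
      Star (Adjacent (fibre contractLeaves (u ↑ˡ k))) v (u ↑ˡ k′) ×
      Star (Adjacent (fibre contractLeaves (u ↑ˡ k))) (u ↑ˡ k′) v) old leaf
      where
      old : ∀ v → contractV (v ↑ˡ k′) ≡ u ↑ˡ k → _
      old v p with ↑ˡ-injective k v u (trans (sym (contractV-old v)) p)
      ... | refl = ε , ε
      leaf : ∀ i → contractV (#V G ↑ʳ i) ≡ u ↑ˡ k → _
      leaf i p = via (to i) refl
        where
        via : ∀ m → to i ≡ m → Star (Adjacent (fibre contractLeaves (u ↑ˡ k))) (#V G ↑ʳ i) (u ↑ˡ k′) ×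
                                Star (Adjacent (fibre contractLeaves (u ↑ˡ k))) (u ↑ˡ k′) (#V G ↑ʳ i)
        via (just j) q = ⊥-elim (↑ˡ≢↑ʳ u j (trans (sym p) (contractV-just q)))
        via nothing  q with ↑ˡ-injective k (at′ i) u (trans (sym (contractV-nothing q)) p)
        ... | refl =
          ((#E G ↑ʳ i , true , contractE-nothing q , end-leaf G at′ i true , end-leaf G at′ i false) ◅ ε) ,
          ((#E G ↑ʳ i , false , contractE-nothing q , end-leaf G at′ i false , end-leaf G at′ i true) ◅ ε)

    only-leaf : ∀ j v → contractV v ≡ #V G ↑ʳ j → v ≡ #V G ↑ʳ from j
    only-leaf j = splitCases (#V G) (λ v → contractV v ≡ #V G ↑ʳ j → v ≡ #V G ↑ʳ from j)
      (λ v p → ⊥-elim (↑ˡ≢↑ʳ v j (trans (sym (contractV-old v)) p)))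
      (λ i p → via i p (to i) refl)
      where
      via : ∀ i → contractV (#V G ↑ʳ i) ≡ #V G ↑ʳ j → ∀ m → to i ≡ m → #V G ↑ʳ i ≡ #V G ↑ʳ from j
      via i p nothing   q = ⊥-elim (↑ˡ≢↑ʳ (at′ i) j (trans (sym (contractV-nothing q)) p))
      via i p (just j′) q with ↑ʳ-injective (#V G) j′ j (trans (sym (contractV-just q)) p)
      ... | refl = cong (#V G ↑ʳ_) (from-to q)

    -- Old edges are not collapsed and so lie in no fibre over a vertex; leaf edges are dealt with
    -- by `∂-leaf`.
    cycle-vanishes : ∀ w z → IsCycle (fibre contractLeaves w) z → ∀ e → z e ≡ 0ℤ
    cycle-vanishes w z cycle = splitCases (#E G) (λ e → z e ≡ 0ℤ)
      (λ e → IsCycle.supported cycle (e ↑ˡ k′) (λ p → edge≢vertex (trans (sym (contractE-old e)) p)))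
      (λ i → trans (sym (∂-leaf G at′ z i)) (IsCycle.boundary cycle (#V G ↑ʳ i)))
      where
      edge≢vertex : ∀ {x w} → ¬ _≡_ {A = Cell G⁻} (inj₂ x) (inj₁ w)
      edge≢vertex ()

    same : ∀ {e f : E G⁻} {b c} → _≡_ {A = Cell G⁻} (inj₂ (e , b)) (inj₂ (f , c)) → e ≡ f
    same refl = refl

    onto-old : ∀ e e′ → MapsOnto contractLeaves e (e′ ↑ˡ k) → e′ ↑ˡ k′ ≡ e
    onto-old e e′ = splitCases (#E G) (λ e → MapsOnto contractLeaves e (e′ ↑ˡ k) → e′ ↑ˡ k′ ≡ e)
      (λ e (b , p) → cong (_↑ˡ k′) (sym (↑ˡ-injective k e e′ (same (trans (sym (contractE-old e)) p)))))
      (λ i (b , p) → via i p (to i) refl) e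
      where
      via : ∀ i {b} → contractE (#E G ↑ʳ i) ≡ inj₂ (e′ ↑ˡ k , b) → ∀ m → to i ≡ m → e′ ↑ˡ k′ ≡ #E G ↑ʳ i
      via i p nothing q with trans (sym (contractE-nothing q)) p
      ... | ()
      via i p (just j) q = ⊥-elim (↑ˡ≢↑ʳ e′ j (sym (same (trans (sym (contractE-just q)) p))))

    onto-leaf : ∀ e j → MapsOnto contractLeaves e (#E G ↑ʳ j) → #E G ↑ʳ from j ≡ e
    onto-leaf e j = splitCases (#E G) (λ e → MapsOnto contractLeaves e (#E G ↑ʳ j) → #E G ↑ʳ from j ≡ e)
      (λ e (b , p) → ⊥-elim (↑ˡ≢↑ʳ e j (same (trans (sym (contractE-old e)) p))))
      (λ i (b , p) → via i p (to i) refl) e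
      where
      via : ∀ i {b} → contractE (#E G ↑ʳ i) ≡ inj₂ (#E G ↑ʳ j , b) → ∀ m → to i ≡ m → #E G ↑ʳ from j ≡ #E G ↑ʳ i
      via i p nothing q with trans (sym (contractE-nothing q)) p
      ... | ()
      via i p (just j′) q with ↑ʳ-injective (#E G) j′ j (same (trans (sym (contractE-just q)) p))
      ... | refl = cong (#E G ↑ʳ_) (sym (from-to q))

  contractLeaves-isContraction : IsContraction contractLeaves
  contractLeaves-isContraction = record
    { vertexFibre = splitCases (#V G) (λ w → Contractible (fibre contractLeaves w))
        (λ u → record
          { nonempty  = u ↑ˡ k′ , contractV-old u
          ; connected = λ v v′ p q → proj₁ (centre u v p) ◅◅ proj₂ (centre u v′ q)
          ; H₁-rank-0 = acyclic⇒H₁-rank-0 (cycle-vanishes (u ↑ˡ k))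
          })
        (λ j → record
          { nonempty  = #V G ↑ʳ from j , contractV-just (to-from j)
          ; connected = λ v v′ p q → subst (Star _ v) (trans (only-leaf j v p) (sym (only-leaf j v′ q))) ε
          ; H₁-rank-0 = acyclic⇒H₁-rank-0 (cycle-vanishes (#V G ↑ʳ j))
          })
    ; edgeFibre = splitCases (#E G) (λ e′ → ∃! _≡_ (λ e → MapsOnto contractLeaves e e′))
        (λ e′ → e′ ↑ˡ k′ , (false , contractE-old e′) , λ {e} p → onto-old e e′ p)
        (λ j → #E G ↑ʳ from j , (false , contractE-just (to-from j)) , λ {e} p → onto-leaf e j p)
    }

  private
    expandV : V G⁻ → V G⁺
    expandV v = [ _↑ˡ k′ , (λ j → #V G ↑ʳ from j) ]′ (splitAt (#V G) v)

    expandE : E G⁻ → E G⁺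
    expandE e = [ _↑ˡ k′ , (λ j → #E G ↑ʳ from j) ]′ (splitAt (#E G) e)

    expandV-old : ∀ v → expandV (v ↑ˡ k) ≡ v ↑ˡ k′
    expandV-old v rewrite splitAt-↑ˡ (#V G) v k = refl

    expandV-leaf : ∀ j → expandV (#V G ↑ʳ j) ≡ #V G ↑ʳ from j
    expandV-leaf j rewrite splitAt-↑ʳ (#V G) k j = refl

    expandE-old : ∀ e → expandE (e ↑ˡ k) ≡ e ↑ˡ k′
    expandE-old e rewrite splitAt-↑ˡ (#E G) e k = refl

    expandE-leaf : ∀ j → expandE (#E G ↑ʳ j) ≡ #E G ↑ʳ from j
    expandE-leaf j rewrite splitAt-↑ʳ (#E G) k j = refl

    expand-leaf : ∀ j s → expandV (if s then #V G ↑ʳ j else at j ↑ˡ k) ≡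
                          (if s then #V G ↑ʳ from j else at′ (from j) ↑ˡ k′)
    expand-leaf j true  = expandV-leaf j
    expand-leaf j false = trans (expandV-old (at j)) (cong (_↑ˡ k′) (sym (label j)))

    -- Embeds the smaller graph on the leaves that were kept. It is the section of `contractLeaves`
    -- that `Cancellation` asks for.
    expandLeaves : Morphism G⁻ G⁺
    expandLeaves = record
      { onV        = expandV
      ; onE        = λ e → inj₂ (expandE e , false)
      ; compatible = splitCases (#E G) (λ e → ∀ s → expandV (Graph.end G⁻ e s) ≡ Graph.end G⁺ (expandE e) s)
          (λ e s → trans (cong expandV (end-old G at e s)) (trans (expandV-old _)
            (trans (sym (end-old G at′ e s)) (cong (λ x → Graph.end G⁺ x s) (sym (expandE-old e))))))
          (λ j s → trans (cong expandV (end-leaf G at j s)) (trans (expand-leaf j s)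
            (trans (sym (end-leaf G at′ (from j) s)) (cong (λ x → Graph.end G⁺ x s) (sym (expandE-leaf j))))))
      }

    contract-expand : ∀ e → contractE (expandE e) ≡ inj₂ (e , false)
    contract-expand = splitCases (#E G) (λ e → contractE (expandE e) ≡ inj₂ (e , false))
      (λ e → trans (cong contractE (expandE-old e)) (contractE-old e))
      (λ j → trans (cong contractE (expandE-leaf j)) (contractE-just (to-from j)))

    expandE-injective : ∀ {e f} → expandE e ≡ expandE f → e ≡ f
    expandE-injective {e} {f} p with trans (sym (contract-expand e)) (trans (cong contractE p) (contract-expand f))
    ... | refl = refl

  module _ {H : Graph} {φ : Morphism G⁺ H} (Φ : IsContraction φ)
           (collapsed : ∀ i → to i ≡ nothing → ∃[ w ] onE φ (#E G ↑ʳ i) ≡ inj₁ w) where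

    private
      ends : ∀ i {w} → onE φ (#E G ↑ʳ i) ≡ inj₁ w → onV φ (#V G ↑ʳ i) ≡ w × onV φ (at′ i ↑ˡ k′) ≡ w
      ends i {w} p = end true , end false
        where
        end : ∀ s → onV φ (if s then #V G ↑ʳ i else at′ i ↑ˡ k′) ≡ w
        end s = trans (cong (onV φ) (sym (end-leaf G at′ i s)))
                     (trans (compatible φ _ s) (cong (λ x → endᶜ H x s) p))

    -- A factorisation of `φ` through `contractLeaves` is determined by composing it with the
    -- section.
    factor : Morphism G⁻ H
    factor = φ ∘ₘ expandLeaves

    factor-contract : factor ∘ₘ contractLeaves ≈ₘ φ
    factor-contract = record
      { ≈V = splitCases (#V G) (λ v → onV φ (expandV (contractV v)) ≡ onV φ v)
          (λ v → cong (onV φ) (trans (cong expandV (contractV-old v)) (expandV-old v)))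
          (λ i → viaV i (to i) refl)
      ; ≈E = splitCases (#E G) (λ e → onCell factor (contractE e) ≡ onE φ e)
          (λ e → trans (cong (onCell factor) (contractE-old e)) (trans (reverseIf-false _) (trans (reverseIf-false _)
                   (cong (onE φ) (expandE-old e)))))
          (λ i → viaE i (to i) refl)
      }
      where
      viaV : ∀ i m → to i ≡ m → onV φ (expandV (contractV (#V G ↑ʳ i))) ≡ onV φ (#V G ↑ʳ i)
      viaV i (just j) p = cong (onV φ) (trans (cong expandV (contractV-just p))
        (trans (expandV-leaf j) (cong (#V G ↑ʳ_) (sym (from-to p)))))
      viaV i nothing  p = trans (cong (onV φ) (trans (cong expandV (contractV-nothing p)) (expandV-old (at′ i))))
        (trans (proj₂ (ends i (proj₂ (collapsed i p)))) (sym (proj₁ (ends i (proj₂ (collapsed i p))))))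
      viaE : ∀ i m → to i ≡ m → onCell factor (contractE (#E G ↑ʳ i)) ≡ onE φ (#E G ↑ʳ i)
      viaE i (just j) p = trans (cong (onCell factor) (contractE-just p))
              (trans (reverseIf-false _) (trans (reverseIf-false _)
        (cong (onE φ) (trans (expandE-leaf j) (cong (#E G ↑ʳ_) (sym (from-to p)))))))
      viaE i nothing  p = trans (cong (onCell factor) (contractE-nothing p))
        (trans (cong (inj₁ ∘ onV φ) (expandV-old (at′ i)))
        (trans (cong inj₁ (proj₂ (ends i (proj₂ (collapsed i p))))) (sym (proj₂ (collapsed i p)))))

    factor-isContraction : IsContraction factor
    factor-isContraction = Cancellation.isContraction contractLeaves-isContraction Φ factor factor-contract
      expandLeaves expandE expandE-injective (λ _ → refl) contract-expand

module _ {G : Graph} {k : ℕ} {at : Fin k → V G} (L : LeafMap at at) where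

  contractLeaves-id : (∀ i → LeafMap.to L i ≡ just i) → contractLeaves {G} L ≈ₘ idₘ
  contractLeaves-id h = record
    { ≈V = splitCases (#V G) (λ v → onV (contractLeaves {G} L) v ≡ v) (contractV-↑ˡ L) (λ i → contractV-just L (h i))
    ; ≈E = splitCases (#E G) (λ e → onE (contractLeaves {G} L) e ≡ inj₂ (e , false)) (contractE-↑ˡ L)
            (λ i → contractE-just L (h i))
    }

module _ {G : Graph} {k₁ k₂ k₃ : ℕ} {at₁ : Fin k₁ → V G} {at₂ : Fin k₂ → V G} {at₃ : Fin k₃ → V G}
         (L₁₂ : LeafMap at₁ at₂) (L₂₃ : LeafMap at₂ at₃) (L₁₃ : LeafMap at₁ at₃) where

  private
    module L₁₂ = LeafMap L₁₂
    module L₂₃ = LeafMap L₂₃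
    module L₁₃ = LeafMap L₁₃
    φ = contractLeaves {G} L₁₂
    ψ = contractLeaves {G} L₂₃
    χ = contractLeaves {G} L₁₃

  contractLeaves-∘ : (∀ i → L₁₃.to i ≡ (L₁₂.to i >>= L₂₃.to)) → ψ ∘ₘ φ ≈ₘ χ
  contractLeaves-∘ h = record
    { ≈V = splitCases (#V G) (λ v → onV ψ (onV φ v) ≡ onV χ v)
        (λ v → trans (cong (onV ψ) (contractV-↑ˡ L₁₂ v)) (trans (contractV-↑ˡ L₂₃ v) (sym (contractV-↑ˡ L₁₃ v))))
        (λ i → viaV i (L₁₂.to i) refl)
    ; ≈E = splitCases (#E G) (λ e → onCell ψ (onE φ e) ≡ onE χ e)
        (λ e → trans (cong (onCell ψ) (contractE-↑ˡ L₁₂ e)) (trans (cong (reverseIf false) (contractE-↑ˡ L₂₃ e))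
                 (sym (contractE-↑ˡ L₁₃ e))))
        (λ i → viaE i (L₁₂.to i) refl)
    }
    where
    composite : ∀ i {m} → L₁₂.to i ≡ m → L₁₃.to i ≡ (m >>= L₂₃.to)
    composite i p = trans (h i) (cong (_>>= L₂₃.to) p)
    same-label : ∀ {i j} → L₁₂.to i ≡ just j → at₁ i ≡ at₂ j
    same-label p = trans (cong at₁ (L₁₂.from-to p)) (L₁₂.label _)
    viaV : ∀ i m → L₁₂.to i ≡ m → onV ψ (onV φ (#V G ↑ʳ i)) ≡ onV χ (#V G ↑ʳ i)
    viaV i nothing p = trans (cong (onV ψ) (contractV-nothing L₁₂ p))
      (trans (contractV-↑ˡ L₂₃ (at₁ i)) (sym (contractV-nothing L₁₃ (composite i p))))
    viaV i (just j) p = trans (cong (onV ψ) (contractV-just L₁₂ p)) (next (L₂₃.to j) refl)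
      where
      next : ∀ m → L₂₃.to j ≡ m → onV ψ (#V G ↑ʳ j) ≡ onV χ (#V G ↑ʳ i)
      next nothing  q = trans (contractV-nothing L₂₃ q)
        (trans (cong (_↑ˡ k₃) (sym (same-label p))) (sym (contractV-nothing L₁₃ (trans (composite i p) q))))
      next (just l) q = trans (contractV-just L₂₃ q) (sym (contractV-just L₁₃ (trans (composite i p) q)))
    viaE : ∀ i m → L₁₂.to i ≡ m → onCell ψ (onE φ (#E G ↑ʳ i)) ≡ onE χ (#E G ↑ʳ i)
    viaE i nothing p = trans (cong (onCell ψ) (contractE-nothing L₁₂ p))
      (trans (cong inj₁ (contractV-↑ˡ L₂₃ (at₁ i))) (sym (contractE-nothing L₁₃ (composite i p))))
    viaE i (just j) p = trans (cong (onCell ψ) (contractE-just L₁₂ p)) (next (L₂₃.to j) refl)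
      where
      next : ∀ m → L₂₃.to j ≡ m → reverseIf false (onE ψ (#E G ↑ʳ j)) ≡ onE χ (#E G ↑ʳ i)
      next nothing  q = trans (cong (reverseIf false) (contractE-nothing L₂₃ q))
        (trans (cong (inj₁ ∘ (_↑ˡ k₃)) (sym (same-label p))) (sym (contractE-nothing L₁₃ (trans (composite i p) q))))
      next (just l) q = trans (cong (reverseIf false) (contractE-just L₂₃ q))
        (sym (contractE-just L₁₃ (trans (composite i p) q)))

idLeafMap : ∀ {X : Set} {k} (at : Fin k → X) → LeafMap at at
idLeafMap at = record { to = just ; from = id ; to-from = λ _ → refl ; from-to = λ { refl → refl } ; label = λ _ → refl }

module _ {G : Graph} {k₁ k₂ : ℕ} {at₁ : Fin k₁ → V G} {at₂ : Fin k₂ → V G}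
         (L : LeafMap at₁ at₂) (L⁻¹ : LeafMap at₂ at₁) where

  contractLeaves-inverse : (∀ i → (LeafMap.to L i >>= LeafMap.to L⁻¹) ≡ just i) →
                           contractLeaves {G} L⁻¹ ∘ₘ contractLeaves {G} L ≈ₘ idₘ
  contractLeaves-inverse h = record
    { ≈V = λ v → trans (_≈ₘ_.≈V composite v) (_≈ₘ_.≈V identity v)
    ; ≈E = λ e → trans (_≈ₘ_.≈E composite e) (_≈ₘ_.≈E identity e)
    }
    where
    composite = contractLeaves-∘ {G} L L⁻¹ (idLeafMap at₁) (λ i → sym (h i))
    identity  = contractLeaves-id {G} (idLeafMap at₁) (λ _ → refl)

-- Sublists and tabulations as leaf maps

module _ {X : Set} where

  toSublist : ∀ {y c : List X} → y ⊑ c → Fin (length c) → Maybe (Fin (length y))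
  toSublist (a ∷ʳ τ)   zero    = nothing
  toSublist (a ∷ʳ τ)   (suc i) = toSublist τ i
  toSublist (refl ∷ τ) zero    = just zero
  toSublist (refl ∷ τ) (suc i) = Maybe.map suc (toSublist τ i)

  fromSublist : ∀ {y c : List X} → y ⊑ c → Fin (length y) → Fin (length c)
  fromSublist (a ∷ʳ τ)   j       = suc (fromSublist τ j)
  fromSublist (refl ∷ τ) zero    = zero
  fromSublist (refl ∷ τ) (suc j) = suc (fromSublist τ j)

  sublistMap : ∀ {y c : List X} → y ⊑ c → LeafMap (lookup c) (lookup y)
  sublistMap τ = record
    { to = toSublist τ ; from = fromSublist τ ; to-from = to-from τ ; from-to = from-to τ _ ; label = label τ }
    where
    to-from : ∀ {y c} (τ : y ⊑ c) j → toSublist τ (fromSublist τ j) ≡ just j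
    to-from (a ∷ʳ τ)   j       = to-from τ j
    to-from (refl ∷ τ) zero    = refl
    to-from (refl ∷ τ) (suc j) = cong (Maybe.map suc) (to-from τ j)
    from-to : ∀ {y c} (τ : y ⊑ c) i {j} → toSublist τ i ≡ just j → i ≡ fromSublist τ j
    from-to (a ∷ʳ τ)   (suc i) p    = cong suc (from-to τ i p)
    from-to (refl ∷ τ) zero    refl = refl
    from-to (refl ∷ τ) (suc i) p with toSublist τ i in q
    from-to (refl ∷ τ) (suc i) refl | just j = cong suc (from-to τ i q)
    label : ∀ {y c} (τ : y ⊑ c) j → lookup c (fromSublist τ j) ≡ lookup y j
    label (a ∷ʳ τ)   j       = label τ j
    label (refl ∷ τ) zero    = refl
    label (refl ∷ τ) (suc j) = label τ j

  toSublist-trans : ∀ {y c c′ : List X} (τ : y ⊑ c) (σ : c ⊑ c′) i →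
                    toSublist (⊆-trans τ σ) i ≡ (toSublist σ i >>= toSublist τ)
  toSublist-trans τ          (a ∷ʳ σ)   zero    = refl
  toSublist-trans τ          (a ∷ʳ σ)   (suc i) = toSublist-trans τ σ i
  toSublist-trans (a ∷ʳ τ)   (refl ∷ σ) zero    = refl
  toSublist-trans (refl ∷ τ) (refl ∷ σ) zero    = refl
  toSublist-trans (a ∷ʳ τ)   (refl ∷ σ) (suc i) with toSublist σ i | toSublist-trans τ σ i
  ... | nothing | p = p
  ... | just _  | p = p
  toSublist-trans (refl ∷ τ) (refl ∷ σ) (suc i) with toSublist σ i | toSublist-trans τ σ i
  ... | nothing | p = cong (Maybe.map suc) p
  ... | just _  | p = cong (Maybe.map suc) p

  select : ∀ c {P Q : Fin (length c) → Set} → (∀ i → P i ⊎ Q i) →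
           ∃[ y ] Σ[ τ ∈ y ⊑ c ] (∀ i → toSublist τ i ≡ nothing → P i) × (∀ j → Q (fromSublist τ j))
  select [] dec = [] , [] , (λ ()) , (λ ())
  select (a ∷ c) dec with dec zero | select c (dec ∘ suc)
  ... | inj₁ p | y , τ , drop , keep = y , a ∷ʳ τ , (λ { zero _ → p ; (suc i) r → drop i r }) , keep
  ... | inj₂ q | y , τ , drop , keep = a ∷ y , refl ∷ τ ,
    (λ { (suc i) r → drop i (map-nothing r) }) , (λ { zero → q ; (suc j) → keep j })
    where
    map-nothing : ∀ {A B : Set} {f : A → B} {m} → Maybe.map f m ≡ nothing → m ≡ nothing
    map-nothing {m = nothing} _ = refl

  module _ {k : ℕ} (at : Fin k → X) where

    private
      eq : length (List.tabulate at) ≡ k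
      eq = length-tabulate at

    -- The list has `k` entries only up to a propositional equality, so the two graphs with leaves
    -- are compared by leaf maps in both directions.
    fromTabulate : LeafMap (lookup (List.tabulate at)) at
    fromTabulate = record
      { to      = just ∘ cast eq
      ; from    = cast (sym eq)
      ; to-from = λ j → cong just (cast-involutive eq (sym eq) j)
      ; from-to = λ { {i} refl → sym (cast-involutive (sym eq) eq i) }
      ; label   = lookup-tabulate at
      }

    toTabulate : LeafMap at (lookup (List.tabulate at))
    toTabulate = record
      { to      = just ∘ cast (sym eq)
      ; from    = cast eq
      ; to-from = λ j → cong just (cast-involutive (sym eq) eq j)
      ; from-to = λ { {i} refl → sym (cast-involutive eq (sym eq) i) }
      ; label   = λ j → trans (sym (lookup-tabulate at (cast eq j)))
                              (cong (lookup (List.tabulate at)) (cast-involutive (sym eq) eq j))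
      }

-- Finiteness of the set of contractions between two graphs

funToFin-injective : ∀ {m n} {f h : Fin m → Fin n} → funToFin f ≡ funToFin h → ∀ i → f i ≡ h i
funToFin-injective {f = f} {h} p zero    = combine-injectiveˡ (f zero) _ (h zero) _ p
funToFin-injective {f = f} {h} p (suc i) = funToFin-injective (combine-injectiveʳ (f zero) _ (h zero) _ p) i

-- Unlike an enumeration, a code that separates classes passes at once to subtypes, here from
-- morphisms to contractions.
FinitelyMany : (I : Set) → (I → I → Set) → Set
FinitelyMany I _∼_ = ∃[ n ] Σ[ code ∈ (I → Fin n) ] (∀ {i j} → code i ≡ code j → i ∼ j)

module _ {G H : Graph} where

  private
    bit : Bool → Fin 2
    bit false = zero
    bit true  = suc zero

    bit-injective : ∀ {a b} → bit a ≡ bit b → a ≡ b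
    bit-injective {false} {false} _ = refl
    bit-injective {true}  {true}  _ = refl

    encodeCell : Cell H → Fin (#V H ℕ.+ #E H ℕ.* 2)
    encodeCell (inj₁ w)       = w ↑ˡ _
    encodeCell (inj₂ (e , b)) = #V H ↑ʳ combine e (bit b)

    encodeCell-injective : ∀ x y → encodeCell x ≡ encodeCell y → x ≡ y
    encodeCell-injective (inj₁ v)       (inj₁ w)       p = cong inj₁ (↑ˡ-injective _ v w p)
    encodeCell-injective (inj₁ v)       (inj₂ _)       p = ⊥-elim (↑ˡ≢↑ʳ v _ p)
    encodeCell-injective (inj₂ _)       (inj₁ w)       p = ⊥-elim (↑ˡ≢↑ʳ w _ (sym p))
    encodeCell-injective (inj₂ (e , b)) (inj₂ (f , c)) p =
      let q , r = combine-injective e (bit b) f (bit c) (↑ʳ-injective (#V H) _ _ p)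
      in cong₂ (λ e b → inj₂ (e , b)) q (bit-injective r)

  morphisms-finite : FinitelyMany (Morphism G H) _≈ₘ_
  morphisms-finite = _ , (λ φ → combine (funToFin (onV φ)) (funToFin (encodeCell ∘ onE φ))) , λ {φ} {ψ} p →
    let q , r = combine-injective (funToFin (onV φ)) (funToFin (encodeCell ∘ onE φ))
                                  (funToFin (onV ψ)) (funToFin (encodeCell ∘ onE ψ)) p
    in record { ≈V = funToFin-injective q
              ; ≈E = λ e → encodeCell-injective (onE φ e) (onE ψ e) (funToFin-injective r e) }

contractions-finite : ∀ {g} (G H : GraphOfGenus g) → FinitelyMany (Contraction G H) (λ φ ψ → morphism φ ≈ₘ morphism ψ)
contractions-finite G H =
  let n , code , injective = morphisms-finite {graph G} {graph H}
  in n , code ∘ morphism , injective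

-- Abstract, as comparing graphs of genus g must not unfold these proofs.
abstract

  sprout-connected : ∀ {g} (G : GraphOfGenus g) {k} (at : Fin k → V (graph G)) →
                     Connected (whole (attachLeaves (graph G) k at))
  sprout-connected G at = attachLeaves-connected (graph G) _ at (GraphOfGenus.connected G)

  sprout-genus : ∀ {g} (G : GraphOfGenus g) {k} (at : Fin k → V (graph G)) →
                 H₁HasRank (whole (attachLeaves (graph G) k at)) g
  sprout-genus G at = attachLeaves-H₁ (graph G) _ at (GraphOfGenus.genus G)

sprout : ∀ {g} (G : GraphOfGenus g) {k} → (Fin k → V (graph G)) → GraphOfGenus g
sprout G {k} at = record
  { graph     = attachLeaves (graph G) k at
  ; nonempty  = proj₁ (GraphOfGenus.nonempty G) ↑ˡ k , tt
  ; connected = sprout-connected G at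
  ; genus     = sprout-genus G at
  }

module _ {g : ℕ} {G : GraphOfGenus g} where

  contract : ∀ {k′ k} {at′ : Fin k′ → V (graph G)} {at : Fin k → V (graph G)} →
             LeafMap at′ at → Contraction (sprout G at′) (sprout G at)
  contract L = record { morphism = contractLeaves {graph G} L ; isContraction = contractLeaves-isContraction {graph G} L }

  module _ {H : GraphOfGenus g} (c : List (V (graph G))) (φ : Contraction (sprout G (lookup c)) H) where

    private
      leafEdge : Fin (length c) → Cell (graph H)
      leafEdge i = onE (morphism φ) (#E (graph G) ↑ʳ i)

      KeptTo : Fin (length c) → E (graph H) → Set
      KeptTo i e = MapsOnto (morphism φ) (#E (graph G) ↑ʳ i) e

      decide : ∀ i → (∃[ w ] leafEdge i ≡ inj₁ w) ⊎ (∃[ e ] KeptTo i e)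
      decide i with leafEdge i
      ... | inj₁ w       = inj₁ (w , refl)
      ... | inj₂ (e , b) = inj₂ (e , b , refl)

      kept-unique : ∀ {i j e} → KeptTo i e → KeptTo j e → i ≡ j
      kept-unique {e = e} p q =
        let _ , _ , unique = IsContraction.edgeFibre (Contraction.isContraction φ) e
        in ↑ʳ-injective (#E (graph G)) _ _ (trans (sym (unique p)) (unique q))

      few-kept : ∀ {y} (τ : y ⊑ c) → (∀ j → ∃[ e ] KeptTo (fromSublist τ j) e) → length y ℕ.≤ #E (graph H)
      few-kept τ kept = injective⇒≤ {f = proj₁ ∘ kept} (λ {i} {j} p → LeafMap.from-injective (sublistMap τ)
        (kept-unique (proj₂ (kept i)) (subst (KeptTo (fromSublist τ j)) (sym p) (proj₂ (kept j)))))

    -- Keeping just the leaves whose edges φ does not collapse; these embed into the edges of H.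
    contraction-factors : ∃[ y ] Σ[ τ ∈ y ⊑ c ] Σ[ χ ∈ Contraction (sprout G (lookup y)) H ]
      length y ℕ.≤ #E (graph H) × morphism (χ ∘ᶜ contract (sublistMap τ)) ≈ₘ morphism φ
    contraction-factors =
      let y , τ , collapsed , kept = select c decide
      in y , τ , record { morphism      = factor {graph G} (sublistMap τ) (Contraction.isContraction φ) collapsed
                        ; isContraction = factor-isContraction {graph G} (sublistMap τ)
                                (Contraction.isContraction φ) collapsed }
           , few-kept τ kept
           , factor-contract {graph G} (sublistMap τ) (Contraction.isContraction φ) collapsed

-- Leading terms in a finitely generated representation

-- There are finitely many such lists. This makes the range of the index `x` independent of `y`, so
-- that finitely many families suffice for all words.
bounded-on-short : ∀ {n} d (f : List (Fin n) → ℕ) → ∃[ B ] (∀ y → length y ≤ d → f y ≤ B)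
bounded-on-short zero f = f [] , λ { [] _ → ℕ.≤-refl }
bounded-on-short {n} (suc d) f = f [] ℕ.⊔ proj₁ tails , λ
  { []      _       → ℕ.m≤m⊔n (f []) _
  ; (a ∷ y) (s≤s p) → ℕ.≤-trans (proj₂ (bounded-on-short d (f ∘ (a ∷_))) y p)
                        (ℕ.≤-trans (proj₂ tails a) (ℕ.m≤n⊔m (f []) _)) }
  where
  maximum : ∀ {n} (h : Fin n → ℕ) → ∃[ B ] (∀ a → h a ≤ B)
  maximum {zero}  h = 0 , λ ()
  maximum {suc n} h with maximum (h ∘ suc)
  ... | B , b = h zero ℕ.⊔ B , λ { zero → ℕ.m≤m⊔n (h zero) B ; (suc a) → ℕ.≤-trans (b a) (ℕ.m≤n⊔m (h zero) B) }
  tails : ∃[ B ] (∀ a → proj₁ (bounded-on-short d (f ∘ (a ∷_))) ≤ B)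
  tails = maximum (λ a → proj₁ (bounded-on-short d (f ∘ (a ∷_))))

word-tabulate : ∀ {A : Set} {r} (v : Vector A r) (m : Vector ℕ r) →
                List.tabulate (v ∘ block m) ≡ word (Vec.tabulate v) (Vec.tabulate m)
word-tabulate {r = zero}  v m = refl
word-tabulate {r = suc r} v m = trans (tabulate-+ (m zero) (v ∘ block m)) (cong₂ _++_
  (trans (tabulate-cong (λ i → cong v (first i))) (constant (m zero)))
  (trans (tabulate-cong (λ i → cong v (rest i))) (word-tabulate (v ∘ suc) (m ∘ suc))))
  where
  tabulate-+ : ∀ {A : Set} k {n} (f : Fin (k ℕ.+ n) → A) →
               List.tabulate f ≡ List.tabulate (f ∘ (_↑ˡ n)) ++ List.tabulate (f ∘ (k ↑ʳ_))
  tabulate-+ zero    f = refl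
  tabulate-+ (suc k) f = cong (f zero ∷_) (tabulate-+ k (f ∘ suc))
  constant : ∀ k → List.tabulate {n = k} (λ _ → v zero) ≡ replicate k (v zero)
  constant zero    = refl
  constant (suc k) = cong (v zero ∷_) (constant k)
  first : ∀ i → block m (i ↑ˡ ∑ℕ (m ∘ suc)) ≡ zero
  first i rewrite splitAt-↑ˡ (m zero) i (∑ℕ (m ∘ suc)) = refl
  rest : ∀ i → block m (m zero ↑ʳ i) ≡ suc (block (m ∘ suc) i)
  rest i rewrite splitAt-↑ʳ (m zero) (∑ℕ (m ∘ suc)) i = refl

module Leaves (em : ∀ {ℓ} → ExcludedMiddle ℓ) {c} (k : Field c) {g : ℕ} (G : GraphOfGenus g) where

  open LinearAlgebra (Field.commutativeRing k)

  leaves : List (V (graph G)) → GraphOfGenus g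
  leaves l = sprout G (lookup l)

  ι : (y l : List (V (graph G))) → y ⊑ l → Contraction (leaves l) (leaves y)
  ι y l τ = contract {G = G} {at′ = lookup l} {at = lookup y} (sublistMap τ)

  ι-∘ : (y l l′ : List (V (graph G))) (τ : y ⊑ l) (σ : l ⊑ l′) →
        morphism (ι y l τ ∘ᶜ ι l l′ σ) ≈ₘ morphism (ι y l′ (⊆-trans τ σ))
  ι-∘ y l l′ τ σ = contractLeaves-∘ {graph G} (sublistMap σ) (sublistMap τ) (sublistMap (⊆-trans τ σ))
          (toSublist-trans τ σ)

  module Generated (d : ℕ) (P : Rep k g) (fg : FinitelyGenerated≤ k d P) where

    open Rep P
    open FinitelyGenerated≤ fg
    module Sub l = Subspaces (em {c}) k (obj (leaves l))
    module Map {H J} (φ : Contraction H J) = ModuleMorphisms.IsModuleHomomorphism (map-homo φ)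

    -- Excluded middle picks a preimage for every code that is attained. A code that is not attained
    -- is given zero, which merely lengthens the list.
    finite-image : ∀ {H} {I : Set} {_∼_ : I → I → Set} → FinitelyMany I _∼_ → (value : I → ∣ H ∣) →
      (∀ {i j} → i ∼ j → value i ≈ value j) → Σ[ l ∈ List ∣ H ∣ ] (∀ i → Any (value i ≈_) l)
    finite-image {H} {I} (n , code , code-injective) value resp =
      List.tabulate representative , λ i → Any.tabulate⁺ (code i) (represents i)
      where
      representative : Fin n → ∣ H ∣
      representative x with em {P = Σ[ i ∈ I ] code i ≡ x}
      ... | yes (i , _) = value i
      ... | no _        = Module.0ᴹ (obj H)
      represents : ∀ i → value i ≈ representative (code i)
      represents i with em {P = Σ[ j ∈ I ] code j ≡ code i}
      ... | yes (j , p) = resp (code-injective (sym p))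
      ... | no ∄        = ⊥-elim (∄ (i , refl))

    images : ∀ H → Σ[ l ∈ List ∣ H ∣ ] (∀ i (ψ : Contraction H (generator i)) → Any (map ψ (u i) ≈_) l)
    images H = List.concat (List.tabulate (λ i → proj₁ (of i))) ,
               λ i ψ → Any.concat⁺ (Any.tabulate⁺ i (proj₂ (of i) ψ))
      where
      of : ∀ i → Σ[ l ∈ List ∣ H ∣ ] (∀ (ψ : Contraction H (generator i)) → Any (map ψ (u i) ≈_) l)
      of i = finite-image {H} (contractions-finite H (generator i)) (λ ψ → map ψ (u i))
              (λ {ψ} {χ} p → map-resp ψ χ p (u i))

    entry : ∀ {H} → List ∣ H ∣ → ℕ → ∣ H ∣
    entry {H} []      x       = Module.0ᴹ (obj H)
    entry     (z ∷ l) zero    = z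
    entry     (z ∷ l) (suc x) = entry l x

    entry-any : ∀ {H} {Q : ∣ H ∣ → Set c} {l} → Any Q l → ∃[ x ] x < length l × Q (entry l x)
    entry-any (here q)  = 0 , s≤s z≤n , q
    entry-any (there a) = let x , x< , q = entry-any a in suc x , s≤s x< , q

    #images : ∃[ B ] (∀ (y : List (V (graph G))) → length y ≤ d → length (proj₁ (images (leaves y))) ≤ B)
    #images = bounded-on-short d (λ y → length (proj₁ (images (leaves y))))

    -- Zero if y has more than d letters or x is out of range.
    shortGenerator : (y : List (V (graph G))) → Dec (length y ≤ d) → ℕ → ∣ leaves y ∣
    shortGenerator y (yes _) x = entry (proj₁ (images (leaves y))) x
    shortGenerator y (no _)  x = Module.0ᴹ (obj (leaves y))

    vectors : (l : List (V (graph G))) → ℕ → Sub.Vectors l {V (graph G)} l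
    vectors l x {y} τ = map (ι y l τ) (shortGenerator y (length y ℕ.≤? d) x)

    vectors-map : ∀ {y l l′ : List (V (graph G))} x (τ : y ⊑ l) (σ : l ⊑ l′) →
                  map (ι l l′ σ) (vectors l x τ) ≈ vectors l′ x (⊆-trans τ σ)
    vectors-map {y} {l} {l′} x τ σ = Module.≈ᴹ-trans (obj (leaves l′))
      (Module.≈ᴹ-sym (obj (leaves l′)) (map-∘ (ι y l τ) (ι l l′ σ) z))
      (map-resp (ι y l τ ∘ᶜ ι l l′ σ) (ι y l′ (⊆-trans τ σ)) (ι-∘ y l l′ τ σ) z)
      where
      z : ∣ leaves y ∣
      z = shortGenerator y (length y ℕ.≤? d) x

    vectors-long : ∀ {y l : List (V (graph G))} x (τ : y ⊑ l) → ¬ length y ≤ d →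
                   vectors l x τ ≈ Module.0ᴹ (obj (leaves l))
    vectors-long {y} {l} x τ long with length y ℕ.≤? d
    ... | yes short = ⊥-elim (long short)
    ... | no _      = Map.0ᴹ-homo (ι y l τ)

    -- The index `x` is the major one in the lexicographic order: each layer is adjoined on top of
    -- all vectors of the layers before it.
    Span : (l : List (V (graph G))) → ℕ → ∣ leaves l ∣ → Set c
    Span l zero    z = z ≈ Module.0ᴹ (obj (leaves l))
    Span l (suc x)   = Sub.Full l (Span l x) (vectors l x)

    Span-isSubmodule : ∀ l x → IsSubmodule (obj (leaves l)) (Span l x)
    Span-isSubmodule l zero    = Sub.0-isSubmodule l
    Span-isSubmodule l (suc x) = Sub.Full-isSubmodule l (Span-isSubmodule l x) (vectors l x)

    Span-map : ∀ {l l′ : List (V (graph G))} (σ : l ⊑ l′) x {z} → Span l x z → Span l′ x (map (ι l l′ σ) z)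
    Span-map {l} {l′} σ zero    p = Module.≈ᴹ-trans (obj (leaves l′)) (Map.⟦⟧-cong (ι l l′ σ) p) (Map.0ᴹ-homo (ι l l′ σ))
    Span-map {l} {l′} σ (suc x) = Full-map em k (map-homo (ι l l′ σ)) σ (Span-isSubmodule l′ x) (Span-map σ x)
      (vectors l x) (vectors l′ x) (λ τ → vectors-map x τ σ)

    Span-mono : ∀ l {x x′} → x ℕ.≤′ x′ → ∀ {z} → Span l x z → Span l x′ z
    Span-mono l ℕ.≤′-refl         p = p
    Span-mono l (ℕ.≤′-step {n} q) p = Sub.Full-⊇ l (Span-isSubmodule l n) (vectors l n) (Span-mono l q p)

    bound : ℕ
    bound = proj₁ #images

    -- Each spanning vector comes from a contraction `φ` to some generator. By `contraction-factors`
    -- it is pulled back from a word `y` of length at most `d`, where it occurs in the list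
    -- `images`; its position there is the layer `x`.
    Span-bound : ∀ l z → Span l bound z
    Span-bound l z =
      let n , a , j , z≈ = spanning (leaves l) z
      in IsSubmodule.resp isSpan (Module.≈ᴹ-sym (obj (leaves l)) z≈)
           (Sub.linearCombination∈ l isSpan a (λ i → image (proj₁ (j i)) (proj₂ (j i))))
      where
      isSpan : IsSubmodule (obj (leaves l)) (Span l bound)
      isSpan = Span-isSubmodule l bound
      is-generator : ∀ y x z → length y ≤ d → z ≈ entry (proj₁ (images (leaves y))) x →
                     z ≈ shortGenerator y (length y ℕ.≤? d) x
      is-generator y x z short p with length y ℕ.≤? d
      ... | yes _     = p
      ... | no ¬short = ⊥-elim (¬short short)
      image : ∀ i φ → Span l bound (map φ (u i))
      image i φ =
        let y , τ , χ , y≤ , χι≈φ = contraction-factors {G = G} {H = generator i} l φ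
            short = ℕ.≤-trans y≤ (degree i)
            x , x< , p = entry-any (proj₂ (images (leaves y)) i χ)
        in IsSubmodule.resp isSpan
             (Module.≈ᴹ-sym (obj (leaves l)) (Module.≈ᴹ-trans (obj (leaves l))
               (Module.≈ᴹ-sym (obj (leaves l)) (map-resp (χ ∘ᶜ ι y l τ) φ χι≈φ (u i)))
               (Module.≈ᴹ-trans (obj (leaves l)) (map-∘ χ (ι y l τ) (u i))
                 (Map.⟦⟧-cong (ι y l τ) (is-generator y x (map χ (u i)) short p)))))
             (Span-mono l (ℕ.≤⇒≤′ (ℕ.≤-trans x< (proj₂ #images y short)))
               (Sub.Full-∋ l (Span-isSubmodule l x) (vectors l x) τ))

    open module C = Counting (em {c}) {V (graph G)} using (Family; Upward; countAll; count; counted; countAll-∖)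

    leading : Subrep k P → ℕ → Family
    leading S x {y} {l} τ = Sub.Leading l (Subrep.carrier S (leaves l)) (Span l x) (vectors l x) τ

    leading-upward : ∀ S x → Upward (leading S x)
    leading-upward S x {y} {l} {l′} τ σ =
      Leading-map em k (map-homo (ι l l′ σ)) (Subrep.isSubmodule S {leaves l′}) (Subrep.stable S (ι l l′ σ)) σ
        (Span-isSubmodule l′ x) (Span-map σ x) (vectors l x) (vectors l′ x) (λ τ → vectors-map x τ σ) τ

    -- The vector is zero, and zero lies in every subrepresentation. Applied to `T`, this confines
    -- the pairs that lead in `S` but not in `T` to words of length at most `d`.
    leading-long : ∀ S x {y l} (τ : y ⊑ l) → ¬ length y ≤ d → leading S x τ
    leading-long S x {y} {l} τ long = 0ᴹ , Sub.Lower-∋0 l (Span-isSubmodule l x) (vectors l x) τ ,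
      IsSubmodule.resp (Subrep.isSubmodule S {leaves l})
        (≈ᴹ-sym (≈ᴹ-trans (+ᴹ-identityʳ (vectors l x τ)) (vectors-long x τ long)))
        (IsSubmodule.0∈ (Subrep.isSubmodule S {leaves l}))
      where open Module (obj (leaves l))

    module _ (S T : Subrep k P) (T⊆S : ∀ H {x} → Subrep.carrier T H x → Subrep.carrier S H x) where

      private
        module S = Subrep S
        module T = Subrep T

      #leading : (l : List (V (graph G))) → ℕ → ℕ
      #leading l zero    = 0
      #leading l (suc x) = countAll l (λ τ → leading S x τ × ¬ leading T x τ) ℕ.+ #leading l x

      relativeBasis-Span : ∀ l x → Sub.RelativeBasis l (λ z → S.carrier (leaves l) z × Span l x z)
                                                       (T.carrier (leaves l)) (#leading l x)
      relativeBasis-Span l zero    = Sub.relativeBasis-zero l (λ { (_ , z≈0) →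
        IsSubmodule.resp (T.isSubmodule {leaves l}) (Module.≈ᴹ-sym (obj (leaves l)) z≈0)
                (IsSubmodule.0∈ (T.isSubmodule {leaves l})) })
      relativeBasis-Span l (suc x) =
        Sub.relativeBasis-full l (S.isSubmodule {leaves l}) (T.isSubmodule {leaves l}) (T⊆S (leaves l))
          (Span-isSubmodule l x) (vectors l x) (relativeBasis-Span l x)

      relativeBasis-leaves : ∀ l → Sub.RelativeBasis l (S.carrier (leaves l)) (T.carrier (leaves l)) (#leading l bound)
      relativeBasis-leaves l = Sub.relativeBasis-mod l (T.isSubmodule {leaves l}) (relativeBasis-Span l bound) proj₁
        (λ {z} z∈S → z , Module.0ᴹ (obj (leaves l)) , (z∈S , Span-bound l z) , IsSubmodule.0∈ (T.isSubmodule {leaves l}) ,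
                     Module.≈ᴹ-sym (obj (leaves l)) (Module.+ᴹ-identityʳ (obj (leaves l)) z))

      leading-short : ∀ {y l} x (τ : y ⊑ l) → leading S x τ × ¬ leading T x τ → length y ≤ d
      leading-short {y} x τ (_ , ¬leadingT) = decidable-stable (length y ℕ.≤? d) (¬leadingT ∘ leading-long T x τ)

      module _ {r : ℕ} (v : Vector (V (graph G)) r) where

        private
          wordOf : Vector ℕ r → List (V (graph G))
          wordOf m = word (Vec.tabulate v) (Vec.tabulate m)

          counting : ∀ S x → C.Counted (Vec.tabulate v) d (leading S x)
          counting S x = counted (Vec.tabulate v) d (leading S x) (leading-upward S x)

          #series : Subrep k P → ℕ → Vector ℕ r → ℕ
          #series S x m = sumCoefficientsAt (C.Counted.series (counting S x)) (Vec.tabulate m)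

          new : ℕ → Vector ℕ r → ℕ
          new x m = countAll (wordOf m) (λ τ → leading S x τ × ¬ leading T x τ)

          new-series : ∀ x m → new x m ℕ.+ #series T x m ≡ #series S x m
          new-series x m = begin
            new x m ℕ.+ #series T x m
              ≡⟨ cong (new x m ℕ.+_) (C.Counted.counts (counting T x) (Vec.tabulate m)) ⟨
            new x m ℕ.+ count d (leading T x) (wordOf m)
              ≡⟨ countAll-∖ d (leading S x) (leading T x) (wordOf m)
                   (λ { τ (z , z∈ , t) → z , z∈ , T⊆S (leaves (wordOf m)) t }) (leading-short x) ⟩
            count d (leading S x) (wordOf m)
              ≡⟨ C.Counted.counts (counting S x) (Vec.tabulate m) ⟩
            #series S x m ∎
            where open ≡-Reasoning

          #series-eventually : ∀ S x → EventuallyPolynomial d (#series S x)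
          #series-eventually S x =
            eventually-sumCoefficients {gs = C.Counted.series (counting S x)} (C.Counted.bounded (counting S x))

          new-eventually : ∀ x → EventuallyPolynomial d (new x)
          new-eventually x = eventually-∸ {f = new x} {#series T x} {#series S x} (new-series x)
            (#series-eventually S x) (#series-eventually T x)

        #leading-eventually : ∀ x → EventuallyPolynomial d (λ m → #leading (wordOf m) x)
        #leading-eventually zero    = eventually-0
        #leading-eventually (suc x) = eventually-+ {f = new x} {λ m → #leading (wordOf m) x}
          (new-eventually x) (#leading-eventually x)

-- Graded pieces of a filtration

module Quotient {c} (k : Field c) (A : Module (Field.commutativeRing k) c c)
  {S T : Pred (Module.Carrierᴹ A) c}
  (isS : LinearAlgebra.IsSubmodule (Field.commutativeRing k) A S)
  (isT : LinearAlgebra.IsSubmodule (Field.commutativeRing k) A T) where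

  open Module A
  open AbelianGroupProperties +ᴹ-abelianGroup using (ε⁻¹≈ε)
  private
    module Q = Module (LinearAlgebra.subquotientModule (Field.commutativeRing k) A isS isT)
    module T = LinearAlgebra.IsSubmodule isT

  ≈⇒≈ : ∀ {x y} (s : S x) (t : S y) → x ≈ᴹ y → (x , s) Q.≈ᴹ (y , t)
  ≈⇒≈ {y = y} s t p = T.resp (≈ᴹ-sym (≈ᴹ-trans (+ᴹ-congʳ p) (-ᴹ‿inverseʳ y))) T.0∈

  private
    minus-0 : ∀ x → x +ᴹ -ᴹ 0ᴹ ≈ᴹ x
    minus-0 x = ≈ᴹ-trans (+ᴹ-congˡ ε⁻¹≈ε) (+ᴹ-identityʳ x)

  ≈0⇒∈ : ∀ {x} (s : S x) → (x , s) Q.≈ᴹ Q.0ᴹ → T x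
  ≈0⇒∈ {x} s = T.resp (minus-0 x)

  ∈⇒≈0 : ∀ {x} (s : S x) → T x → (x , s) Q.≈ᴹ Q.0ᴹ
  ∈⇒≈0 {x} s = T.resp (≈ᴹ-sym (minus-0 x))

module Graded {c} (em : ExcludedMiddle c) (k : Field c) {g : ℕ} (M : Rep k g) (F : Filtration k M)
  (P : Rep k g) (S T : Subrep k P) (T⊆S : ∀ H {x} → Subrep.carrier T H x → Subrep.carrier S H x)
  (iso : _≅_ k (gr k F) (subquotient k S T)) where

  open LinearAlgebra (Field.commutativeRing k)
  open Filtration F renaming (length to #steps)
  open _≅_ iso

  private
    module M = Rep M
    module P = Rep P
    module S = Subrep S
    module T = Subrep T
    module Step (i : Fin (suc #steps)) = Subrep (step i)

    piece : Fin #steps → Rep k g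
    piece j = subquotient k (step (suc j)) (step (inject₁ j))

    module Piece j {H} = Module (Rep.obj (piece j) H)
    module Gr {H} = Module (Rep.obj (gr k F) H)
    module S/T {H} = Module (Rep.obj (subquotient k S T) H)
    module Obj {H} = Module (P.obj H)
    module ObjM {H} = Module (M.obj H)
    module To {H} = ModuleMorphisms.IsModuleIsomorphism (isIso {H})
    module QuotientP {H} = Quotient k (P.obj H) (S.isSubmodule {H}) (T.isSubmodule {H})
    module QuotientM j {H} = Quotient k (M.obj H) (Step.isSubmodule (suc j) {H}) (Step.isSubmodule (inject₁ j) {H})

  module _ (i : Fin #steps) where

    -- x and z correspond if the isomorphism takes the class of z in the
    -- i-th graded piece to the class of x.
    record Corresponds (H : GraphOfGenus g) (x : P.∣ H ∣) (z : M.∣ H ∣) : Set c where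
      field
        element : Rep.∣_∣ (gr k F) H
        inS     : S.carrier H x
        inStep  : Step.carrier (suc i) H z
        others  : ∀ j → j ≢ i → Piece._≈ᴹ_ j {H} (element j) (Piece.0ᴹ j {H})
        this    : Piece._≈ᴹ_ i {H} (element i) (z , inStep)
        matches : S/T._≈ᴹ_ {H} (to {H} element) (x , inS)

    open Corresponds

    linearRelation : ∀ H → LinearRelation em k {P.obj H} {M.obj H} (Corresponds H)
    linearRelation H = record { R-resp = respect ; R-0 = zero∈ ; R-+ = add ; R-* = scale }
      where
      isS : IsSubmodule (P.obj H) (S.carrier H)
      isS = S.isSubmodule {H}
      isStep : IsSubmodule (M.obj H) (Step.carrier (suc i) H)
      isStep = Step.isSubmodule (suc i) {H}
      respect : ∀ {x x′ z z′} → Module._≈ᴹ_ (P.obj H) x x′ → Module._≈ᴹ_ (M.obj H) z z′ → Corresponds H x z →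
              Corresponds H x′ z′
      respect {x} {x′} {z} {z′} p q R = record
        { element = R .element
        ; inS     = s
        ; inStep  = t
        ; others  = R .others
        ; this    = Piece.≈ᴹ-trans i {H} {R .element i} {z , R .inStep} {z′ , t} (R .this)
                (QuotientM.≈⇒≈ i {H} (R .inStep) t q)
        ; matches = S/T.≈ᴹ-trans {H} {to {H} (R .element)} {x , R .inS} {x′ , s} (R .matches)
                (QuotientP.≈⇒≈ {H} (R .inS) s p)
        }
        where
        s = IsSubmodule.resp isS p (R .inS)
        t = IsSubmodule.resp isStep q (R .inStep)
      zero∈ : Corresponds H (Module.0ᴹ (P.obj H)) (Module.0ᴹ (M.obj H))
      zero∈ = record
        { element = Gr.0ᴹ {H}
        ; inS     = IsSubmodule.0∈ isS
        ; inStep  = IsSubmodule.0∈ isStep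
        ; others  = λ j _ → Piece.≈ᴹ-refl j {H} {Piece.0ᴹ j {H}}
        ; this    = Piece.≈ᴹ-refl i {H} {Piece.0ᴹ i {H}}
        ; matches = To.0ᴹ-homo {H}
        }
      add : ∀ {x x′ z z′} → Corresponds H x z → Corresponds H x′ z′ →
            Corresponds H (Module._+ᴹ_ (P.obj H) x x′) (Module._+ᴹ_ (M.obj H) z z′)
      add {x} {x′} {z} {z′} R R′ = record
        { element = w⁺
        ; inS     = IsSubmodule.+∈ isS (R .inS) (R′ .inS)
        ; inStep  = IsSubmodule.+∈ isStep (R .inStep) (R′ .inStep)
        ; others  = λ j j≢i → Piece.≈ᴹ-trans j {H} {w⁺ j}
            {Piece._+ᴹ_ j {H} (Piece.0ᴹ j {H}) (Piece.0ᴹ j {H})} {Piece.0ᴹ j {H}}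
            (Piece.+ᴹ-cong j {H} {w j} {Piece.0ᴹ j {H}} {w′ j} {Piece.0ᴹ j {H}} (R .others j j≢i) (R′ .others j j≢i))
            (Piece.+ᴹ-identityˡ j {H} (Piece.0ᴹ j {H}))
        ; this    = Piece.+ᴹ-cong i {H} {w i} {z , R .inStep} {w′ i} {z′ , R′ .inStep} (R .this) (R′ .this)
        ; matches = S/T.≈ᴹ-trans {H} {to {H} w⁺} {S/T._+ᴹ_ {H} (to {H} w) (to {H} w′)}
            {S/T._+ᴹ_ {H} (x , R .inS) (x′ , R′ .inS)}
            (To.+ᴹ-homo {H} w w′)
            (S/T.+ᴹ-cong {H} {to {H} w} {x , R .inS} {to {H} w′} {x′ , R′ .inS} (R .matches) (R′ .matches))
        }
        where
        w w′ w⁺ : Rep.∣_∣ (gr k F) H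
        w  = R .element
        w′ = R′ .element
        w⁺ = Gr._+ᴹ_ {H} w w′
      scale : ∀ a {x z} → Corresponds H x z → Corresponds H (Module._*ₗ_ (P.obj H) a x) (Module._*ₗ_ (M.obj H) a z)
      scale a {x} {z} R = record
        { element = aw
        ; inS     = IsSubmodule.*ₗ∈ isS a (R .inS)
        ; inStep  = IsSubmodule.*ₗ∈ isStep a (R .inStep)
        ; others  = λ j j≢i → Piece.≈ᴹ-trans j {H} {aw j} {Piece._*ₗ_ j {H} a (Piece.0ᴹ j {H})} {Piece.0ᴹ j {H}}
            (Piece.*ₗ-congˡ j {H} {a} {w j} {Piece.0ᴹ j {H}} (R .others j j≢i)) (Piece.*ₗ-zeroʳ j {H} a)
        ; this    = Piece.*ₗ-congˡ i {H} {a} {w i} {z , R .inStep} (R .this)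
        ; matches = S/T.≈ᴹ-trans {H} {to {H} aw} {S/T._*ₗ_ {H} a (to {H} w)} {S/T._*ₗ_ {H} a (x , R .inS)}
            (To.*ₗ-homo {H} a w) (S/T.*ₗ-congˡ {H} {a} {to {H} w} {x , R .inS} (R .matches))
        }
        where
        w aw : Rep.∣_∣ (gr k F) H
        w  = R .element
        aw = Gr._*ₗ_ {H} a w

    Corresponds-map : ∀ {H J} (φ : Contraction H J) {x z} → Corresponds J x z → Corresponds H (P.map φ x) (M.map φ z)
    Corresponds-map {H} {J} φ {x} {z} R = record
      { element = Rep.map (gr k F) φ w
      ; inS     = S.stable φ (R .inS)
      ; inStep  = Step.stable (suc i) φ (R .inStep)
      ; others  = λ j j≢i → Piece.≈ᴹ-trans j {H} {Rep.map (piece j) φ (w j)}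
          {Rep.map (piece j) φ (Piece.0ᴹ j {J})} {Piece.0ᴹ j {H}}
          (PieceMap.⟦⟧-cong j {w j} {Piece.0ᴹ j {J}} (R .others j j≢i)) (PieceMap.0ᴹ-homo j)
      ; this    = PieceMap.⟦⟧-cong i {w i} {z , R .inStep} (R .this)
      ; matches = S/T.≈ᴹ-trans {H} {to {H} (Rep.map (gr k F) φ w)} {S/Tmap (to {J} w)} {S/Tmap (x , R .inS)}
          (natural φ w) (S/TMap.⟦⟧-cong {to {J} w} {x , R .inS} (R .matches))
      }
      where
      w : Rep.∣_∣ (gr k F) J
      w = R .element
      S/Tmap : Rep.∣_∣ (subquotient k S T) J → Rep.∣_∣ (subquotient k S T) H
      S/Tmap = Rep.map (subquotient k S T) φ
      module PieceMap j = ModuleMorphisms.IsModuleHomomorphism (Rep.map-homo (piece j) φ)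
      module S/TMap = ModuleMorphisms.IsModuleHomomorphism (Rep.map-homo (subquotient k S T) φ)

    -- The preimage in `S` of the image of the `i`-th graded piece. It exhibits that piece as a
    -- subquotient of `P`, namely the quotient of `part` by `T`.
    part : Subrep k P
    part = record
      { carrier     = λ H x → ∃[ z ] Corresponds H x z
      ; isSubmodule = λ {H} → record
          { resp = λ { p (z , R) → z , LinearRelation.R-resp (linearRelation H) p (ObjM.≈ᴹ-refl {H}) R }
          ; 0∈   = _ , LinearRelation.R-0 (linearRelation H)
          ; +∈   = λ { (_ , R) (_ , R′) → _ , LinearRelation.R-+ (linearRelation H) R R′ }
          ; *ₗ∈  = λ { a (_ , R) → _ , LinearRelation.R-* (linearRelation H) a R }
          }
      ; stable      = λ { φ (z , R) → M.map φ z , Corresponds-map φ R }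
      }

    T⊆part : ∀ H {x} → T.carrier H x → Subrep.carrier part H x
    T⊆part H {x} t = Module.0ᴹ (M.obj H) , record
      { element = Gr.0ᴹ {H}
      ; inS     = T⊆S H t
      ; inStep  = IsSubmodule.0∈ (Step.isSubmodule (suc i) {H})
      ; others  = λ j _ → Piece.≈ᴹ-refl j {H} {Piece.0ᴹ j {H}}
      ; this    = Piece.≈ᴹ-refl i {H} {Piece.0ᴹ i {H}}
      ; matches = S/T.≈ᴹ-trans {H} {to {H} (Gr.0ᴹ {H})} {S/T.0ᴹ {H}} {x , T⊆S H t} (To.0ᴹ-homo {H})
          (S/T.≈ᴹ-sym {H} {x , T⊆S H t} {S/T.0ᴹ {H}} (QuotientP.∈⇒≈0 {H} (T⊆S H t) t))
      }

    Corresponds-onto : ∀ H {z} → Step.carrier (suc i) H z → ∃[ x ] Subrep.carrier part H x × Corresponds H x z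
    Corresponds-onto H {z} z∈ = proj₁ (to {H} w) , (z , R) , R
      where
      -- The element of the direct sum concentrated in position `i`. The decision is passed as an
      -- argument so that `off-i` and `at-i` can split on it.
      component : ∀ j → Dec (j ≡ i) → Piece.Carrierᴹ j {H}
      component j (yes refl) = z , z∈
      component j (no _)     = Piece.0ᴹ j {H}
      w : Rep.∣_∣ (gr k F) H
      w j = component j (j ≟ i)
      off-i : ∀ j (j≟i : Dec (j ≡ i)) → j ≢ i → Piece._≈ᴹ_ j {H} (component j j≟i) (Piece.0ᴹ j {H})
      off-i j (yes p) j≢i = ⊥-elim (j≢i p)
      off-i j (no _)  j≢i = Piece.≈ᴹ-refl j {H} {Piece.0ᴹ j {H}}
      at-i : (i≟i : Dec (i ≡ i)) → Piece._≈ᴹ_ i {H} (component i i≟i) (z , z∈)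
      at-i (yes refl) = Piece.≈ᴹ-refl i {H} {z , z∈}
      at-i (no i≢i)   = ⊥-elim (i≢i refl)
      R : Corresponds H (proj₁ (to {H} w)) z
      R = record
        { element = w
        ; inS     = proj₂ (to {H} w)
        ; inStep  = z∈
        ; others  = λ j → off-i j (j ≟ i)
        ; this    = at-i (i ≟ i)
        ; matches = S/T.≈ᴹ-refl {H} {to {H} w}
        }

    -- Injectivity of the isomorphism: the class of `x` is zero, hence so is the element of the
    -- direct sum, and with it the class of `z`.
    Corresponds-T : ∀ H {x z} → Corresponds H x z → T.carrier H x → Step.carrier (inject₁ i) H z
    Corresponds-T H {x} {z} R t = QuotientM.≈0⇒∈ i {H} (R .inStep)
      (Piece.≈ᴹ-trans i {H} {z , R .inStep} {w i} {Piece.0ᴹ i {H}}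
        (Piece.≈ᴹ-sym i {H} {w i} {z , R .inStep} (R .this)) (w≈0 i))
      where
      w : Rep.∣_∣ (gr k F) H
      w = R .element
      w≈0 : Gr._≈ᴹ_ {H} w (Gr.0ᴹ {H})
      w≈0 = To.injective {H} {w} {Gr.0ᴹ {H}} (S/T.≈ᴹ-trans {H} {to {H} w} {x , R .inS} {to {H} (Gr.0ᴹ {H})} (R .matches)
        (S/T.≈ᴹ-trans {H} {x , R .inS} {S/T.0ᴹ {H}} {to {H} (Gr.0ᴹ {H})} (QuotientP.∈⇒≈0 {H} (R .inS) t)
          (S/T.≈ᴹ-sym {H} {to {H} (Gr.0ᴹ {H})} {S/T.0ᴹ {H}} (To.0ᴹ-homo {H}))))

    -- All components away from `i` are zero by `others`, and the one at `i` is the class of `z`, so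
    -- the isomorphism sends the element to zero.
    Corresponds-T⁻¹ : ∀ H {x z} → Corresponds H x z → Step.carrier (inject₁ i) H z → T.carrier H x
    Corresponds-T⁻¹ H {x} {z} R z∈ = QuotientP.≈0⇒∈ {H} (R .inS)
      (S/T.≈ᴹ-trans {H} {x , R .inS} {to {H} w} {S/T.0ᴹ {H}} (S/T.≈ᴹ-sym {H} {to {H} w} {x , R .inS} (R .matches))
        (S/T.≈ᴹ-trans {H} {to {H} w} {to {H} (Gr.0ᴹ {H})} {S/T.0ᴹ {H}} (To.⟦⟧-cong {H} {w} {Gr.0ᴹ {H}} w≈0)
                (To.0ᴹ-homo {H})))
      where
      w : Rep.∣_∣ (gr k F) H
      w = R .element
      component≈0 : ∀ j → Dec (j ≡ i) → Piece._≈ᴹ_ j {H} (w j) (Piece.0ᴹ j {H})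
      component≈0 j (yes refl) = Piece.≈ᴹ-trans i {H} {w i} {z , R .inStep} {Piece.0ᴹ i {H}} (R .this)
              (QuotientM.∈⇒≈0 i {H} (R .inStep) z∈)
      component≈0 j (no j≢i)   = R .others j j≢i
      w≈0 : Gr._≈ᴹ_ {H} w (Gr.0ᴹ {H})
      w≈0 j = component≈0 j (j ≟ i)

    relativeBasis-piece : ∀ H {n} →
      Subspaces.RelativeBasis em k (P.obj H) (Subrep.carrier part H) (T.carrier H) n →
      Subspaces.RelativeBasis em k (M.obj H) (Step.carrier (suc i) H) (Step.carrier (inject₁ i) H) n
    relativeBasis-piece H = relativeBasis-transport em k (linearRelation H)
      id inStep (Corresponds-onto H) (Corresponds-T H) (Corresponds-T⁻¹ H) (T.isSubmodule {H})

  dimension-filtered : ∀ H (n : Fin #steps → ℕ) →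
    (∀ i → Subspaces.RelativeBasis em k (P.obj H) (Subrep.carrier (part i) H) (T.carrier H) (n i)) →
    HasDimension (M.obj H) (∑ℕ n)
  dimension-filtered H n B = relativeBasis-dimension (top H) (bottom H _) (Step.isSubmodule zero {H})
    (relativeBasis-filtration #steps (λ i → Step.carrier i H) (λ i → Step.isSubmodule i {H}) (λ i → mono i H _) n
      (λ i → relativeBasis-piece i H (B i)))
    where open Subspaces em k (M.obj H)

-- From words of leaves back to `G ⟨ v , m ⟩`, and the conclusion

module _ {g : ℕ} (G : GraphOfGenus g) {r : ℕ} (v : Vector (V (graph G)) r) (m : Vector ℕ r) where

  private
    at : Fin (∑ℕ m) → V (graph G)
    at = v ∘ block m

    sprouted : GraphOfGenus g
    sprouted = sprout G (lookup (List.tabulate at))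

  toSprout : Contraction (G ⟨ v , m ⟩) sprouted
  toSprout = record { morphism      = contractLeaves {graph G} (toTabulate at)
                    ; isContraction = contractLeaves-isContraction {graph G} (toTabulate at) }

  fromSprout : Contraction sprouted (G ⟨ v , m ⟩)
  fromSprout = record { morphism      = contractLeaves {graph G} (fromTabulate at)
                      ; isContraction = contractLeaves-isContraction {graph G} (fromTabulate at) }

  to-fromSprout : morphism toSprout ∘ₘ morphism fromSprout ≈ₘ idₘ
  to-fromSprout = contractLeaves-inverse {graph G} (fromTabulate at) (toTabulate at)
    (λ i → cong just (cast-involutive (sym (length-tabulate at)) (length-tabulate at) i))

  from-toSprout : morphism fromSprout ∘ₘ morphism toSprout ≈ₘ idₘ
  from-toSprout = contractLeaves-inverse {graph G} (toTabulate at) (fromTabulate at)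
    (λ i → cong just (cast-involutive (length-tabulate at) (sym (length-tabulate at)) i))

  dimension-sprout : ∀ {c} (em : ExcludedMiddle c) (k : Field c) (M : Rep k g) {n} →
    LinearAlgebra.HasDimension (Field.commutativeRing k) (Rep.obj M sprouted) n →
    LinearAlgebra.HasDimension (Field.commutativeRing k) (Rep.obj M (G ⟨ v , m ⟩)) n
  dimension-sprout em k M = dimension-iso em k {obj sprouted} {obj (G ⟨ v , m ⟩)} (map-homo toSprout)
          (map-homo fromSprout)
    (inverse sprouted (G ⟨ v , m ⟩) toSprout fromSprout to-fromSprout)
    (inverse (G ⟨ v , m ⟩) sprouted fromSprout toSprout from-toSprout)
    where
    open Rep M
    inverse : ∀ H J (φ : Contraction J H) (ψ : Contraction H J) → morphism φ ∘ₘ morphism ψ ≈ₘ idₘ →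
              ∀ x → map ψ (map φ x) ≈ x
    inverse H J φ ψ φψ≈id x = ≈ᴹ-trans (≈ᴹ-sym (map-∘ φ ψ x)) (≈ᴹ-trans (map-resp (φ ∘ᶜ ψ) idᶜ φψ≈id x) (map-id x))
      where open Module (obj H)

corollary4p7 : (∀ {ℓ} → ExcludedMiddle ℓ) →
    ∀ {c} (k : Field c) (g d : ℕ) (M : Rep k g) → Smallish k d M →
    (G : GraphOfGenus g) (r : ℕ) (v : Vector (V (graph G)) r) → Injective _≡_ _≡_ v →
    Σ[ f ∈ Polynomial r ] TotalDegree≤ d f ×
    (∃[ N ] ((m : Vector ℕ r) → (∀ i → N ≤ m i) →
    ∃[ n ] LinearAlgebra.HasDimension (Field.commutativeRing k) (Rep.obj M (G ⟨ v , m ⟩)) n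
    × fromℕℚ n ≡ evaluate f (fromℕℚ ∘ m)))
corollary4p7 em {c} k g d M (F , P , fg , S , T , T⊆S , iso) G r v _ =
  polynomial , totalDegree≤ , threshold , λ m large →
    dim m , dimension-sprout G v m em k M (hasDimension m) , agrees m large
  where
  open Leaves em k G
  open Generated d P fg
  open Graded (em {c}) k M F P S T (λ H → T⊆S H _) iso
  word-of : Vector ℕ r → List (V (graph G))
  word-of m = word (Vec.tabulate v) (Vec.tabulate m)
  #part : Fin (Filtration.length F) → Vector ℕ r → ℕ
  #part i m = #leading (part i) T (T⊆part i) (word-of m) bound
  dim : Vector ℕ r → ℕ
  dim m = ∑ℕ (λ i → #part i m)
  hasDimension : ∀ m → LinearAlgebra.HasDimension (Field.commutativeRing k)
                         (Rep.obj M (leaves (List.tabulate (v ∘ block m)))) (dim m)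
  -- The leaves of `G ⟨ v , m ⟩` come in consecutive blocks, so listing them gives the word in which
  -- embeddings were counted.
  hasDimension m = subst (λ l → LinearAlgebra.HasDimension (Field.commutativeRing k) (Rep.obj M (leaves l)) (dim m))
    (sym (word-tabulate v m))
    (dimension-filtered (leaves (word-of m)) (λ i → #part i m)
      (λ i → relativeBasis-leaves (part i) T (T⊆part i) (word-of m)))
  open EventuallyPolynomial (eventually-∑ {D = d} (Filtration.length F) {#part}
    (λ i → #leading-eventually (part i) T (T⊆part i) v bound))
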